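{- There is a non-adaptive $O(1)$-approximation algorithm for the Stoch-Cost $k$-TSP problem, i.e. a non-adaptive policy whose expected total cost (tour length plus cost of selected vertices) is at most a universal constant times the expected total cost of the optimal adaptive policy.
   Context: Stoch-Cost $k$-TSP: We are given a finite metric $(V,d)$ with a designated vertex $\mathsf{root}\in V$, a target $k\in\mathbb{Z}_{\ge 0}$, and for each vertex $v\in V$ an independent nonnegative random cost $C_v\in\mathbb{R}_{\ge 0}$ whose (discrete) distribution is given explicitly as input. The actual value of $C_v$ is revealed only when $v$ is visited. A vertex $v$ can be selected only if (1) $v$ has been visited and (2) the tour is currently at $v$. The goal is to adaptively find a tour $\Pi$ originating at $\mathsf{root}$ and select a set $S$ of $k$ visited vertices so as to minimize $\mathbb{E}[d(\Pi)+\sum_{v\in S}C_v]$, where $d(\Pi)$ is the length of the tour. An adaptive algorithm may base its decisions on already revealed costs; a non-adaptive algorithm fixes an ordered list of vertices in advance and visits them in that order (with selection and stopping rules applied along the way). An algorithm is an $\alpha$-approximation if its expected objective is at most $\alpha$ times that of the optimal adaptive algorithm.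
   Formalization: The distances of the metric, the possible values of the costs C_v and their probabilities are rational numbers here, where the English allows real ones. -}

module Defs where

open import Data.Nat using (ℕ; zero; suc) renaming (_≤_ to _≤ℕ_)
open import Data.Fin using (Fin; _≟_) renaming (zero to fzero; suc to fsuc)
open import Data.Integer using (+_)
open import Data.Rational using (ℚ; 0ℚ; 1ℚ; _+_; _*_; _≤_; _<_; _/_)
open import Data.List using (List; []; _∷_; length)
open import Data.List.Membership.Propositional using (_∉_)
open import Data.Maybe using (Maybe; just; nothing)
open import Data.Product using (Σ; _,_; _×_)
open import Data.Unit using (⊤)
open import Data.Empty using (⊥)
open import Relation.Binary.PropositionalEquality using (_≡_; refl)
open import Relation.Nullary using (yes; no)

sumFin : (n : ℕ) → (Fin n → ℚ) → ℚ
sumFin zero    f = 0ℚ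
sumFin (suc n) f = f fzero + sumFin n (λ i → f (fsuc i))

ℕ→ℚ : ℕ → ℚ
ℕ→ℚ c = + c / 1

-- Raw data of a Stoch-Cost k-TSP instance.  Vertices are Fin n.
-- The (discrete) distribution of C_v has support {val v o | o : Fin (m v)},
-- with  Pr[C_v = val v o] = prob v o.
record Instance : Set where
  field
    n    : ℕ
    root : Fin n
    d    : Fin n → Fin n → ℚ
    k    : ℕ
    m    : Fin n → ℕ
    val  : (v : Fin n) → Fin (m v) → ℚ
    prob : (v : Fin n) → Fin (m v) → ℚ

open Instance public

record ValidInstance (I : Instance) : Set where
  field
    d-nonneg : ∀ u v → 0ℚ ≤ d I u v
    d-refl   : ∀ v → d I v v ≡ 0ℚ
    d-sym    : ∀ u v → d I u v ≡ d I v u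
    d-tri    : ∀ u v w → d I u w ≤ d I u v + d I v w
    val-nonneg : ∀ v o → 0ℚ ≤ val I v o
    prob-pos   : ∀ v o → 0ℚ < prob I v o
    prob-sum   : ∀ v → sumFin (m I v) (prob I v) ≡ 1ℚ
    k≤n        : k I ≤ℕ n I

-- An adaptive policy is a finite decision tree:
--   stop       : end the tour (it returns to the root),
--   select t   : select the vertex the tour is currently at, continue with t,
--   move v f   : travel to v; if C_v is not yet revealed it is revealed now
--                and the policy continues with f o where C_v = val v o
--                (if C_v was already revealed as outcome o, continue with f o).
data Policy (I : Instance) : Set where
  stop   : Policy I
  select : Policy I → Policy I
  move   : (v : Fin (n I)) → ((o : Fin (m I v)) → Policy I) → Policy I

Revealed : Instance → Set
Revealed I = List (Σ (Fin (n I)) (λ v → Fin (m I v)))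

lookupRev : (I : Instance) → Revealed I → (v : Fin (n I)) → Maybe (Fin (m I v))
lookupRev I [] v = nothing
lookupRev I ((u , o) ∷ r) v with u ≟ v
... | yes refl = just o
... | no _     = lookupRev I r v

record State (I : Instance) : Set where
  constructor st
  field
    pos : Fin (n I)
    rev : Revealed I
    sel : List (Fin (n I))

open State public

-- Initial state: at the root, nothing revealed yet, nothing selected.
-- (The root's cost is revealed by the zero-length move  move root.)
start : (I : Instance) → State I
start I = st (root I) [] []

cost : (I : Instance) → Policy I → State I → ℚ
cost I stop s = d I (pos s) (root I)
cost I (select t) s with lookupRev I (rev s) (pos s)
... | just o  = val I (pos s) o + cost I t (st (pos s) (rev s) (pos s ∷ sel s))
... | nothing = 0ℚ   -- not allowed; excluded by Feasible
cost I (move v f) s with lookupRev I (rev s) v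
... | just o  = d I (pos s) v + cost I (f o) (st v (rev s) (sel s))
... | nothing = d I (pos s) v
                + sumFin (m I v) (λ o → prob I v o * cost I (f o) (st v ((v , o) ∷ rev s) (sel s)))

Feasible : (I : Instance) → Policy I → State I → Set
Feasible I stop s = length (sel s) ≡ k I
Feasible I (select t) s with lookupRev I (rev s) (pos s)
... | just o  = (pos s ∉ sel s) × Feasible I t (st (pos s) (rev s) (pos s ∷ sel s))
... | nothing = ⊥
Feasible I (move v f) s with lookupRev I (rev s) v
... | just o  = Feasible I (f o) (st v (rev s) (sel s))
... | nothing = (o : Fin (m I v)) → Feasible I (f o) (st v ((v , o) ∷ rev s) (sel s))

-- A policy is non-adaptive w.r.t. the fixed ordered list L of vertices if,
-- on every realisation, the vertices it moves to are exactly a prefix of L,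
-- in this order (only the selection and stopping decisions may depend on the
-- revealed costs).
FollowsOrder : (I : Instance) → List (Fin (n I)) → Policy I → Set
FollowsOrder I L stop = ⊤
FollowsOrder I L (select t) = FollowsOrder I L t
FollowsOrder I [] (move v f) = ⊥
FollowsOrder I (u ∷ L) (move v f) = (v ≡ u) × ((o : Fin (m I v)) → FollowsOrder I L (f o))

NonAdaptive : (I : Instance) → Policy I → Set
NonAdaptive I t = Σ (List (Fin (n I))) (λ L → FollowsOrder I L t)

-- Let T* be the optimal adaptive exploration, A its expected cost, and let phase i have budget
-- B = βⁱA.  The non-adaptive tour is built by adding, in every phase, two root-to-leaf paths of T*
-- of cost at most B.  It "fails" on a world (a realisation of all costs) if its visited set V does not
-- contain k vertices of total cost O(B).
--
-- One phase multiplies the failure probability by 23/24, up to the probability that T* itself costs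
-- more than B.  Take three independent worlds a, b, d in which V fails.  If T* succeeds in all three,
-- then with probability at least 1/8 one of them is repaired by the paths that T* takes in the other
-- two; by symmetry and averaging, two suitable paths can be fixed.  The reason is a tug of war: at a price
-- level λ, let X be the sum of (1 - c/λ)⁺ over visited vertices (or the number of affordable ones).
-- If all three worlds still fail, then in each of them the vertices explored by its own path beat
-- those explored by the other two, although, added over the three worlds, the latter have twice
-- the mean of the former.  Since the deficits k - X decrease in λ, all three failures can be read off
-- at one common level.  Where the deficit is large the event is excluded by a self-normalised
-- Chebyshev bound, whose error terms are summable over dyadic levels; at the last level its
-- probability is bounded by a product martingale.  Both hold conditionally on the
-- costs in V, which are independent of those outside V.
--
-- Hence the sum over i of βⁱ Pr[phase i fails] is O(1), which bounds the expected cost by O(A).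
module Submission where

open import Defs
open import Data.Bool using (Bool; true; false; T; _∨_; _∧_; not; if_then_else_)
open import Data.Empty using (⊥)
open import Data.Fin using (Fin; zero; suc)
import Data.Fin as F
import Data.Fin.Properties as FP
open import Data.Integer using () renaming (+_ to ⁺_)
import Data.Integer as ℤ
import Data.Integer.Properties as ℤP
open import Data.List using (List; []; _∷_; _++_; length; foldr; allFin; map; concatMap)
import Data.List as L
import Data.List.Properties as LP
open import Data.List.Membership.Propositional using (_∈_; _∉_)
import Data.List.Membership.DecPropositional as DecMem
import Data.List.Relation.Unary.Unique.DecPropositional as DecUnique
import Data.List.Membership.Propositional.Properties as MP
open import Data.List.Relation.Unary.All using (All; []; _∷_)
import Data.List.Relation.Unary.All as All
open import Data.List.Relation.Unary.Any using (here; there; _─_)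
open import Data.List.Relation.Unary.Unique.Propositional using (Unique)
import Data.List.Relation.Unary.Unique.Propositional.Properties as UP
open import Data.List.Relation.Unary.AllPairs using ([]; _∷_)
open import Data.Maybe using (Maybe; just; nothing)
open import Data.Nat using (ℕ; zero; suc)
import Data.Nat as ℕ
import Data.Nat.Properties as ℕP
open import Data.Product using (Σ; ∃; _×_; _,_; proj₁; proj₂)
open import Data.Rational using (ℚ; 0ℚ; 1ℚ; _+_; _*_; _-_; -_; _≤_; _<_; _/_; _≤?_; _≤ᵇ_; _⊔_)
import Data.Rational as Q
import Data.Rational.Properties as QP
import Data.Rational.Unnormalised as Qᵘ
import Data.Rational.Unnormalised.Properties as QᵘP
open import Data.Sum using (_⊎_; inj₁; inj₂)
open import Data.Unit using (tt)
open import Function using (_∘_)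
open import Level using (0ℓ)
open import Relation.Binary.PropositionalEquality using (_≡_; _≢_; refl; sym; trans; cong; cong₂; subst; subst₂)
open import Relation.Nullary using (¬_; ¬?; Dec; yes; no; does; contradiction)
open import Tactic.RingSolver using (solve-∀)
open import Tactic.RingSolver.Core.AlmostCommutativeRing using (AlmostCommutativeRing; fromCommutativeRing)

-- The failure test is linear programming duality: the `k` cheapest of the visited vertices cost the
-- maximum over λ of `λ (k - X)`, where `X` is the truncated sum at price λ. Sums over vertices can
-- be compared between paths vertex by vertex, minima over `k`-subsets cannot. Restricting λ to
-- dyadic prices loses only a constant factor. Three worlds create the drift. With two, a vertex
-- explored in just one of them would carry the signs 1 and -1, and nothing would push against two
-- persistent failures; with three it carries 1, -1, -1. The three worlds never share one
-- martingale. Two of them are fixed first, so that the set `U` they explore is constant while the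
-- third is drawn; the three ways of doing this meet only in a pointwise inequality between their
-- potentials. The factor 23/24 arises as follows: given failure in all three worlds, all three
-- failures persist with probability at most `7/8 = 3 (1/4 + 1/24)`, up to overruns of the optimum.
-- So the three indicators have total mean at most `2 + 7/8`, and by symmetry each has mean at most
-- a third of it.

ℚring : AlmostCommutativeRing 0ℓ 0ℓ
ℚring = fromCommutativeRing QP.+-*-commutativeRing isZero
  where
  isZero : ∀ x → Maybe (0ℚ ≡ x)
  isZero x with 0ℚ QP.≟ x
  ... | yes p = just p
  ... | no  _ = nothing

-- Rational arithmetic.

2ℚ 3ℚ ⅓ ¼ : ℚ
2ℚ = ⁺ 2 / 1
3ℚ = ⁺ 3 / 1
⅓  = ⁺ 1 / 3
¼  = ⁺ 1 / 4

lit≤ : ∀ {p q} → {_ : T (p ≤ᵇ q)} → p ≤ q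
lit≤ {p} {q} {t} = QP.≤ᵇ⇒≤ {p} {q} t

≤-by : ∀ {p q} r → 0ℚ ≤ r → q ≡ p + r → p ≤ q
≤-by {p} r 0≤r refl = subst (_≤ p + r) (QP.+-identityʳ p) (QP.+-monoʳ-≤ p 0≤r)

slack : ∀ {p q} → p ≤ q → 0ℚ ≤ q - p
slack {p} {q} h = subst (_≤ q - p) (QP.+-inverseʳ p) (QP.+-monoˡ-≤ (- p) h)

slack⁻¹ : ∀ {p q} → 0ℚ ≤ q - p → p ≤ q
slack⁻¹ {p} {q} h = ≤-by (q - p) h (eq p q)
  where
  eq : ∀ p q → q ≡ p + (q - p)
  eq = solve-∀ ℚring

+-nn : ∀ {p q} → 0ℚ ≤ p → 0ℚ ≤ q → 0ℚ ≤ p + q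
+-nn = QP.+-mono-≤

*-nn : ∀ {p q} → 0ℚ ≤ p → 0ℚ ≤ q → 0ℚ ≤ p * q
*-nn {p} {q} 0≤p 0≤q = subst (_≤ p * q) (QP.*-zeroʳ p)
  (QP.*-monoˡ-≤-nonNeg p {{Q.nonNegative 0≤p}} 0≤q)

*-monoˡ : ∀ {c p q} → 0ℚ ≤ c → p ≤ q → c * p ≤ c * q
*-monoˡ {c} 0≤c = QP.*-monoˡ-≤-nonNeg c {{Q.nonNegative 0≤c}}

*-monoʳ : ∀ {c p q} → 0ℚ ≤ c → p ≤ q → p * c ≤ q * c
*-monoʳ {c} 0≤c = QP.*-monoʳ-≤-nonNeg c {{Q.nonNegative 0≤c}}

*-mono : ∀ {p q r s} → 0ℚ ≤ p → 0ℚ ≤ s → p ≤ q → r ≤ s → p * r ≤ q * s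
*-mono 0≤p 0≤s p≤q r≤s = QP.≤-trans (*-monoˡ 0≤p r≤s) (*-monoʳ 0≤s p≤q)

*-cancelˡ : ∀ {c p q} → 0ℚ < c → c * p ≤ c * q → p ≤ q
*-cancelˡ {c} 0<c = QP.*-cancelˡ-≤-pos c {{Q.positive 0<c}}

*-pos : ∀ {p q} → 0ℚ < p → 0ℚ < q → 0ℚ < p * q
*-pos {p} {q} 0<p 0<q = subst (_< p * q) (QP.*-zeroʳ p)
  (QP.*-monoʳ-<-pos p {{Q.positive 0<p}} 0<q)

sq-nn : ∀ p → 0ℚ ≤ p * p
sq-nn p with QP.≤-total 0ℚ p
... | inj₁ 0≤p = *-nn 0≤p 0≤p
... | inj₂ p≤0 = subst (0ℚ ≤_) (eq p) (*-nn 0≤-p 0≤-p)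
  where
  eq : ∀ p → (- p) * (- p) ≡ p * p
  eq = solve-∀ ℚring
  0≤-p : 0ℚ ≤ - p
  0≤-p = subst (0ℚ ≤_) (QP.+-identityˡ (- p)) (slack p≤0)

abstract
  ≤⊎> : ∀ p q → p ≤ q ⊎ q < p
  ≤⊎> p q with p ≤? q
  ... | yes h = inj₁ h
  ... | no  h = inj₂ (QP.≰⇒> h)

abstract
  posPart : ℚ → ℚ
  posPart p = 0ℚ ⊔ p

  posPart-nn : ∀ p → 0ℚ ≤ posPart p
  posPart-nn p = QP.p≤p⊔q 0ℚ p

  ≤posPart : ∀ p → p ≤ posPart p
  ≤posPart p = QP.p≤q⊔p 0ℚ p

  posPart-lub : ∀ {p q} → 0ℚ ≤ q → p ≤ q → posPart p ≤ q
  posPart-lub 0≤q p≤q = QP.⊔-lub 0≤q p≤q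

isLeft : ∀ {A B : Set} → A ⊎ B → Bool
isLeft (inj₁ _) = true
isLeft (inj₂ _) = false

leq : ℚ → ℚ → Bool
leq p q = isLeft (≤⊎> p q)

<⇒¬≤ : ∀ {p q} → p < q → ¬ (q ≤ p)
<⇒¬≤ p<q q≤p = QP.<-irrefl refl (QP.<-≤-trans p<q q≤p)

-- Junk value: inv 0 = 0.
inv : ℚ → ℚ
inv x with x QP.≟ 0ℚ
... | yes _   = 0ℚ
... | no  x≢0 = Q.1/_ x {{Q.≢-nonZero x≢0}}

*-inv : ∀ {x} → 0ℚ < x → x * inv x ≡ 1ℚ
*-inv {x} 0<x with x QP.≟ 0ℚ
... | yes refl = contradiction 0<x (QP.<-irrefl refl)
... | no  x≢0  = QP.*-inverseʳ x {{Q.≢-nonZero x≢0}}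

inv-pos : ∀ {x} → 0ℚ < x → 0ℚ < inv x
inv-pos {x} 0<x with ≤⊎> (inv x) 0ℚ
... | inj₂ h = h
... | inj₁ h = contradiction
  (QP.≤-trans (QP.≤-reflexive (sym (*-inv 0<x)))
    (QP.≤-trans (*-monoˡ (QP.<⇒≤ 0<x) h) (QP.≤-reflexive (QP.*-zeroʳ x))))
  (λ { (Q.*≤* (ℤ.+≤+ ())) })

1<⇒0< : ∀ {x} → 1ℚ ≤ x → 0ℚ < x
1<⇒0< h = QP.<-≤-trans (QP.positive⁻¹ 1ℚ) h

ℕ→ℚ-suc : ∀ n → ℕ→ℚ (suc n) ≡ 1ℚ + ℕ→ℚ n
ℕ→ℚ-suc n = QP.toℚᵘ-injective (QᵘP.≃-trans (QP.toℚᵘ-fromℚᵘ (Qᵘ.mkℚᵘ (⁺ suc n) 0))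
  (QᵘP.≃-trans eq (QᵘP.≃-sym (QᵘP.≃-trans (QP.toℚᵘ-homo-+ 1ℚ (ℕ→ℚ n))
    (QᵘP.+-congʳ Qᵘ.1ℚᵘ (QP.toℚᵘ-fromℚᵘ (Qᵘ.mkℚᵘ (⁺ n) 0)))))))
  where
  eq : Qᵘ.mkℚᵘ (⁺ suc n) 0 Qᵘ.≃ Qᵘ.1ℚᵘ Qᵘ.+ Qᵘ.mkℚᵘ (⁺ n) 0
  eq = Qᵘ.*≡* (cong (ℤ._* ⁺ 1) (cong (λ z → ⁺ 1 ℤ.+ z)
         (sym (ℤP.*-identityʳ (⁺ n)))))

ℕ→ℚ-nn : ∀ n → 0ℚ ≤ ℕ→ℚ n
ℕ→ℚ-nn zero    = QP.≤-refl
ℕ→ℚ-nn (suc n) = subst (0ℚ ≤_) (sym (ℕ→ℚ-suc n)) (+-nn (lit≤ {0ℚ} {1ℚ}) (ℕ→ℚ-nn n))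

ℕ→ℚ-mono : ∀ {a b} → a ℕ.≤ b → ℕ→ℚ a ≤ ℕ→ℚ b
ℕ→ℚ-mono {b = b} ℕ.z≤n = ℕ→ℚ-nn b
ℕ→ℚ-mono {suc a} {suc b} (ℕ.s≤s h) =
  subst₂ _≤_ (sym (ℕ→ℚ-suc a)) (sym (ℕ→ℚ-suc b)) (QP.+-monoʳ-≤ 1ℚ (ℕ→ℚ-mono h))

ℕ→ℚ-< : ∀ {a b} → a ℕ.< b → 1ℚ + ℕ→ℚ a ≤ ℕ→ℚ b
ℕ→ℚ-< {a} h = subst (_≤ _) (ℕ→ℚ-suc a) (ℕ→ℚ-mono h)

pow : ℚ → ℕ → ℚ
pow x zero    = 1ℚ
pow x (suc j) = x * pow x j

pow-nn : ∀ {x} j → 0ℚ ≤ x → 0ℚ ≤ pow x j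
pow-nn zero    0≤x = lit≤ {0ℚ} {1ℚ}
pow-nn (suc j) 0≤x = *-nn 0≤x (pow-nn j 0≤x)

pow2≥1 : ∀ j → 1ℚ ≤ pow 2ℚ j
pow2≥1 zero    = QP.≤-refl
pow2≥1 (suc j) = QP.≤-trans (pow2≥1 j) (≤-by (pow 2ℚ j) (pow-nn j (lit≤ {0ℚ} {2ℚ})) (eq (pow 2ℚ j)))
  where
  eq : ∀ p → 2ℚ * p ≡ p + p
  eq = solve-∀ ℚring

ℕ→ℚ≤pow2 : ∀ j → ℕ→ℚ j ≤ pow 2ℚ j
ℕ→ℚ≤pow2 zero    = lit≤ {0ℚ} {1ℚ}
ℕ→ℚ≤pow2 (suc j) = subst₂ _≤_ (sym (ℕ→ℚ-suc j)) (sym (eq (pow 2ℚ j))) (QP.+-mono-≤ (pow2≥1 j) (ℕ→ℚ≤pow2 j))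
  where
  eq : ∀ p → 2ℚ * p ≡ p + p
  eq = solve-∀ ℚring

𝟙 : Bool → ℚ
𝟙 true  = 1ℚ
𝟙 false = 0ℚ

𝟙-nn : ∀ b → 0ℚ ≤ 𝟙 b
𝟙-nn true  = lit≤ {0ℚ} {1ℚ}
𝟙-nn false = QP.≤-refl

𝟙≤1 : ∀ b → 𝟙 b ≤ 1ℚ
𝟙≤1 true  = QP.≤-refl
𝟙≤1 false = lit≤ {0ℚ} {1ℚ}

-- Finite sums.

sumFin-cong : ∀ n {f g : Fin n → ℚ} → (∀ i → f i ≡ g i) → sumFin n f ≡ sumFin n g
sumFin-cong zero    h = refl
sumFin-cong (suc n) h = cong₂ _+_ (h zero) (sumFin-cong n (h ∘ suc))

sumFin-mono : ∀ n {f g : Fin n → ℚ} → (∀ i → f i ≤ g i) → sumFin n f ≤ sumFin n g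
sumFin-mono zero    h = QP.≤-refl
sumFin-mono (suc n) h = QP.+-mono-≤ (h zero) (sumFin-mono n (h ∘ suc))

interchange : ∀ a b c d → (a + b) + (c + d) ≡ (a + c) + (b + d)
interchange = solve-∀ ℚring

sumFin-+ : ∀ n (f g : Fin n → ℚ) → sumFin n (λ i → f i + g i) ≡ sumFin n f + sumFin n g
sumFin-+ zero    f g = sym (QP.+-identityˡ 0ℚ)
sumFin-+ (suc n) f g = trans (cong ((f zero + g zero) +_) (sumFin-+ n (f ∘ suc) (g ∘ suc)))
  (interchange (f zero) (g zero) _ _)

sumFin-* : ∀ n c (f : Fin n → ℚ) → sumFin n (λ i → c * f i) ≡ c * sumFin n f
sumFin-* zero    c f = sym (QP.*-zeroʳ c)
sumFin-* (suc n) c f = trans (cong (c * f zero +_) (sumFin-* n c (f ∘ suc)))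
  (sym (QP.*-distribˡ-+ c (f zero) _))

sumFin-*ʳ : ∀ n c (f : Fin n → ℚ) → sumFin n (λ i → f i * c) ≡ sumFin n f * c
sumFin-*ʳ n c f = trans (sumFin-cong n (λ i → QP.*-comm (f i) c)) (trans (sumFin-* n c f) (QP.*-comm c _))

sumFin-0 : ∀ n → sumFin n (λ _ → 0ℚ) ≡ 0ℚ
sumFin-0 zero    = refl
sumFin-0 (suc n) = trans (QP.+-identityˡ _) (sumFin-0 n)

sumFin-swap : ∀ n m (f : Fin n → Fin m → ℚ) →
  sumFin n (λ i → sumFin m (f i)) ≡ sumFin m (λ j → sumFin n (λ i → f i j))
sumFin-swap zero    m f = sym (sumFin-0 m)
sumFin-swap (suc n) m f = trans (cong (sumFin m (f zero) +_) (sumFin-swap n m (f ∘ suc)))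
  (sym (sumFin-+ m (f zero) _))

sumL : ∀ {A : Set} → List A → (A → ℚ) → ℚ
sumL []       f = 0ℚ
sumL (x ∷ xs) f = f x + sumL xs f

module _ {A : Set} where

  sumL-cong : ∀ (xs : List A) {f g : A → ℚ} → (∀ {x} → x ∈ xs → f x ≡ g x) → sumL xs f ≡ sumL xs g
  sumL-cong []       h = refl
  sumL-cong (x ∷ xs) h = cong₂ _+_ (h (here refl)) (sumL-cong xs (h ∘ there))

  sumL-mono : ∀ (xs : List A) {f g : A → ℚ} → (∀ {x} → x ∈ xs → f x ≤ g x) → sumL xs f ≤ sumL xs g
  sumL-mono []       h = QP.≤-refl
  sumL-mono (x ∷ xs) h = QP.+-mono-≤ (h (here refl)) (sumL-mono xs (h ∘ there))

  sumL-+ : ∀ (xs : List A) f g → sumL xs (λ x → f x + g x) ≡ sumL xs f + sumL xs g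
  sumL-+ []       f g = sym (QP.+-identityˡ 0ℚ)
  sumL-+ (x ∷ xs) f g = trans (cong ((f x + g x) +_) (sumL-+ xs f g)) (interchange (f x) (g x) _ _)

  sumL-* : ∀ (xs : List A) c f → sumL xs (λ x → c * f x) ≡ c * sumL xs f
  sumL-* []       c f = sym (QP.*-zeroʳ c)
  sumL-* (x ∷ xs) c f = trans (cong (c * f x +_) (sumL-* xs c f)) (sym (QP.*-distribˡ-+ c (f x) _))

  sumL-nn : ∀ (xs : List A) {f : A → ℚ} → (∀ x → 0ℚ ≤ f x) → 0ℚ ≤ sumL xs f
  sumL-nn []       h = QP.≤-refl
  sumL-nn (x ∷ xs) h = +-nn (h x) (sumL-nn xs h)

  sumL-1 : ∀ (xs : List A) → sumL xs (λ _ → 1ℚ) ≡ ℕ→ℚ (length xs)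
  sumL-1 []       = refl
  sumL-1 (x ∷ xs) = trans (cong (1ℚ +_) (sumL-1 xs)) (sym (ℕ→ℚ-suc (length xs)))

  sumL-++ : ∀ (xs ys : List A) f → sumL (xs ++ ys) f ≡ sumL xs f + sumL ys f
  sumL-++ []       ys f = sym (QP.+-identityˡ _)
  sumL-++ (x ∷ xs) ys f = trans (cong (f x +_) (sumL-++ xs ys f)) (sym (QP.+-assoc (f x) _ _))

  sumL-─ : ∀ {xs : List A} {v} (i : v ∈ xs) f → sumL xs f ≡ f v + sumL (xs ─ i) f
  sumL-─ (here refl) f = refl
  sumL-─ {x ∷ xs} {v} (there i) f = trans (cong (f x +_) (sumL-─ i f)) (eq (f x) (f v) _)
    where
    eq : ∀ a b c → a + (b + c) ≡ b + (a + c)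
    eq = solve-∀ ℚring

  ∈-─⁻ : ∀ {xs : List A} {u v} (i : v ∈ xs) → u ∈ (xs ─ i) → u ∈ xs
  ∈-─⁻ (here refl) j         = there j
  ∈-─⁻ (there i)   (here p)  = here p
  ∈-─⁻ (there i)   (there j) = there (∈-─⁻ i j)

  ∈-─⁺ : ∀ {xs : List A} {u v} (i : v ∈ xs) → u ∈ xs → u ≢ v → u ∈ (xs ─ i)
  ∈-─⁺ (here refl) (here p)  u≢v = contradiction p u≢v
  ∈-─⁺ (here refl) (there j) u≢v = j
  ∈-─⁺ (there i)   (here p)  u≢v = here p
  ∈-─⁺ (there i)   (there j) u≢v = there (∈-─⁺ i j u≢v)

  All-─ : ∀ {P : A → Set} {xs : List A} {v} (i : v ∈ xs) → All P xs → All P (xs ─ i)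
  All-─ (here refl) (p ∷ ps) = ps
  All-─ (there i)   (p ∷ ps) = p ∷ All-─ i ps

  Unique-─ : ∀ {xs : List A} {v} (i : v ∈ xs) → Unique xs → Unique (xs ─ i)
  Unique-─ (here refl) (p ∷ u) = u
  Unique-─ (there i)   (p ∷ u) = All-─ i p ∷ Unique-─ i u

  ∉-─ : ∀ {xs : List A} {v} (i : v ∈ xs) → Unique xs → v ∉ (xs ─ i)
  ∉-─ (here refl) (p ∷ u) j         = All.lookup p j refl
  ∉-─ (there i)   (p ∷ u) (here refl) = All.lookup p i refl
  ∉-─ (there i)   (p ∷ u) (there j) = ∉-─ i u j

  length-─ : ∀ {xs : List A} {v} (i : v ∈ xs) → length xs ≡ suc (length (xs ─ i))
  length-─ (here refl) = refl
  length-─ (there i)   = cong suc (length-─ i)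

  sumL-⊆ : ∀ (S xs : List A) {f : A → ℚ} → (∀ x → 0ℚ ≤ f x) → Unique S → (∀ {v} → v ∈ S → v ∈ xs) →
    sumL S f ≤ sumL xs f
  sumL-⊆ []      xs h u sub = sumL-nn xs h
  sumL-⊆ (v ∷ S) xs {f} h (p ∷ u) sub = subst (f v + sumL S f ≤_) (sym (sumL-─ i f))
    (QP.+-monoʳ-≤ (f v) (sumL-⊆ S (xs ─ i) h u
      (λ j → ∈-─⁺ i (sub (there j)) (λ { refl → All.lookup p j refl }))))
    where i = sub (here refl)

-- Worlds and expectations under the product measure.

data World : (n : ℕ) → (Fin n → ℕ) → Set where
  []  : ∀ {m} → World zero m
  _∷_ : ∀ {n m} → Fin (m zero) → World n (m ∘ suc) → World (suc n) m

get : ∀ {n m} → World n m → (v : Fin n) → Fin (m v)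
get (o ∷ w) zero    = o
get (o ∷ w) (suc v) = get w v

set : ∀ {n m} → World n m → (v : Fin n) → Fin (m v) → World n m
set (_ ∷ w) zero    o  = o ∷ w
set (x ∷ w) (suc v) o = x ∷ set w v o

get-set : ∀ {n m} (w : World n m) v o → get (set w v o) v ≡ o
get-set (_ ∷ w) zero    o = refl
get-set (x ∷ w) (suc v) o = get-set w v o

get-set-≢ : ∀ {n m} (w : World n m) {v u} o → u ≢ v → get (set w v o) u ≡ get w u
get-set-≢ (x ∷ w) {zero}  {zero}  o u≢v = contradiction refl u≢v
get-set-≢ (x ∷ w) {zero}  {suc u} o u≢v = refl
get-set-≢ (x ∷ w) {suc v} {zero}  o u≢v = refl
get-set-≢ (x ∷ w) {suc v} {suc u} o u≢v = get-set-≢ w o (u≢v ∘ cong suc)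

world-ext : ∀ {n m} (w w′ : World n m) → (∀ v → get w v ≡ get w′ v) → w ≡ w′
world-ext []      []       h = refl
world-ext (o ∷ w) (o′ ∷ w′) h = cong₂ _∷_ (h zero) (world-ext w w′ (h ∘ suc))

Weights : (n : ℕ) → (Fin n → ℕ) → Set
Weights n m = (v : Fin n) → Fin (m v) → ℚ

record IsProb {n m} (p : Weights n m) : Set where
  field
    p-nn  : ∀ v o → 0ℚ ≤ p v o
    p-sum : ∀ v → sumFin (m v) (p v) ≡ 1ℚ

open IsProb public

E : ∀ {n m} → Weights n m → (World n m → ℚ) → ℚ
E {zero}      p g = g []
E {suc n} {m} p g = sumFin (m zero) (λ o → p zero o * E (λ v → p (suc v)) (λ w → g (o ∷ w)))

tailP : ∀ {n m} {p : Weights (suc n) m} → IsProb p → IsProb (λ v → p (suc v))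
tailP P = record { p-nn = λ v → p-nn P (suc v) ; p-sum = λ v → p-sum P (suc v) }

E-cong : ∀ {n m} (p : Weights n m) {f g} → (∀ w → f w ≡ g w) → E p f ≡ E p g
E-cong {zero}      p h = h []
E-cong {suc n} {m} p h =
  sumFin-cong (m zero) (λ o → cong (p zero o *_) (E-cong _ (λ w → h (o ∷ w))))

E-mono : ∀ {n m} {p : Weights n m} → IsProb p → ∀ {f g} → (∀ w → f w ≤ g w) → E p f ≤ E p g
E-mono {zero}      P h = h []
E-mono {suc n} {m} P h =
  sumFin-mono (m zero) (λ o → *-monoˡ (p-nn P zero o) (E-mono (tailP P) (λ w → h (o ∷ w))))

E-+ : ∀ {n m} (p : Weights n m) f g → E p (λ w → f w + g w) ≡ E p f + E p g
E-+ {zero}      p f g = refl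
E-+ {suc n} {m} p f g = trans
  (sumFin-cong (m zero) (λ o → trans (cong (p zero o *_) (E-+ (λ v → p (suc v)) _ _)) (QP.*-distribˡ-+ (p zero o) _ _)))
  (sumFin-+ (m zero) _ _)

E-* : ∀ {n m} (p : Weights n m) c f → E p (λ w → c * f w) ≡ c * E p f
E-* {zero}      p c f = refl
E-* {suc n} {m} p c f = trans
  (sumFin-cong (m zero) (λ o → trans (cong (p zero o *_) (E-* (λ v → p (suc v)) c _)) (eq (p zero o) c _)))
  (sumFin-* (m zero) c _)
  where
  eq : ∀ a b c → a * (b * c) ≡ b * (a * c)
  eq = solve-∀ ℚring

E-const : ∀ {n m} {p : Weights n m} → IsProb p → ∀ c → E p (λ _ → c) ≡ c
E-const {zero}      P c = refl
E-const {suc n} {m} {p} P c = trans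
  (sumFin-cong (m zero) (λ o → cong (p zero o *_) (E-const (tailP P) c)))
  (trans (sumFin-*ʳ (m zero) c (p zero)) (trans (cong (_* c) (p-sum P zero)) (QP.*-identityˡ c)))

E-nn : ∀ {n m} {p : Weights n m} → IsProb p → ∀ {f} → (∀ w → 0ℚ ≤ f w) → 0ℚ ≤ E p f
E-nn P {f} h = subst (_≤ E _ f) (E-const P 0ℚ) (E-mono P h)

E-sumFin : ∀ {n m} (p : Weights n m) l (f : Fin l → World n m → ℚ) →
  E p (λ w → sumFin l (λ i → f i w)) ≡ sumFin l (λ i → E p (f i))
E-sumFin {zero}      p l f = refl
E-sumFin {suc n} {m} p l f = trans
  (sumFin-cong (m zero) (λ o → trans (cong (p zero o *_) (E-sumFin (λ v → p (suc v)) l _)) (sym (sumFin-* l (p zero o) _))))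
  (sumFin-swap (m zero) l _)

E-swap : ∀ {n m n′ m′} (p : Weights n m) (p′ : Weights n′ m′) (f : World n m → World n′ m′ → ℚ) →
  E p (λ a → E p′ (f a)) ≡ E p′ (λ b → E p (λ a → f a b))
E-swap {zero}      p p′ f = refl
E-swap {suc n} {m} p p′ f = trans
  (sumFin-cong (m zero) (λ o → trans (cong (p zero o *_) (E-swap (λ v → p (suc v)) p′ _)) (sym (E-* p′ (p zero o) _))))
  (sym (E-sumFin p′ (m zero) _))

-- Independence of the coordinates: replacing coordinate `v` by a fresh draw leaves the law
-- unchanged.
E-set : ∀ {n m} {p : Weights n m} → IsProb p → ∀ v (g : World n m → ℚ) →
  E p g ≡ sumFin (m v) (λ o → p v o * E p (λ w → g (set w v o)))
E-set {suc n} {m} {p} P zero g = sumFin-cong (m zero) (λ o → cong (p zero o *_) (sym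
  (trans (sumFin-*ʳ (m zero) _ (p zero)) (trans (cong (_* E (λ v → p (suc v)) (λ w → g (o ∷ w))) (p-sum P zero)) (QP.*-identityˡ _)))))
E-set {suc n} {m} {p} P (suc v) g = trans
  (sumFin-cong (m zero) (λ o → trans (cong (p zero o *_) (E-set (tailP P) v _)) (sym (sumFin-* (m (suc v)) (p zero o) _))))
  (trans (sumFin-swap (m zero) (m (suc v)) _)
    (sumFin-cong (m (suc v)) (λ o′ → trans
      (sumFin-cong (m zero) (λ o → eq (p zero o) (p (suc v) o′) _))
      (sumFin-* (m zero) (p (suc v) o′) _))))
  where
  eq : ∀ a b c → a * (b * c) ≡ b * (a * c)
  eq = solve-∀ ℚring

argminFin : ∀ n → (f : Fin (suc n) → ℚ) → ∃ λ i → ∀ j → f i ≤ f j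
argminFin zero    f = zero , λ { zero → QP.≤-refl }
argminFin (suc n) f with argminFin n (f ∘ suc)
... | i , h with ≤⊎> (f zero) (f (suc i))
...   | inj₁ l = zero , λ { zero → QP.≤-refl ; (suc j) → QP.≤-trans l (h j) }
...   | inj₂ l = suc i , λ { zero → QP.<⇒≤ l ; (suc j) → h j }

argminFin′ : ∀ {n} → Fin n → (f : Fin n → ℚ) → ∃ λ i → ∀ j → f i ≤ f j
argminFin′ {suc n} _ f = argminFin n f

inhabited : ∀ n (f : Fin n → ℚ) → sumFin n f ≡ 1ℚ → Fin n
inhabited zero    f ()
inhabited (suc n) f _ = zero

someWorld : ∀ {n m} {p : Weights n m} → IsProb p → World n m
someWorld {zero}  P = []
someWorld {suc n} {m} {p} P = inhabited (m zero) (p zero) (p-sum P zero) ∷ someWorld (tailP P)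

argminWorld : ∀ {n m} {p : Weights n m} → IsProb p → (f : World n m → ℚ) → ∃ λ w → ∀ w′ → f w ≤ f w′
argminWorld {zero}  P f = [] , λ { [] → QP.≤-refl }
argminWorld {suc n} {m} {p} P f = (o ∷ proj₁ (best o)) , λ { (o′ ∷ w′) → QP.≤-trans (h o′) (proj₂ (best o′) w′) }
  where
  best : ∀ o → ∃ λ w → ∀ w′ → f (o ∷ w) ≤ f (o ∷ w′)
  best o = argminWorld (tailP P) (λ w → f (o ∷ w))
  r = argminFin′ (inhabited (m zero) (p zero) (p-sum P zero)) (λ o → f (o ∷ proj₁ (best o)))
  o = proj₁ r
  h = proj₂ r

allWorlds : ∀ n m → List (World n m)
allWorlds zero    m = [] ∷ []
allWorlds (suc n) m = concatMap (λ o → map (o ∷_) (allWorlds n (m ∘ suc))) (allFin (m zero))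

∈-allWorlds : ∀ {n m} (w : World n m) → w ∈ allWorlds n m
∈-allWorlds []      = here refl
∈-allWorlds (o ∷ w) = MP.∈-concat⁺′ (MP.∈-map⁺ (o ∷_) (∈-allWorlds w)) (MP.∈-map⁺ _ (MP.∈-allFin o))

set-comm : ∀ {n m} (w : World n m) {u v} a b → u ≢ v → set (set w u a) v b ≡ set (set w v b) u a
set-comm (x ∷ w) {zero}  {zero}  a b u≢v = contradiction refl u≢v
set-comm (x ∷ w) {zero}  {suc v} a b u≢v = refl
set-comm (x ∷ w) {suc u} {zero}  a b u≢v = refl
set-comm (x ∷ w) {suc u} {suc v} a b u≢v = cong (x ∷_) (set-comm w a b (u≢v ∘ cong suc))

-- Visited sets and exploration trees.

mem : ∀ {n} → List (Fin n) → Fin n → Bool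
mem []       u = false
mem (v ∷ xs) u = does (u FP.≟ v) ∨ mem xs u

mem-≢ : ∀ {n} (xs : List (Fin n)) {u v} → u ≢ v → mem (v ∷ xs) u ≡ mem xs u
mem-≢ xs {u} {v} u≢v with u FP.≟ v
... | yes eq = contradiction eq u≢v
... | no  _  = refl

mem-here : ∀ {n} (xs : List (Fin n)) v → mem (v ∷ xs) v ≡ true
mem-here xs v with v FP.≟ v
... | yes _ = refl
... | no  h = contradiction refl h

∈⇒mem : ∀ {n} {xs : List (Fin n)} {u} → u ∈ xs → mem xs u ≡ true
∈⇒mem {xs = v ∷ xs} {u} i with u FP.≟ v
... | yes _ = refl
∈⇒mem {xs = v ∷ xs} (here eq) | no h = contradiction eq h
∈⇒mem {xs = v ∷ xs} (there i) | no h = ∈⇒mem i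

mem⇒∈ : ∀ {n} (xs : List (Fin n)) {u} → mem xs u ≡ true → u ∈ xs
mem⇒∈ (v ∷ xs) {u} h with u FP.≟ v
... | yes eq = here eq
... | no  _  = there (mem⇒∈ xs h)

-- Adaptive exploration: `us` lists the vertices not visited yet; at a leaf, k visited vertices are selected.
record Leaf {n} (k : ℕ) (us : List (Fin n)) : Set where
  constructor leaf
  field
    picks  : List (Fin n)
    uniq   : Unique picks
    size   : length picks ≡ k
    out    : All (_∉ us) picks

open Leaf public

data Tree {n} (m : Fin n → ℕ) (k : ℕ) : List (Fin n) → Set where
  fin   : ∀ {us} → Leaf k us → Tree m k us
  visit : ∀ {us v} (i : v ∈ us) → (Fin (m v) → Tree m k (us ─ i)) → Tree m k us

path : ∀ {n m k us} → Tree {n} m k us → World n m → List (Fin n)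
path (fin _)           w = []
path (visit {v = v} i f) w = v ∷ path (f (get w v)) w

chosen : ∀ {n m k us} → Tree {n} m k us → World n m → List (Fin n)
chosen (fin l)             w = picks l
chosen (visit {v = v} i f) w = chosen (f (get w v)) w

-- A tree queries only vertices of `us`; in particular, each subtree below a visit of `v` ignores
-- coordinate `v`.
path-set : ∀ {n m k us} (T : Tree {n} m k us) w {v} o → v ∉ us → path T (set w v o) ≡ path T w
path-set (fin _) w o v∉ = refl
path-set (visit {v = u} i f) w {v} o v∉ =
  cong (u ∷_) (trans (cong (λ x → path (f x) (set w v o)) (get-set-≢ w o (λ { refl → v∉ i })))
    (path-set (f (get w u)) w o (v∉ ∘ ∈-─⁻ i)))

-- Supermartingales along an adaptive exploration.

module Supermartingale
  {n : ℕ} {m : Fin n → ℕ} {k : ℕ} {p : Weights n m} (P : IsProb p) (V : Fin n → Bool)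
  {S : Set} (st : (v : Fin n) → Fin (m v) → Bool → S → S)
  (Inv : S → Set) (inv-st : ∀ v o b s → Inv s → Inv (st v o b s))
  (st-comm : ∀ v o b v′ o′ b′ s → st v o b (st v′ o′ b′ s) ≡ st v′ o′ b′ (st v o b s))
  (Ψ : S → ℚ)
  (skip : ∀ v o b s → V v ≡ true → st v o b s ≡ s)
  (super : ∀ v b s → V v ≡ false → Inv s → sumFin (m v) (λ o → p v o * Ψ (st v o b s)) ≤ Ψ s)
  where

  -- Every vertex updates the state, also those that the path never meets: in the applications the
  -- unexplored vertices of `U` count negatively.
  fold : List (Fin n) → World n m → (Fin n → Bool) → S → S
  fold []       w y s = s
  fold (v ∷ us) w y s = fold us w y (st v (get w v) (y v) s)

  fold-cong : ∀ us w {y y′} s → (∀ {u} → u ∈ us → y u ≡ y′ u) → fold us w y s ≡ fold us w y′ s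
  fold-cong []       w s h = refl
  fold-cong (v ∷ us) w {y} {y′} s h = trans (fold-cong us w _ (h ∘ there))
    (cong (λ b → fold us w y′ (st v (get w v) b s)) (h (here refl)))

  fold-set : ∀ us w {v} o y s → v ∉ us → fold us (set w v o) y s ≡ fold us w y s
  fold-set []       w o y s v∉ = refl
  fold-set (u ∷ us) w {v} o y s v∉ = trans (fold-set us w o y _ (v∉ ∘ there))
    (cong (λ x → fold us w y (st u x (y u) s)) (get-set-≢ w o (λ { refl → v∉ (here refl) })))

  -- Commuting updates allow the vertex explored next to be processed first, although the order of
  -- `us` is fixed in advance.
  fold-─ : ∀ {us v} (i : v ∈ us) w y s → fold us w y s ≡ fold (us ─ i) w y (st v (get w v) (y v) s)
  fold-─ (here refl) w y s = refl
  fold-─ {u ∷ us} {v} (there i) w y s = trans (fold-─ i w y _)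
    (cong (fold (us ─ i) w y) (st-comm v _ _ u _ _ s))

  DependsOn : (World n m → ℚ) → Set
  DependsOn φ = ∀ w v o → V v ≡ false → φ (set w v o) ≡ φ w

  -- `φ` is quantified here because it changes in the induction: at a vertex of `V` it is replaced
  -- by its version with one outcome fixed.
  Bound : (World n m → S → S) → Set
  Bound F = ∀ φ s → DependsOn φ → (∀ w → 0ℚ ≤ φ w) → Inv s →
            E p (λ w → φ w * Ψ (F w s)) ≤ Ψ s * E p φ

  -- If `v` is in `V`, the state stands still while `φ` and the continuation may depend on the
  -- outcome, which is therefore fixed inside `φ`. Otherwise `φ` ignores the outcome and `super`
  -- pays for the update. The flag `b` is settled before the outcome is drawn, which is
  -- predictability.
  step : ∀ v b (F : Fin (m v) → World n m → S → S) →
    (∀ o w o′ s → F o (set w v o′) s ≡ F o w s) → (∀ o → Bound (F o)) →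
    Bound (λ w s → F (get w v) w (st v (get w v) b s))
  step v b F indep IH φ s dep φ-nn inv-s with V v in Vv
  ... | true = begin
      E p (λ w → φ w * Ψ (F (get w v) w (st v (get w v) b s)))
        ≡⟨ E-set P v _ ⟩
      sumFin (m v) (λ o → p v o * E p (λ w → φ (set w v o) * Ψ (F (get (set w v o) v) (set w v o) (st v (get (set w v o) v) b s))))
        ≡⟨ sumFin-cong (m v) (λ o → cong (p v o *_) (E-cong p (λ w → cong (φ (set w v o) *_) (cong Ψ (eq o w))))) ⟩
      sumFin (m v) (λ o → p v o * E p (λ w → φ (set w v o) * Ψ (F o w s)))
        ≤⟨ sumFin-mono (m v) (λ o → *-monoˡ (p-nn P v o) (IH o (λ w → φ (set w v o)) s (dep′ o) (λ w → φ-nn _) inv-s)) ⟩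
      sumFin (m v) (λ o → p v o * (Ψ s * E p (λ w → φ (set w v o))))
        ≡⟨ sumFin-cong (m v) (λ o → swap* (p v o) (Ψ s) _) ⟩
      sumFin (m v) (λ o → Ψ s * (p v o * E p (λ w → φ (set w v o))))
        ≡⟨ sumFin-* (m v) (Ψ s) _ ⟩
      Ψ s * sumFin (m v) (λ o → p v o * E p (λ w → φ (set w v o)))
        ≡⟨ cong (Ψ s *_) (sym (E-set P v φ)) ⟩
      Ψ s * E p φ ∎
    where
    open QP.≤-Reasoning
    swap* : ∀ a b c → a * (b * c) ≡ b * (a * c)
    swap* = solve-∀ ℚring
    eq : ∀ o w → F (get (set w v o) v) (set w v o) (st v (get (set w v o) v) b s) ≡ F o w s
    eq o w = trans (cong (λ x → F x (set w v o) (st v x b s)) (get-set w v o))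
      (trans (indep o w o _) (cong (F o w) (skip v o b s Vv)))
    dep′ : ∀ o → DependsOn (λ w → φ (set w v o))
    dep′ o w u a Vu = trans (cong φ (set-comm w a o u≢v)) (dep (set w v o) u a Vu)
      where
      u≢v : u ≢ v
      u≢v refl with trans (sym Vv) Vu
      ... | ()
  ... | false = begin
      E p (λ w → φ w * Ψ (F (get w v) w (st v (get w v) b s)))
        ≡⟨ E-set P v _ ⟩
      sumFin (m v) (λ o → p v o * E p (λ w → φ (set w v o) * Ψ (F (get (set w v o) v) (set w v o) (st v (get (set w v o) v) b s))))
        ≡⟨ sumFin-cong (m v) (λ o → cong (p v o *_) (E-cong p (λ w → cong₂ _*_ (dep w v o Vv) (cong Ψ (eq o w))))) ⟩
      sumFin (m v) (λ o → p v o * E p (λ w → φ w * Ψ (F o w (st v o b s))))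
        ≤⟨ sumFin-mono (m v) (λ o → *-monoˡ (p-nn P v o) (IH o φ _ dep φ-nn (inv-st v o b s inv-s))) ⟩
      sumFin (m v) (λ o → p v o * (Ψ (st v o b s) * E p φ))
        ≡⟨ sumFin-cong (m v) (λ o → sym (QP.*-assoc (p v o) _ _)) ⟩
      sumFin (m v) (λ o → p v o * Ψ (st v o b s) * E p φ)
        ≡⟨ sumFin-*ʳ (m v) (E p φ) _ ⟩
      sumFin (m v) (λ o → p v o * Ψ (st v o b s)) * E p φ
        ≤⟨ *-monoʳ (E-nn P φ-nn) (super v b s Vv inv-s) ⟩
      Ψ s * E p φ ∎
    where
    open QP.≤-Reasoning
    eq : ∀ o w → F (get (set w v o) v) (set w v o) (st v (get (set w v o) v) b s) ≡ F o w (st v o b s)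
    eq o w = trans (cong (λ x → F x (set w v o) (st v x b s)) (get-set w v o)) (indep o w o _)

  fold-bound : ∀ us y → Unique us → Bound (λ w → fold us w y)
  fold-bound []       y u φ s dep φ-nn inv-s =
    QP.≤-reflexive (trans (E-cong p (λ w → QP.*-comm (φ w) (Ψ s))) (E-* p (Ψ s) φ))
  fold-bound (v ∷ us) y (v∉ ∷ u) = step v (y v) (λ _ w → fold us w y)
    (λ o w o′ s → fold-set us w o′ y s (λ i → All.lookup v∉ i refl)) (λ o → fold-bound us y u)

  -- Whether the path meets a vertex depends only on costs seen before. At a leaf the path is over,
  -- and all remaining vertices are processed with the constant flag `false`.
  tree-bound : ∀ {us} (T : Tree m k us) → Unique us → Bound (λ w → fold us w (mem (path T w)))
  tree-bound {us} (fin _) u = fold-bound us (λ _ → false) u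
  tree-bound {us} (visit {v = v} i f) u φ s dep φ-nn inv-s =
    subst (_≤ Ψ s * E p φ) (E-cong p (λ w → cong (φ w *_) (cong Ψ (sym (eq w)))))
      (step v true F (λ o w o′ s → trans
          (cong (λ q → fold (us ─ i) (set w v o′) (mem q) s) (path-set (f o) w o′ (∉-─ i u)))
          (fold-set (us ─ i) w o′ _ s (∉-─ i u)))
        (λ o → tree-bound (f o) (Unique-─ i u)) φ s dep φ-nn inv-s)
    where
    F : Fin (m v) → World n m → S → S
    F o w = fold (us ─ i) w (mem (path (f o) w))
    eq : ∀ w → fold us w (mem (path (visit i f) w)) s ≡ F (get w v) w (st v (get w v) true s)
    eq w = trans (fold-─ i w _ s) (trans
      (cong (λ b → fold (us ─ i) w (mem (v ∷ q)) (st v (get w v) b s)) (mem-here q v))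
      (fold-cong (us ─ i) w _ (λ j → mem-≢ q (λ { refl → ∉-─ i u j }))))
      where q = path (f (get w v)) w

-- Sign with which the value of a vertex enters X(V ∪ path) - X(V ∪ U): arguments are membership in V, U and the path.
sgn : Bool → Bool → Bool → ℚ
sgn false false true  = 1ℚ
sgn false true  false = - 1ℚ
sgn _     _     _     = 0ℚ

asgn : Bool → Bool → Bool → ℚ
asgn V U y = sgn V U y * sgn V U y

-- Quadratic and product supermartingales for the difference of two explorations.

module Moments
  {n : ℕ} {m : Fin n → ℕ} {k : ℕ} {p : Weights n m} (P : IsProb p) (V U : Fin n → Bool)
  (x : (v : Fin n) → Fin (m v) → ℚ) (x-nn : ∀ v o → 0ℚ ≤ x v o) (x≤1 : ∀ v o → x v o ≤ 1ℚ)
  where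

  μ : Fin n → ℚ
  μ v = sumFin (m v) (λ o → p v o * x v o)

  μ-nn : ∀ v → 0ℚ ≤ μ v
  μ-nn v = subst (_≤ μ v) (sumFin-0 (m v)) (sumFin-mono (m v) (λ o → *-nn (p-nn P v o) (x-nn v o)))

  mean-affine : ∀ v A B → sumFin (m v) (λ o → p v o * (A + B * x v o)) ≡ A + B * μ v
  mean-affine v A B = trans (sumFin-cong (m v) (λ o → eq (p v o) A B (x v o)))
    (trans (sumFin-+ (m v) _ _) (cong₂ _+_
      (trans (sumFin-* (m v) A (p v)) (trans (cong (A *_) (p-sum P v)) (QP.*-identityʳ A)))
      (sumFin-* (m v) B _)))
    where
    eq : ∀ q A B x → q * (A + B * x) ≡ A * q + B * (q * x)
    eq = solve-∀ ℚring

  μ≤1 : ∀ v → μ v ≤ 1ℚ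
  μ≤1 v = QP.≤-trans (sumFin-mono (m v) (λ o → *-monoˡ (p-nn P v o) (x≤1 v o)))
    (QP.≤-reflexive (trans (sumFin-cong (m v) (λ o → QP.*-identityʳ (p v o))) (p-sum P v)))

  sg ag : Fin n → Bool → ℚ
  sg v b = sgn (V v) (U v) b
  ag v b = asgn (V v) (U v) b

  sg-skip : ∀ v b → V v ≡ true → sg v b ≡ 0ℚ
  sg-skip v b Vv rewrite Vv = refl

  inv-diff : ∀ {c δ} → 0ℚ < c → 0ℚ ≤ δ → inv c ≡ inv (c + δ) + δ * inv c * inv (c + δ)
  inv-diff {c} {δ} 0<c 0≤δ = trans (sym (QP.*-identityʳ u)) (trans (cong (u *_) (sym (*-inv 0<c+δ)))
      (trans (eq u c δ u′) (trans (cong (λ z → z * u′ + δ * u * u′) (*-inv 0<c)) (cong (_+ δ * u * u′) (QP.*-identityˡ u′)))))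
    where
    u = inv c
    u′ = inv (c + δ)
    0<c+δ : 0ℚ < c + δ
    0<c+δ = subst (_< c + δ) (QP.+-identityʳ 0ℚ) (QP.+-mono-<-≤ 0<c 0≤δ)
    eq : ∀ u c δ u′ → u * ((c + δ) * u′) ≡ (c * u) * u′ + δ * u * u′
    eq = solve-∀ ℚring

  -- Chebyshev for a self-normalised martingale: Z²/(a+M)² + 1/(a+M) is a supermartingale, because
  -- a step of conditional mean mass δ adds at most δ to the variance while
  -- 1/(a+M) drops by δ/((a+M)(a+M+δ)).
  module Quadratic (a : ℚ) (0<a : 0ℚ < a) where

    stQ : (v : Fin n) → Fin (m v) → Bool → ℚ × ℚ → ℚ × ℚ
    stQ v o b (Z , M) = (Z + sg v b * (x v o - μ v)) , (M + ag v b * μ v)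

    ΨQ : ℚ × ℚ → ℚ
    ΨQ (Z , M) = Z * Z * (inv (a + M) * inv (a + M)) + inv (a + M)

    InvQ : ℚ × ℚ → Set
    InvQ (Z , M) = 0ℚ ≤ M

    superQ : ∀ v b s → V v ≡ false → InvQ s → sumFin (m v) (λ o → p v o * ΨQ (stQ v o b s)) ≤ ΨQ s
    superQ v b (Z , M) _ 0≤M = begin
        sumFin (m v) (λ o → p v o * ΨQ (stQ v o b (Z , M)))
          ≤⟨ sumFin-mono (m v) (λ o → *-monoˡ (p-nn P v o) (point o)) ⟩
        sumFin (m v) (λ o → p v o * ((A * uu + u′) + (B * uu) * x v o))
          ≡⟨ mean-affine v (A * uu + u′) (B * uu) ⟩
        (A * uu + u′) + (B * uu) * μ v
          ≤⟨ ≤-by (δ * u′ * (u - u′) + (s * s * (μ v * μ v)) * uu + Z * Z * ((u - u′) * (u + u′)))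
               (+-nn (+-nn (*-nn (*-nn δ-nn u′-nn) d-nn) (*-nn (*-nn (sq-nn s) (sq-nn (μ v))) (*-nn u′-nn u′-nn)))
                     (*-nn (sq-nn Z) (*-nn d-nn (+-nn u-nn u′-nn))))
               (trans (cong (Z * Z * (u * u) +_) (inv-diff 0<c δ-nn)) (trans
                 (cong (λ z → Z * Z * (u * u) + (z + δ * u * z)) u′≡) (fin-eq Z s (μ v) u u′))) ⟩
        Z * Z * (u * u) + u ∎
      where
      open QP.≤-Reasoning
      s = sg v b
      δ = s * s * μ v
      c = a + M
      u = inv c
      u′ = inv (a + (M + δ))
      uu = u′ * u′
      A = Z * Z - 2ℚ * s * Z * μ v + s * s * (μ v * μ v)
      B = 2ℚ * s * Z + s * s * (1ℚ - 2ℚ * μ v)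
      0<c : 0ℚ < c
      0<c = subst (_< c) (QP.+-identityʳ 0ℚ) (QP.+-mono-<-≤ 0<a 0≤M)
      δ-nn : 0ℚ ≤ δ
      δ-nn = *-nn (sq-nn s) (μ-nn v)
      0<c′ : 0ℚ < a + (M + δ)
      0<c′ = subst (_< a + (M + δ)) (QP.+-identityʳ 0ℚ) (QP.+-mono-<-≤ 0<a (+-nn 0≤M δ-nn))
      u-nn : 0ℚ ≤ u
      u-nn = QP.<⇒≤ (inv-pos 0<c)
      u′-nn : 0ℚ ≤ u′
      u′-nn = QP.<⇒≤ (inv-pos 0<c′)
      u′≡ : inv (c + δ) ≡ u′
      u′≡ = cong inv (QP.+-assoc a M δ)
      d-nn : 0ℚ ≤ u - u′
      d-nn = slack (≤-by (δ * u * u′) (*-nn (*-nn δ-nn u-nn) u′-nn)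
        (trans (inv-diff 0<c δ-nn) (cong (λ z → z + δ * u * z) u′≡)))
      fin-eq : ∀ Z s μ u u′ → Z * Z * (u * u) + (u′ + s * s * μ * u * u′) ≡
        ((Z * Z - 2ℚ * s * Z * μ + s * s * (μ * μ)) * (u′ * u′) + u′) + ((2ℚ * s * Z + s * s * (1ℚ - 2ℚ * μ)) * (u′ * u′)) * μ
        + (s * s * μ * u′ * (u - u′) + (s * s * (μ * μ)) * (u′ * u′) + Z * Z * ((u - u′) * (u + u′)))
      fin-eq = solve-∀ ℚring
      -- Replacing `x²` by `x`, which is larger on the unit interval, makes the square affine in
      -- `x`, so that only the mean `μ v` enters.
      point : ∀ o → ΨQ (stQ v o b (Z , M)) ≤ (A * uu + u′) + (B * uu) * x v o
      point o = ≤-by (s * s * (x v o * (1ℚ - x v o)) * uu)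
        (*-nn (*-nn (sq-nn s) (*-nn (x-nn v o) (slack (x≤1 v o)))) (*-nn u′-nn u′-nn))
        (pt-eq Z s (μ v) (x v o) u′)
        where
        pt-eq : ∀ Z s μ x u′ → ((Z * Z - 2ℚ * s * Z * μ + s * s * (μ * μ)) * (u′ * u′) + u′) + ((2ℚ * s * Z + s * s * (1ℚ - 2ℚ * μ)) * (u′ * u′)) * x
          ≡ (Z + s * (x - μ)) * (Z + s * (x - μ)) * (u′ * u′) + u′ + s * s * (x * (1ℚ - x)) * (u′ * u′)
        pt-eq = solve-∀ ℚring

    +-comm₃ : ∀ z a b → (z + a) + b ≡ (z + b) + a
    +-comm₃ = solve-∀ ℚring

    +0* : ∀ z {c} d → c ≡ 0ℚ → z + c * d ≡ z
    +0* z d refl = trans (cong (z +_) (QP.*-zeroˡ d)) (QP.+-identityʳ z)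

    open Supermartingale {k = k} P V stQ InvQ
      (λ v o b s i → +-nn i (*-nn (sq-nn (sg v b)) (μ-nn v)))
      (λ v o b v′ o′ b′ s → cong₂ _,_ (+-comm₃ (proj₁ s) _ _) (+-comm₃ (proj₂ s) _ _))
      ΨQ
      (λ v o b s Vv → cong₂ _,_ (+0* (proj₁ s) _ (sg-skip v b Vv))
        (+0* (proj₂ s) _ (trans (cong (_* sg v b) (sg-skip v b Vv)) (QP.*-zeroˡ (sg v b)))))
      superQ

    fold-sum : ∀ us w y Z M → fold us w y (Z , M) ≡
      ((Z + sumL us (λ v → sg v (y v) * (x v (get w v) - μ v))) , (M + sumL us (λ v → ag v (y v) * μ v)))
    fold-sum []       w y Z M = cong₂ _,_ (sym (QP.+-identityʳ Z)) (sym (QP.+-identityʳ M))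
    fold-sum (v ∷ us) w y Z M = trans (fold-sum us w y _ _) (cong₂ _,_ (QP.+-assoc Z _ _) (QP.+-assoc M _ _))

    Z-of M-of : List (Fin n) → World n m → (Fin n → Bool) → ℚ
    Z-of us w y = sumL us (λ v → sg v (y v) * (x v (get w v) - μ v))
    M-of us w y = sumL us (λ v → ag v (y v) * μ v)

    ΨQ-start : ΨQ (0ℚ , 0ℚ) ≡ inv a
    ΨQ-start = trans (cong₂ _+_ (QP.*-zeroˡ (inv (a + 0ℚ) * inv (a + 0ℚ))) (cong inv (QP.+-identityʳ a)))
      (QP.+-identityˡ (inv a))

    quadratic-bound : ∀ {us} (T : Tree m k us) → Unique us → ∀ φ →
      (∀ w v o → V v ≡ false → φ (set w v o) ≡ φ w) → (∀ w → 0ℚ ≤ φ w) →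
      E p (λ w → φ w * ΨQ (Z-of us w (mem (path T w)) , M-of us w (mem (path T w)))) ≤ inv a * E p φ
    quadratic-bound {us} T u φ dep φ-nn = subst₂ _≤_
      (E-cong p (λ w → cong (λ s → φ w * ΨQ s) (trans (fold-sum us w _ 0ℚ 0ℚ)
        (cong₂ _,_ (QP.+-identityˡ (Z-of us w (mem (path T w)))) (QP.+-identityˡ (M-of us w (mem (path T w))))))))
      (cong (_* E p φ) ΨQ-start)
      (tree-bound T u φ (0ℚ , 0ℚ) dep φ-nn QP.≤-refl)

    -- The quadratic term alone is then at least 1/9. This is the Markov step of the Chebyshev
    -- bound: `9 ΨQ` dominates the indicator of a large deviation.
    ΨQ-large : ∀ Z M → 0ℚ ≤ M → a + M ≤ 3ℚ * Z → 1ℚ ≤ (⁺ 9 / 1) * ΨQ (Z , M)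
    ΨQ-large Z M 0≤M h = QP.≤-trans (QP.≤-reflexive (trans (sym (QP.*-identityˡ 1ℚ)) (cong₂ _*_ (sym cu) (sym cu))))
      (QP.≤-trans (*-mono (QP.≤-trans (lit≤ {0ℚ} {1ℚ}) (QP.≤-reflexive (sym cu))) 0≤3Zu h′ h′)
        (≤-by ((⁺ 9 / 1) * u) (*-nn (lit≤ {0ℚ} {⁺ 9 / 1}) u-nn) (eq Z u)))
      where
      u = inv (a + M)
      0<c : 0ℚ < a + M
      0<c = subst (_< a + M) (QP.+-identityʳ 0ℚ) (QP.+-mono-<-≤ 0<a 0≤M)
      cu : (a + M) * u ≡ 1ℚ
      cu = *-inv 0<c
      u-nn : 0ℚ ≤ u
      u-nn = QP.<⇒≤ (inv-pos 0<c)
      h′ : (a + M) * u ≤ 3ℚ * Z * u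
      h′ = *-monoʳ u-nn h
      0≤3Zu : 0ℚ ≤ 3ℚ * Z * u
      0≤3Zu = QP.≤-trans (lit≤ {0ℚ} {1ℚ}) (QP.≤-trans (QP.≤-reflexive (sym cu)) h′)
      eq : ∀ Z u → (⁺ 9 / 1) * (Z * Z * (u * u) + u) ≡ 3ℚ * Z * u * (3ℚ * Z * u) + (⁺ 9 / 1) * u
      eq = solve-∀ ℚring

    ΨQ-nn : ∀ Z M → 0ℚ ≤ M → 0ℚ ≤ ΨQ (Z , M)
    ΨQ-nn Z M 0≤M = +-nn (*-nn (sq-nn Z) (*-nn u-nn u-nn)) u-nn
      where
      u-nn : 0ℚ ≤ inv (a + M)
      u-nn = QP.<⇒≤ (inv-pos (subst (_< a + M) (QP.+-identityʳ 0ℚ) (QP.+-mono-<-≤ 0<a 0≤M)))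

  module Product where

    -- The tilts 1/3 and 1/4 satisfy (1 + 1/3)(1 - 1/4) = 1 and (1 - μ/3)(1 + μ/4)² ≥ 1 on [0,1].
    fac : Bool → Bool → Bool → ℚ → ℚ → ℚ
    fac false false true  x μ = (1ℚ + ⅓ * x) * (1ℚ - ⅓ * μ)
    fac false true  false x μ = (1ℚ - ¼ * x) * (1ℚ + ¼ * μ)
    fac _     _     _     x μ = 1ℚ

    stW : (v : Fin n) → Fin (m v) → Bool → ℚ → ℚ
    stW v o b s = s * fac (V v) (U v) b (x v o) (μ v)

    fac-nn : ∀ V U b {x μ} → 0ℚ ≤ x → x ≤ 1ℚ → 0ℚ ≤ μ → μ ≤ 1ℚ → 0ℚ ≤ fac V U b x μ
    fac-nn false false true  {x} {μ} 0≤x x≤1 0≤μ μ≤1 = *-nn (+-nn (lit≤ {0ℚ} {1ℚ}) (*-nn (lit≤ {0ℚ} {⅓}) 0≤x))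
      (≤-by (⅓ * (1ℚ - μ) + 2ℚ * ⅓) (+-nn (*-nn (lit≤ {0ℚ} {⅓}) (slack μ≤1)) (lit≤ {0ℚ} {2ℚ * ⅓})) (eq μ))
      where
      eq : ∀ μ → 1ℚ - ⅓ * μ ≡ 0ℚ + (⅓ * (1ℚ - μ) + 2ℚ * ⅓)
      eq = solve-∀ ℚring
    fac-nn false true false {x} {μ} 0≤x x≤1 0≤μ μ≤1 = *-nn
      (≤-by (¼ * (1ℚ - x) + 3ℚ * ¼) (+-nn (*-nn (lit≤ {0ℚ} {¼}) (slack x≤1)) (lit≤ {0ℚ} {3ℚ * ¼})) (eq x))
      (+-nn (lit≤ {0ℚ} {1ℚ}) (*-nn (lit≤ {0ℚ} {¼}) 0≤μ))
      where
      eq : ∀ x → 1ℚ - ¼ * x ≡ 0ℚ + (¼ * (1ℚ - x) + 3ℚ * ¼)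
      eq = solve-∀ ℚring
    fac-nn false false false _ _ _ _ = lit≤ {0ℚ} {1ℚ}
    fac-nn false true  true  _ _ _ _ = lit≤ {0ℚ} {1ℚ}
    fac-nn true  _     _     _ _ _ _ = lit≤ {0ℚ} {1ℚ}

    -- The factor has mean `1 - (μ/3)²` or `1 - (μ/4)²`, or is constant.
    fac-mean : ∀ v V U b s → 0ℚ ≤ s → sumFin (m v) (λ o → p v o * (s * fac V U b (x v o) (μ v))) ≤ s
    fac-mean v false false true s 0≤s = QP.≤-trans
      (QP.≤-reflexive (trans (sumFin-cong (m v) (λ o → cong (p v o *_) (eq s (x v o) (μ v)))) (mean-affine v (s * (1ℚ - ⅓ * μ v)) (s * ⅓ * (1ℚ - ⅓ * μ v)))))
      (≤-by (s * (⅓ * μ v * (⅓ * μ v))) (*-nn 0≤s (sq-nn (⅓ * μ v))) (eq′ s (μ v)))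
      where
      eq : ∀ s x μ → s * ((1ℚ + ⅓ * x) * (1ℚ - ⅓ * μ)) ≡ s * (1ℚ - ⅓ * μ) + s * ⅓ * (1ℚ - ⅓ * μ) * x
      eq = solve-∀ ℚring
      eq′ : ∀ s μ → s ≡ s * (1ℚ - ⅓ * μ) + s * ⅓ * (1ℚ - ⅓ * μ) * μ + s * (⅓ * μ * (⅓ * μ))
      eq′ = solve-∀ ℚring
    fac-mean v false true false s 0≤s = QP.≤-trans
      (QP.≤-reflexive (trans (sumFin-cong (m v) (λ o → cong (p v o *_) (eq s (x v o) (μ v)))) (mean-affine v (s * (1ℚ + ¼ * μ v)) (- (s * ¼ * (1ℚ + ¼ * μ v))))))
      (≤-by (s * (¼ * μ v * (¼ * μ v))) (*-nn 0≤s (sq-nn (¼ * μ v))) (eq′ s (μ v)))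
      where
      eq : ∀ s x μ → s * ((1ℚ - ¼ * x) * (1ℚ + ¼ * μ)) ≡ s * (1ℚ + ¼ * μ) + (- (s * ¼ * (1ℚ + ¼ * μ))) * x
      eq = solve-∀ ℚring
      eq′ : ∀ s μ → s ≡ s * (1ℚ + ¼ * μ) + (- (s * ¼ * (1ℚ + ¼ * μ))) * μ + s * (¼ * μ * (¼ * μ))
      eq′ = solve-∀ ℚring
    fac-mean v false false false s _ = one v s
      where
      one : ∀ v s → sumFin (m v) (λ o → p v o * (s * 1ℚ)) ≤ s
      one v s = QP.≤-reflexive (trans (sumFin-*ʳ (m v) (s * 1ℚ) (p v)) (trans (cong (_* (s * 1ℚ)) (p-sum P v))
        (trans (QP.*-identityˡ (s * 1ℚ)) (QP.*-identityʳ s))))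
    fac-mean v false true  true  s h = fac-mean v false false false s h
    fac-mean v true  U     b     s h = fac-mean v false false false s h

    fac-skip : ∀ v b x μ → V v ≡ true → fac (V v) (U v) b x μ ≡ 1ℚ
    fac-skip v b x μ Vv rewrite Vv = refl

    *-comm₃ : ∀ z a b → (z * a) * b ≡ (z * b) * a
    *-comm₃ = solve-∀ ℚring

    open Supermartingale {k = k} P V stW (0ℚ ≤_)
      (λ v o b s i → *-nn i (fac-nn (V v) (U v) b (x-nn v o) (x≤1 v o) (μ-nn v) (μ≤1 v)))
      (λ v o b v′ o′ b′ s → *-comm₃ s _ _)
      (λ s → s)
      (λ v o b s Vv → trans (cong (s *_) (fac-skip v b _ _ Vv)) (QP.*-identityʳ s))
      (λ v b s _ i → fac-mean v (V v) (U v) b s i)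

    prodL : List (Fin n) → World n m → (Fin n → Bool) → ℚ
    prodL []       w y = 1ℚ
    prodL (v ∷ us) w y = fac (V v) (U v) (y v) (x v (get w v)) (μ v) * prodL us w y

    fold-prod : ∀ us w y s → fold us w y s ≡ s * prodL us w y
    fold-prod []       w y s = sym (QP.*-identityʳ s)
    fold-prod (v ∷ us) w y s = trans (fold-prod us w y _) (QP.*-assoc s _ _)

    prodL-nn : ∀ us w y → 0ℚ ≤ prodL us w y
    prodL-nn []       w y = lit≤ {0ℚ} {1ℚ}
    prodL-nn (v ∷ us) w y = *-nn (fac-nn (V v) (U v) (y v) (x-nn v _) (x≤1 v _) (μ-nn v) (μ≤1 v)) (prodL-nn us w y)

    product-bound : ∀ {us} (T : Tree m k us) → Unique us → ∀ φ →
      (∀ w v o → V v ≡ false → φ (set w v o) ≡ φ w) → (∀ w → 0ℚ ≤ φ w) →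
      E p (λ w → φ w * prodL us w (mem (path T w))) ≤ E p φ
    product-bound {us} T u φ dep φ-nn = subst₂ _≤_
      (E-cong p (λ w → cong (φ w *_) (trans (fold-prod us w _ 1ℚ) (QP.*-identityˡ (prodL us w (mem (path T w)))))))
      (QP.*-identityˡ (E p φ))
      (tree-bound T u φ 1ℚ dep φ-nn (lit≤ {0ℚ} {1ℚ}))

-- Chosen sets, price levels and the failure test.

chosen-unique : ∀ {n m k us} (T : Tree {n} m k us) w → Unique (chosen T w)
chosen-unique (fin l)             w = uniq l
chosen-unique (visit {v = v} i f) w = chosen-unique (f (get w v)) w

chosen-length : ∀ {n m k us} (T : Tree {n} m k us) w → length (chosen T w) ≡ k
chosen-length (fin l)             w = size l
chosen-length (visit {v = v} i f) w = chosen-length (f (get w v)) w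

chosen⊆path : ∀ {n m k us} (T : Tree {n} m k us) w {u} → u ∈ chosen T w → u ∈ us → u ∈ path T w
chosen⊆path (fin l) w j u∈ = contradiction u∈ (All.lookup (out l) j)
chosen⊆path (visit {v = v} i f) w {u} j u∈ with u FP.≟ v
... | yes eq  = here eq
... | no  u≢v = there (chosen⊆path (f (get w v)) w j (∈-─⁺ i u∈ u≢v))

member≤sum : ∀ {A : Set} {xs : List A} {f : A → ℚ} {v} → (∀ x → 0ℚ ≤ f x) → v ∈ xs → f v ≤ sumL xs f
member≤sum {xs = xs} {f} h i = ≤-by (sumL (xs ─ i) f) (sumL-nn (xs ─ i) h) (sumL-─ i f)

∨-trueʳ : ∀ a {b} → b ≡ true → a ∨ b ≡ true
∨-trueʳ true  refl = refl
∨-trueʳ false refl = refl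

sumN : ℕ → (ℕ → ℚ) → ℚ
sumN zero    f = 0ℚ
sumN (suc J) f = sumN J f + f J

sumN-nn : ∀ J {f} → (∀ j → 0ℚ ≤ f j) → 0ℚ ≤ sumN J f
sumN-nn zero    h = QP.≤-refl
sumN-nn (suc J) h = +-nn (sumN-nn J h) (h J)

term≤sumN : ∀ {J j f} → (∀ i → 0ℚ ≤ f i) → j ℕ.< J → f j ≤ sumN J f
term≤sumN {suc J} {j} {f} h (ℕ.s≤s l) with ℕP.m≤n⇒m<n∨m≡n l
... | inj₁ j<J  = QP.≤-trans (term≤sumN h j<J) (≤-by (f J) (h J) refl)
... | inj₂ refl = ≤-by (sumN J f) (sumN-nn J h) (QP.+-comm (sumN J f) (f J))

-- Three successful paths lose 3 · 2ʲ of the slack C₀ · 2ʲ; the sum over j of 9 / (432 · 2ʲ) is at most 1/24.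
C₀ : ℚ
C₀ = ⁺ 435 / 1

module Levels
  {n : ℕ} {m : Fin n → ℕ} (k : ℕ)
  (c : (v : Fin n) → Fin (m v) → ℚ) (c-nn : ∀ v o → 0ℚ ≤ c v o)
  where

  us₀ : List (Fin n)
  us₀ = allFin n

  us₀-unique : Unique us₀
  us₀-unique = UP.allFin⁺ n

  K : ℚ
  K = ℕ→ℚ k

  -- Costs are in units of the budget.  Level j + 1 stands for the price 2⁻ʲ; level 0 is what forces the
  -- exact cardinality k, which no truncated value can see.
  lv : ℕ → (v : Fin n) → Fin (m v) → ℚ
  lv zero    v o = 𝟙 (leq (c v o) 1ℚ)
  lv (suc j) v o = posPart (1ℚ - pow 2ℚ j * c v o)

  lv-nn : ∀ l v o → 0ℚ ≤ lv l v o
  lv-nn zero    v o = 𝟙-nn (leq (c v o) 1ℚ)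
  lv-nn (suc j) v o = posPart-nn (1ℚ - pow 2ℚ j * c v o)

  2ʲc-nn : ∀ j v o → 0ℚ ≤ pow 2ℚ j * c v o
  2ʲc-nn j v o = *-nn (pow-nn j (lit≤ {0ℚ} {2ℚ})) (c-nn v o)

  lv≤1 : ∀ l v o → lv l v o ≤ 1ℚ
  lv≤1 zero    v o = 𝟙≤1 (leq (c v o) 1ℚ)
  lv≤1 (suc j) v o = posPart-lub (lit≤ {0ℚ} {1ℚ})
    (≤-by (pow 2ℚ j * c v o) (2ʲc-nn j v o) (eq (pow 2ℚ j * c v o)))
    where
    eq : ∀ z → 1ℚ ≡ (1ℚ - z) + z
    eq = solve-∀ ℚring

  lv-suc≤ : ∀ l v o → lv (suc l) v o ≤ lv l v o
  lv-suc≤ zero v o with ≤⊎> (c v o) 1ℚ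
  ... | inj₁ _ = lv≤1 1 v o
  ... | inj₂ h = posPart-lub QP.≤-refl (slack⁻¹ (subst (0ℚ ≤_) (eq (c v o)) (slack (QP.<⇒≤ h))))
    where
    eq : ∀ z → z - 1ℚ ≡ 0ℚ - (1ℚ - 1ℚ * z)
    eq = solve-∀ ℚring
  lv-suc≤ (suc j) v o = posPart-lub (posPart-nn (1ℚ - pow 2ℚ j * c v o)) (QP.≤-trans
    (≤-by (pow 2ℚ j * c v o) (2ʲc-nn j v o) (eq (pow 2ℚ j) (c v o))) (≤posPart (1ℚ - pow 2ℚ j * c v o)))
    where
    eq : ∀ z c → 1ℚ - z * c ≡ (1ℚ - 2ℚ * z * c) + z * c
    eq = solve-∀ ℚring

  lv-anti : ∀ {i j} → i ℕ.≤ j → ∀ v o → lv j v o ≤ lv i v o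
  lv-anti {i} {zero}  ℕ.z≤n v o = QP.≤-refl
  lv-anti {i} {suc j} l v o with ℕP.m≤n⇒m<n∨m≡n l
  ... | inj₁ (ℕ.s≤s i≤j) = QP.≤-trans (lv-suc≤ j v o) (lv-anti i≤j v o)
  ... | inj₂ refl        = QP.≤-refl

  X : ℕ → (Fin n → Bool) → World n m → ℚ
  X l V w = sumL us₀ (λ v → 𝟙 (V v) * lv l v (get w v))

  -- A set of `k` vertices of total cost `C` has deficit at most `C/λ` at price λ. The slack is this
  -- bound for `C = C₀`; a count has no slack.
  sl : ℕ → ℚ
  sl zero    = 0ℚ
  sl (suc j) = C₀ * pow 2ℚ j

  sl-nn : ∀ l → 0ℚ ≤ sl l
  sl-nn zero    = QP.≤-refl
  sl-nn (suc j) = *-nn (lit≤ {0ℚ} {C₀}) (pow-nn j (lit≤ {0ℚ} {2ℚ}))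

  -- The same bound for total cost one, that is, for a path on which the optimum keeps to the
  -- budget.
  rr : ℕ → ℚ
  rr zero    = 0ℚ
  rr (suc j) = pow 2ℚ j

  -- The dual form of containing `k` vertices of cost O(1), at dyadic prices. The last level `k + 1`
  -- is low enough: `k` vertices of cost at most `2⁻ᵏ` cost at most one together.
  Ok : (Fin n → Bool) → World n m → Set
  Ok V w = ∀ (l : Fin (suc (suc k))) → K ≤ X (F.toℕ l) V w + sl (F.toℕ l)

  abstract
    ok? : ∀ V w → Dec (Ok V w)
    ok? V w = FP.all? (λ l → K ≤? X (F.toℕ l) V w + sl (F.toℕ l))

  fl : (Fin n → Bool) → World n m → ℚ
  fl V w = 𝟙 (not (does (ok? V w)))

  fl-nn : ∀ V w → 0ℚ ≤ fl V w
  fl-nn V w = 𝟙-nn (not (does (ok? V w)))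

  fl≤1 : ∀ V w → fl V w ≤ 1ℚ
  fl≤1 V w = 𝟙≤1 (not (does (ok? V w)))

  fl-ok : ∀ {V w} → Ok V w → fl V w ≡ 0ℚ
  fl-ok {V} {w} h with ok? V w
  ... | yes _ = refl
  ... | no ¬h = contradiction h ¬h

  fl-¬ok : ∀ {V w} → ¬ Ok V w → fl V w ≡ 1ℚ
  fl-¬ok {V} {w} ¬h with ok? V w
  ... | yes h = contradiction h ¬h
  ... | no _  = refl

  X-mono : ∀ l {V V′} w → (∀ v → V v ≡ true → V′ v ≡ true) → X l V w ≤ X l V′ w
  X-mono l {V} {V′} w h = sumL-mono us₀ (λ {v} _ → *-monoʳ (lv-nn l v _) (𝟙-mono (V v) (V′ v) (h v)))
    where
    𝟙-mono : ∀ a b → (a ≡ true → b ≡ true) → 𝟙 a ≤ 𝟙 b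
    𝟙-mono false b h = 𝟙-nn b
    𝟙-mono true  b h rewrite h refl = QP.≤-refl

  X-anti : ∀ {i j} V w → i ℕ.≤ j → X j V w ≤ X i V w
  X-anti V w i≤j = sumL-mono us₀ (λ {v} _ → *-monoˡ (𝟙-nn (V v)) (lv-anti i≤j v _))

  Ok-mono : ∀ {V V′} w → (∀ v → V v ≡ true → V′ v ≡ true) → Ok V w → Ok V′ w
  Ok-mono w h ok l = QP.≤-trans (ok l) (QP.+-monoˡ-≤ (sl (F.toℕ l)) (X-mono (F.toℕ l) w h))

  Ok-cong : ∀ {V w w′} → (∀ v → V v ≡ true → get w v ≡ get w′ v) → Ok V w → Ok V w′
  Ok-cong {V} {w} {w′} h ok l = subst (λ x → K ≤ x + sl (F.toℕ l)) (sumL-cong us₀ (λ {v} _ → eq v)) (ok l)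
    where
    eq : ∀ v → 𝟙 (V v) * lv (F.toℕ l) v (get w v) ≡ 𝟙 (V v) * lv (F.toℕ l) v (get w′ v)
    eq v with V v in Vv
    ... | true  = cong (λ o → 1ℚ * lv (F.toℕ l) v o) (h v Vv)
    ... | false = trans (QP.*-zeroˡ (lv (F.toℕ l) v (get w v))) (sym (QP.*-zeroˡ (lv (F.toℕ l) v (get w′ v))))

  fl-cong : ∀ {V w w′} → (∀ v → V v ≡ true → get w v ≡ get w′ v) → fl V w ≡ fl V w′
  fl-cong {V} {w} {w′} h with ok? V w
  ... | yes ok = sym (fl-ok (Ok-cong {V} {w} {w′} h ok))
  ... | no ¬ok = sym (fl-¬ok (λ ok → ¬ok (Ok-cong {V} {w′} {w} (λ v Vv → sym (h v Vv)) ok)))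

  -- Failure is determined by the costs inside `V`, which is what the supermartingale bounds ask of
  -- `φ`.
  fl-set : ∀ V w v o → V v ≡ false → fl V (set w v o) ≡ fl V w
  fl-set V w v o Vv = fl-cong (λ u Vu → get-set-≢ w o (λ { refl → case (trans (sym Vv) Vu) }))
    where
    case : false ≡ true → ⊥
    case ()

  fl-mono : ∀ {V V′} w → (∀ v → V v ≡ true → V′ v ≡ true) → fl V′ w ≤ fl V w * fl V′ w
  fl-mono {V} {V′} w h with ok? V w
  ... | no  _  = QP.≤-reflexive (sym (QP.*-identityˡ (fl V′ w)))
  ... | yes ok = QP.≤-reflexive (trans (fl-ok (Ok-mono w h ok)) (sym (QP.*-zeroˡ (fl V′ w))))

  fails : ∀ {V w} → ¬ Ok V w → ∃ λ l → l ℕ.≤ suc k × X l V w + sl l < K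
  fails {V} {w} ¬ok with FP.¬∀⟶∃¬ _ _ (λ l → K ≤? X (F.toℕ l) V w + sl (F.toℕ l)) ¬ok
  ... | l , h = F.toℕ l , ℕ.s≤s⁻¹ (FP.toℕ<n l) , QP.≰⇒> h

  module _ (T : Tree m k us₀) where

    chosen-sum : ∀ l (V : Fin n → Bool) (w : World n m) → sumL (chosen T w) (λ v → lv l v (get w v)) ≤ X l (λ v → V v ∨ mem (path T w) v) w
    chosen-sum l V w = subst (_≤ X l (λ v → V v ∨ mem (path T w) v) w)
      (sumL-cong (chosen T w) (λ {v} i → trans (cong (λ b → 𝟙 b * lv l v (get w v))
        (∨-trueʳ (V v) (∈⇒mem (chosen⊆path T w i (MP.∈-allFin v))))) (QP.*-identityˡ (lv l v (get w v)))))
      (sumL-⊆ (chosen T w) us₀ (λ v → *-nn (𝟙-nn (V v ∨ mem (path T w) v)) (lv-nn l v (get w v))) (chosen-unique T w) (λ {v} _ → MP.∈-allFin v))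

    -- Every chosen vertex costs at most one and so is counted at level 0. At price `2⁻ʲ` the chosen
    -- values add up to at least `K - 2ʲ Σc`, already without truncation.
    success : ∀ l (V : Fin n → Bool) (w : World n m) → sumL (chosen T w) (λ v → c v (get w v)) ≤ 1ℚ →
      K ≤ X l (λ v → V v ∨ mem (path T w) v) w + rr l
    success zero V w h = QP.≤-trans (QP.≤-reflexive (trans (cong ℕ→ℚ (sym (chosen-length T w)))
        (trans (sym (sumL-1 (chosen T w))) (sumL-cong (chosen T w) cheap))))
      (QP.≤-trans (chosen-sum 0 V w) (QP.≤-reflexive (sym (QP.+-identityʳ (X 0 (λ v → V v ∨ mem (path T w) v) w)))))
      where
      cheap : ∀ {v} → v ∈ chosen T w → 1ℚ ≡ lv 0 v (get w v)
      cheap {v} i with ≤⊎> (c v (get w v)) 1ℚ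
      ... | inj₁ _ = refl
      ... | inj₂ l = contradiction (QP.≤-trans (member≤sum (λ u → c-nn u (get w u)) i) h) (<⇒¬≤ l)
    success (suc j) V w h = QP.≤-trans (≤-by (t * (1ℚ - Σc)) (*-nn t-nn (slack h)) (eq K t Σc))
      (QP.+-monoˡ-≤ t (QP.≤-trans (QP.≤-reflexive lower)
        (QP.≤-trans (sumL-mono (chosen T w) (λ {v} _ → ≤posPart (1ℚ - t * c v (get w v)))) (chosen-sum (suc j) V w))))
      where
      t = pow 2ℚ j
      t-nn = pow-nn j (lit≤ {0ℚ} {2ℚ})
      Σc = sumL (chosen T w) (λ v → c v (get w v))
      eq : ∀ K t s → (K - t * s) + t ≡ K + t * (1ℚ - s)
      eq = solve-∀ ℚring
      lower : K - t * Σc ≡ sumL (chosen T w) (λ v → 1ℚ - t * c v (get w v))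
      lower = sym (trans (sumL-+ (chosen T w) (λ _ → 1ℚ) (λ v → - (t * c v (get w v))))
        (cong₂ _+_ (trans (sumL-1 (chosen T w)) (cong ℕ→ℚ (chosen-length T w)))
          (trans (sumL-cong (chosen T w) (λ {v} _ → QP.neg-distribˡ-* t (c v (get w v))))
            (trans (sumL-* (chosen T w) (- t) (λ v → c v (get w v))) (sym (QP.neg-distribˡ-* t Σc))))))

-- Sign and tilt inequalities for three paths.

q43 q34 : ℚ
q43 = ⁺ 4 / 3
q34 = ⁺ 3 / 4

pow-+ : ∀ x i j → pow x (i ℕ.+ j) ≡ pow x i * pow x j
pow-+ x zero    j = sym (QP.*-identityˡ (pow x j))
pow-+ x (suc i) j = trans (cong (x *_) (pow-+ x i j)) (sym (QP.*-assoc x (pow x i) (pow x j)))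

ℕ→ℚ-+ : ∀ i j → ℕ→ℚ (i ℕ.+ j) ≡ ℕ→ℚ i + ℕ→ℚ j
ℕ→ℚ-+ zero    j = sym (QP.+-identityˡ (ℕ→ℚ j))
ℕ→ℚ-+ (suc i) j = trans (ℕ→ℚ-suc (i ℕ.+ j)) (trans (cong (1ℚ +_) (ℕ→ℚ-+ i j))
  (trans (sym (QP.+-assoc 1ℚ (ℕ→ℚ i) (ℕ→ℚ j))) (cong (_+ ℕ→ℚ j) (sym (ℕ→ℚ-suc i)))))

pow≥1 : ∀ {x} j → 1ℚ ≤ x → 1ℚ ≤ pow x j
pow≥1 zero    h = QP.≤-refl
pow≥1 {x} (suc j) h = QP.≤-trans (QP.≤-reflexive (sym (QP.*-identityˡ 1ℚ)))
  (*-mono (lit≤ {0ℚ} {1ℚ}) (pow-nn j (QP.≤-trans (lit≤ {0ℚ} {1ℚ}) h)) h (pow≥1 j h))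

-- The two tilts are reciprocal, so ups and downs cancel in pairs and at least one up remains.
tilt≥ : ∀ u d → d ℕ.< u → q43 ≤ pow q43 u * pow q34 d
tilt≥ (suc u) zero    _ = QP.≤-trans (QP.≤-reflexive (sym (QP.*-identityʳ q43)))
  (QP.≤-trans (*-monoˡ (lit≤ {0ℚ} {q43}) (pow≥1 u (lit≤ {1ℚ} {q43}))) (QP.≤-reflexive (sym (QP.*-identityʳ (pow q43 (suc u))))))
tilt≥ (suc u) (suc d) (ℕ.s≤s l) = QP.≤-trans (tilt≥ u d l) (QP.≤-reflexive (eq (pow q43 u) (pow q34 d)))
  where
  eq : ∀ a b → a * b ≡ q43 * a * (q34 * b)
  eq = solve-∀ ℚring

am-gm₃ : ∀ x y z → 0ℚ ≤ x → 0ℚ ≤ y → 0ℚ ≤ z → (⁺ 27 / 1) * (x * y * z) ≤ (x + y + z) * (x + y + z) * (x + y + z)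
am-gm₃ x y z 0≤x 0≤y 0≤z = ≤-by _
  (+-nn (*-nn (*-nn (lit≤ {0ℚ} {⁺ 1 / 2}) (+-nn (+-nn 0≤x 0≤y) 0≤z)) (+-nn (+-nn (sq-nn (x - y)) (sq-nn (y - z))) (sq-nn (z - x))))
    (*-nn (lit≤ {0ℚ} {3ℚ}) (+-nn (+-nn (*-nn 0≤x (sq-nn (y - z))) (*-nn 0≤y (sq-nn (z - x)))) (*-nn 0≤z (sq-nn (x - y))))))
  (eq x y z)
  where
  eq : ∀ x y z → (x + y + z) * (x + y + z) * (x + y + z) ≡ (⁺ 27 / 1) * (x * y * z)
    + ((⁺ 1 / 2) * (x + y + z) * ((x - y) * (x - y) + (y - z) * (y - z) + (z - x) * (z - x))
    + 3ℚ * (x * ((y - z) * (y - z)) + y * ((z - x) * (z - x)) + z * ((x - y) * (x - y))))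
  eq = solve-∀ ℚring

-- By AM-GM the sum is at least `3 · 4/3`. The weight `¼` in `dev` turns this 4 into 1.
sum≥4 : ∀ x y z → 0ℚ ≤ x → 0ℚ ≤ y → 0ℚ ≤ z → q43 * q43 * q43 ≤ x * y * z → ⁺ 4 / 1 ≤ x + y + z
sum≥4 x y z 0≤x 0≤y 0≤z h with ≤⊎> (⁺ 4 / 1) (x + y + z)
... | inj₁ l = l
... | inj₂ l = contradiction (QP.≤-trans (*-monoˡ (lit≤ {0ℚ} {⁺ 27 / 1}) h) (am-gm₃ x y z 0≤x 0≤y 0≤z)) (<⇒¬≤ cube)
  where
  s = x + y + z
  s-nn : 0ℚ ≤ s
  s-nn = +-nn (+-nn 0≤x 0≤y) 0≤z
  cube : s * s * s < (⁺ 27 / 1) * (q43 * q43 * q43)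
  cube = QP.≤-<-trans (*-mono (*-nn s-nn s-nn) s-nn
      (*-mono s-nn (lit≤ {0ℚ} {⁺ 4 / 1}) (QP.<⇒≤ l) (QP.<⇒≤ l)) (QP.≤-refl {s}))
    (QP.*-monoʳ-<-pos (⁺ 16 / 1) l)

sumL-3 : ∀ {A : Set} (xs : List A) f g h →
  sumL xs (λ x → f x + g x + h x) ≡ sumL xs f + sumL xs g + sumL xs h
sumL-3 xs f g h = trans (sumL-+ xs (λ x → f x + g x) h) (cong (_+ sumL xs h) (sumL-+ xs f g))

-- The factor `fac` is split into realised value and mean. The values differ between the three
-- worlds but the means do not, so only the `den` parts can be multiplied across worlds.
num den : Bool → Bool → Bool → ℚ → ℚ
num false false true  x = 1ℚ + ⅓ * x
num false true  false x = 1ℚ - ¼ * x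
num _     _     _     x = 1ℚ
den false false true  μ = 1ℚ - ⅓ * μ
den false true  false μ = 1ℚ + ¼ * μ
den _     _     _     μ = 1ℚ

-- Each vertex explored by exactly one of three paths is tilted up once and down twice.
den₃ : ∀ V a b c {μ} → 0ℚ ≤ μ → μ ≤ 1ℚ →
  1ℚ ≤ den V (b ∨ c) a μ * den V (a ∨ c) b μ * den V (a ∨ b) c μ
den₃ V a b c {μ} 0≤μ μ≤1 = go V a b c
  where
  1≤1+¼μ : 1ℚ ≤ 1ℚ + ¼ * μ
  1≤1+¼μ = ≤-by (¼ * μ) (*-nn (lit≤ {0ℚ} {¼}) 0≤μ) refl
  main : 1ℚ ≤ (1ℚ - ⅓ * μ) * (1ℚ + ¼ * μ) * (1ℚ + ¼ * μ)
  main = ≤-by ((⁺ 1 / 48) * μ * (2ℚ + (⁺ 5 / 1) * (1ℚ - μ) + (1ℚ - μ) * (1ℚ + μ)))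
    (*-nn (*-nn (lit≤ {0ℚ} {⁺ 1 / 48}) 0≤μ) (+-nn (+-nn (lit≤ {0ℚ} {2ℚ}) (*-nn (lit≤ {0ℚ} {⁺ 5 / 1}) (slack μ≤1)))
      (*-nn (slack μ≤1) (+-nn (lit≤ {0ℚ} {1ℚ}) 0≤μ)))) (eq μ)
    where
    eq : ∀ μ → (1ℚ - ⅓ * μ) * (1ℚ + ¼ * μ) * (1ℚ + ¼ * μ) ≡
      1ℚ + (⁺ 1 / 48) * μ * (2ℚ + (⁺ 5 / 1) * (1ℚ - μ) + (1ℚ - μ) * (1ℚ + μ))
    eq = solve-∀ ℚring
  perm₁ : ∀ a b → a * b * b ≡ b * a * b
  perm₁ = solve-∀ ℚring
  perm₂ : ∀ a b → a * b * b ≡ b * b * a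
  perm₂ = solve-∀ ℚring
  one₁ : ∀ a → a ≡ a * 1ℚ * 1ℚ
  one₁ = solve-∀ ℚring
  one₂ : ∀ a → a ≡ 1ℚ * a * 1ℚ
  one₂ = solve-∀ ℚring
  one₃ : ∀ a → a ≡ 1ℚ * 1ℚ * a
  one₃ = solve-∀ ℚring
  go : ∀ V a b c → 1ℚ ≤ den V (b ∨ c) a μ * den V (a ∨ c) b μ * den V (a ∨ b) c μ
  go true  a     b     c     = lit≤ {1ℚ} {1ℚ * 1ℚ * 1ℚ}
  go false false false false = lit≤ {1ℚ} {1ℚ * 1ℚ * 1ℚ}
  go false true  false false = main
  go false false true  false = subst (1ℚ ≤_) (perm₁ (1ℚ - ⅓ * μ) (1ℚ + ¼ * μ)) main
  go false false false true  = subst (1ℚ ≤_) (perm₂ (1ℚ - ⅓ * μ) (1ℚ + ¼ * μ)) main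
  go false true  true  false = subst (1ℚ ≤_) (one₃ (1ℚ + ¼ * μ)) 1≤1+¼μ
  go false true  false true  = subst (1ℚ ≤_) (one₂ (1ℚ + ¼ * μ)) 1≤1+¼μ
  go false false true  true  = subst (1ℚ ≤_) (one₁ (1ℚ + ¼ * μ)) 1≤1+¼μ
  go false true  true  true  = lit≤ {1ℚ} {1ℚ * 1ℚ * 1ℚ}

-- On values 0 and 1 the tilts are exact powers of 4/3 and 3/4, so a product of tilts encodes a
-- difference of counts.
num-count : ∀ V U y β → ∃ λ u → ∃ λ d →
  num V U y (𝟙 β) ≡ pow q43 u * pow q34 d × sgn V U y * 𝟙 β + ℕ→ℚ d ≡ ℕ→ℚ u
num-count true  U     y     β     = 0 , 0 , refl , zero-case β
  where
  zero-case : ∀ β → 0ℚ * 𝟙 β + 0ℚ ≡ 0ℚ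
  zero-case true  = refl
  zero-case false = refl
num-count false false false true  = 0 , 0 , refl , refl
num-count false false false false = 0 , 0 , refl , refl
num-count false true  true  true  = 0 , 0 , refl , refl
num-count false true  true  false = 0 , 0 , refl , refl
num-count false false true  true  = 1 , 0 , refl , refl
num-count false false true  false = 0 , 0 , refl , refl
num-count false true  false true  = 0 , 1 , refl , refl
num-count false true  false false = 0 , 0 , refl , refl

sgn-𝟙 : ∀ V U y → sgn V U y + 𝟙 (V ∨ U) ≡ 𝟙 (V ∨ y)
sgn-𝟙 true  U     y     = refl
sgn-𝟙 false false false = refl
sgn-𝟙 false false true  = refl
sgn-𝟙 false true  false = refl
sgn-𝟙 false true  true  = refl

-- Equality holds for a vertex on exactly one path, with signs 1, -1, -1. The sum of signs is then
-- minus a third of the mass; this ratio is the 3 in `ΨQ-large`.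
sgn₃ : ∀ V a b c → 3ℚ * (sgn V (b ∨ c) a + sgn V (a ∨ c) b + sgn V (a ∨ b) c)
  + (asgn V (b ∨ c) a + asgn V (a ∨ c) b + asgn V (a ∨ b) c) ≤ 0ℚ
sgn₃ true  a     b     c     = QP.≤-refl
sgn₃ false false false false = QP.≤-refl
sgn₃ false true  false false = lit≤
sgn₃ false false true  false = lit≤
sgn₃ false false false true  = lit≤
sgn₃ false true  true  false = lit≤
sgn₃ false true  false true  = lit≤
sgn₃ false false true  true  = lit≤
sgn₃ false true  true  true  = QP.≤-refl

0<2^ : ∀ j → 0ℚ < pow 2ℚ j
0<2^ j = 1<⇒0< (pow2≥1 j)

-- Three worlds in which failure persists.

module Triple
  {n : ℕ} {m : Fin n → ℕ} {k : ℕ} {p : Weights n m} (P : IsProb p)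
  (c : (v : Fin n) → Fin (m v) → ℚ) (c-nn : ∀ v o → 0ℚ ≤ c v o)
  (V : Fin n → Bool) (T : Tree m k (allFin n))
  where

  open Levels {m = m} k c c-nn

  y : World n m → Fin n → Bool
  y w = mem (path T w)

  module Mo (l : ℕ) (U : Fin n → Bool) = Moments {k = k} P V U (lv l) (lv-nn l) (lv≤1 l)

  -- The total advantage that three failing worlds exhibit at level `j + 1`: slack 435 minus three
  -- losses of 1, times `2ʲ`. The same number regularises the denominators of the potential.
  a₀ : ℕ → ℚ
  a₀ j = (⁺ 432 / 1) * pow 2ℚ j

  a₀-pos : ∀ j → 0ℚ < a₀ j
  a₀-pos j = *-pos (QP.positive⁻¹ (⁺ 432 / 1)) (0<2^ j)

  S : ℕ → (Fin n → Bool) → World n m → ℚ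
  S l U w = sumL us₀ (λ v → sgn (V v) (U v) (y w v) * lv l v (get w v))

  X-diff : ∀ l U w → S l U w + X l (λ v → V v ∨ U v) w ≡ X l (λ v → V v ∨ y w v) w
  X-diff l U w = trans (sym (sumL-+ us₀ (λ v → sgn (V v) (U v) (y w v) * lv l v (get w v)) (λ v → 𝟙 (V v ∨ U v) * lv l v (get w v))))
    (sumL-cong us₀ (λ {v} _ → trans (sym (QP.*-distribʳ-+ (lv l v (get w v)) (sgn (V v) (U v) (y w v)) (𝟙 (V v ∨ U v))))
      (cong (_* lv l v (get w v)) (sgn-𝟙 (V v) (U v) (y w v)))))

  W : (Fin n → Bool) → World n m → ℚ
  W U w = Mo.Product.prodL 0 U us₀ w (y w)

  Zs Ms : ℕ → (Fin n → Bool) → World n m → ℚ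
  Zs j U w = Mo.Quadratic.Z-of (suc j) U (a₀ j) (a₀-pos j) us₀ w (y w)
  Ms j U w = Mo.Quadratic.M-of (suc j) U (a₀ j) (a₀-pos j) us₀ w (y w)

  Ψ : ℕ → (Fin n → Bool) → World n m → ℚ
  Ψ j U w = Mo.Quadratic.ΨQ (suc j) U (a₀ j) (a₀-pos j) (Zs j U w , Ms j U w)

  Ms-nn : ∀ j U w → 0ℚ ≤ Ms j U w
  Ms-nn j U w = sumL-nn us₀ (λ v → *-nn (sq-nn (sgn (V v) (U v) (y w v))) (Mo.μ-nn (suc j) U v))

  Ψ-nn : ∀ j U w → 0ℚ ≤ Ψ j U w
  Ψ-nn j U w = Mo.Quadratic.ΨQ-nn (suc j) U (a₀ j) (a₀-pos j) (Zs j U w) (Ms j U w) (Ms-nn j U w)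

  W-nn : ∀ U w → 0ℚ ≤ W U w
  W-nn U w = Mo.Product.prodL-nn 0 U us₀ w (y w)

  9ℚ : ℚ
  9ℚ = ⁺ 9 / 1

  9Ψ-nn : ∀ U w j → 0ℚ ≤ 9ℚ * Ψ j U w
  9Ψ-nn U w j = *-nn (lit≤ {0ℚ} {9ℚ}) (Ψ-nn j U w)

  -- One potential for all levels. If three successful worlds still fail, either the three product
  -- terms together or a single quadratic term reaches one.
  dev : (Fin n → Bool) → World n m → ℚ
  dev U w = ¼ * W U w + sumN (suc k) (λ j → 9ℚ * Ψ j U w)

  dev-nn : ∀ U w → 0ℚ ≤ dev U w
  dev-nn U w = +-nn (*-nn (lit≤ {0ℚ} {¼}) (W-nn U w)) (sumN-nn (suc k) (9Ψ-nn U w))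

  module Three (a b d : World n m) where

    Ua Ub Ud : Fin n → Bool
    Ua v = y b v ∨ y d v
    Ub v = y a v ∨ y d v
    Ud v = y a v ∨ y b v

    XaU XbU XdU : ℕ → ℚ
    XaU l = X l (λ v → V v ∨ Ua v) a
    XbU l = X l (λ v → V v ∨ Ub v) b
    XdU l = X l (λ v → V v ∨ Ud v) d

    devs : ℚ
    devs = dev Ua a + dev Ub b + dev Ud d

    numL : (Fin n → Bool) → World n m → List (Fin n) → ℚ
    numL U w []       = 1ℚ
    numL U w (v ∷ us) = num (V v) (U v) (y w v) (lv 0 v (get w v)) * numL U w us

    num-nn : ∀ V U y {x} → 0ℚ ≤ x → x ≤ 1ℚ → 0ℚ ≤ num V U y x
    num-nn false false true  0≤x x≤1 = +-nn (lit≤ {0ℚ} {1ℚ}) (*-nn (lit≤ {0ℚ} {⅓}) 0≤x)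
    num-nn false true  false {x} 0≤x x≤1 = ≤-by (¼ * (1ℚ - x) + 3ℚ * ¼) (+-nn (*-nn (lit≤ {0ℚ} {¼}) (slack x≤1)) (lit≤ {0ℚ} {3ℚ * ¼})) (eq x)
      where
      eq : ∀ x → 1ℚ - ¼ * x ≡ 0ℚ + (¼ * (1ℚ - x) + 3ℚ * ¼)
      eq = solve-∀ ℚring
    num-nn false false false _ _ = lit≤ {0ℚ} {1ℚ}
    num-nn false true  true  _ _ = lit≤ {0ℚ} {1ℚ}
    num-nn true  _     _     _ _ = lit≤ {0ℚ} {1ℚ}

    numL-nn : ∀ U w us → 0ℚ ≤ numL U w us
    numL-nn U w []       = lit≤ {0ℚ} {1ℚ}
    numL-nn U w (v ∷ us) = *-nn (num-nn (V v) (U v) (y w v) (lv-nn 0 v (get w v)) (lv≤1 0 v (get w v))) (numL-nn U w us)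

    fac-split : ∀ V U y x μ → Mo.Product.fac 0 Ua V U y x μ ≡ num V U y x * den V U y μ
    fac-split false false true  x μ = refl
    fac-split false true  false x μ = refl
    fac-split false false false x μ = refl
    fac-split false true  true  x μ = refl
    fac-split true  _     _     x μ = refl

    -- By `den₃` the three mean parts of each vertex multiply to at least one, so inserting them
    -- only increases the product.
    prod₃ : ∀ us → numL Ua a us * numL Ub b us * numL Ud d us ≤
      Mo.Product.prodL 0 Ua us a (y a) * Mo.Product.prodL 0 Ub us b (y b) * Mo.Product.prodL 0 Ud us d (y d)
    prod₃ []       = QP.≤-refl
    prod₃ (v ∷ us) = subst₂ _≤_
      (eqˡ na nb nd (numL Ua a us) (numL Ub b us) (numL Ud d us))
      (trans (eqʳ na nb nd da db dd Pa Pb Pd)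
        (cong₂ _*_ (cong₂ _*_ (cong (_* Pa) (sym (fac-split (V v) (Ua v) (y a v) xa μv))) (cong (_* Pb) (sym (fac-split (V v) (Ub v) (y b v) xb μv))))
          (cong (_* Pd) (sym (fac-split (V v) (Ud v) (y d v) xd μv)))))
      (*-monoˡ n-nn (*-mono (lit≤ {0ℚ} {1ℚ}) (*-nn (*-nn Pa-nn Pb-nn) Pd-nn)
        (den₃ (V v) (y a v) (y b v) (y d v) (Mo.μ-nn 0 Ua v) (Mo.μ≤1 0 Ua v)) (prod₃ us)))
      where
      -- One mean serves all three worlds, since `μ` does not depend on `U`.
      μv = Mo.μ 0 Ua v
      xa = lv 0 v (get a v)
      xb = lv 0 v (get b v)
      xd = lv 0 v (get d v)
      na = num (V v) (Ua v) (y a v) xa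
      nb = num (V v) (Ub v) (y b v) xb
      nd = num (V v) (Ud v) (y d v) xd
      da = den (V v) (Ua v) (y a v) μv
      db = den (V v) (Ub v) (y b v) μv
      dd = den (V v) (Ud v) (y d v) μv
      Pa = Mo.Product.prodL 0 Ua us a (y a)
      Pb = Mo.Product.prodL 0 Ub us b (y b)
      Pd = Mo.Product.prodL 0 Ud us d (y d)
      Pa-nn = Mo.Product.prodL-nn 0 Ua us a (y a)
      Pb-nn = Mo.Product.prodL-nn 0 Ub us b (y b)
      Pd-nn = Mo.Product.prodL-nn 0 Ud us d (y d)
      n-nn : 0ℚ ≤ na * nb * nd
      n-nn = *-nn (*-nn (num-nn (V v) (Ua v) (y a v) (lv-nn 0 v (get a v)) (lv≤1 0 v (get a v))) (num-nn (V v) (Ub v) (y b v) (lv-nn 0 v (get b v)) (lv≤1 0 v (get b v))))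
        (num-nn (V v) (Ud v) (y d v) (lv-nn 0 v (get d v)) (lv≤1 0 v (get d v)))
      eqˡ : ∀ x y z A B D → x * y * z * (1ℚ * (A * B * D)) ≡ (x * A) * (y * B) * (z * D)
      eqˡ = solve-∀ ℚring
      eqʳ : ∀ x y z p q r A B D → x * y * z * ((p * q * r) * (A * B * D)) ≡ (x * p * A) * (y * q * B) * (z * r * D)
      eqʳ = solve-∀ ℚring

    count : ∀ U w us → ∃ λ u → ∃ λ e → numL U w us ≡ pow q43 u * pow q34 e ×
      sumL us (λ v → sgn (V v) (U v) (y w v) * lv 0 v (get w v)) + ℕ→ℚ e ≡ ℕ→ℚ u
    count U w []       = 0 , 0 , refl , refl
    count U w (v ∷ us) with count U w us | num-count (V v) (U v) (y w v) (leq (c v (get w v)) 1ℚ)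
    ... | u , e , h , s | u′ , e′ , h′ , s′ = u′ ℕ.+ u , e′ ℕ.+ e ,
        trans (cong₂ _*_ h′ h) (trans (eq (pow q43 u′) (pow q34 e′) (pow q43 u) (pow q34 e))
          (sym (cong₂ _*_ (pow-+ q43 u′ u) (pow-+ q34 e′ e)))) ,
        trans (cong (sumL (v ∷ us) f +_) (ℕ→ℚ-+ e′ e)) (trans (interchange (f v) (sumL us f) (ℕ→ℚ e′) (ℕ→ℚ e))
          (trans (cong₂ _+_ s′ s) (sym (ℕ→ℚ-+ u′ u))))
      where
      f : Fin n → ℚ
      f v = sgn (V v) (U v) (y w v) * lv 0 v (get w v)
      eq : ∀ a b c d → (a * b) * (c * d) ≡ (a * c) * (b * d)
      eq = solve-∀ ℚring

    -- `S 0 U w` is a difference `u - e` of natural numbers, so positivity already gives `e < u` and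
    -- a whole factor 4/3.
    num-large : ∀ U w → 0ℚ < S 0 U w → q43 ≤ numL U w us₀
    num-large U w h with count U w us₀
    ... | u , e , eq , s with u ℕP.≤? e
    ...   | no  u≰e = subst (q43 ≤_) (sym eq) (tilt≥ u e (ℕP.≰⇒> u≰e))
    ...   | yes u≤e = contradiction (ℕ→ℚ-mono u≤e) (<⇒¬≤ (subst (ℕ→ℚ e <_) s
              (subst (_< S 0 U w + ℕ→ℚ e) (QP.+-identityˡ (ℕ→ℚ e)) (QP.+-monoˡ-< (ℕ→ℚ e) h))))

    q43-nn : 0ℚ ≤ q43
    q43-nn = lit≤ {0ℚ} {q43}

    W-large : 0ℚ < S 0 Ua a → 0ℚ < S 0 Ub b → 0ℚ < S 0 Ud d → ⁺ 4 / 1 ≤ W Ua a + W Ub b + W Ud d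
    W-large ha hb hd = sum≥4 (W Ua a) (W Ub b) (W Ud d) (W-nn Ua a) (W-nn Ub b) (W-nn Ud d)
      (QP.≤-trans (*-mono (lit≤ {0ℚ} {q43 * q43}) (numL-nn Ud d us₀)
        (*-mono q43-nn (numL-nn Ub b us₀) (num-large Ua a ha) (num-large Ub b hb)) (num-large Ud d hd)) (prod₃ us₀))

    Z₃ M₃ S₃ : ℕ → ℚ
    Z₃ j = Zs j Ua a + Zs j Ub b + Zs j Ud d
    M₃ j = Ms j Ua a + Ms j Ub b + Ms j Ud d
    S₃ l = S l Ua a + S l Ub b + S l Ud d

    -- Centring subtracts `Σ sgn · μ`, and by `sgn₃` thrice this is at most minus the mass `M₃`. The
    -- drift thus supplies the random part of the denominators.
    Z-large : ∀ j → 3ℚ * S₃ (suc j) + M₃ j ≤ 3ℚ * Z₃ j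
    Z-large j = subst₂ _≤_
      (trans (sumL-+ us₀ (λ v → 3ℚ * (sa v * xa v + sb v * xb v + sd v * xd v)) (λ v → ma v * μ v + mb v * μ v + md v * μ v)) (cong₂ _+_
        (trans (sumL-* us₀ 3ℚ (λ v → sa v * xa v + sb v * xb v + sd v * xd v)) (cong (3ℚ *_) (sumL-3 us₀ (λ v → sa v * xa v) (λ v → sb v * xb v) (λ v → sd v * xd v))))
        (sumL-3 us₀ (λ v → ma v * μ v) (λ v → mb v * μ v) (λ v → md v * μ v))))
      (trans (sumL-* us₀ 3ℚ (λ v → sa v * (xa v - μ v) + sb v * (xb v - μ v) + sd v * (xd v - μ v)))
        (cong (3ℚ *_) (sumL-3 us₀ (λ v → sa v * (xa v - μ v)) (λ v → sb v * (xb v - μ v)) (λ v → sd v * (xd v - μ v)))))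
      (sumL-mono us₀ (λ {v} _ → ≤-by (μ v * (0ℚ - (3ℚ * (sa v + sb v + sd v) + (ma v + mb v + md v))))
        (*-nn (Mo.μ-nn (suc j) Ua v) (slack (sgn₃ (V v) (y a v) (y b v) (y d v))))
        (eq (sa v) (sb v) (sd v) (ma v) (mb v) (md v) (xa v) (xb v) (xd v) (μ v))))
      where
      μ xa xb xd sa sb sd ma mb md : Fin n → ℚ
      μ v  = Mo.μ (suc j) Ua v
      xa v = lv (suc j) v (get a v)
      xb v = lv (suc j) v (get b v)
      xd v = lv (suc j) v (get d v)
      sa v = sgn (V v) (Ua v) (y a v)
      sb v = sgn (V v) (Ub v) (y b v)
      sd v = sgn (V v) (Ud v) (y d v)
      ma v = asgn (V v) (Ua v) (y a v)
      mb v = asgn (V v) (Ub v) (y b v)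
      md v = asgn (V v) (Ud v) (y d v)
      eq₁ : ∀ s x μ → s * (x - μ) ≡ s * x - s * μ
      eq₁ = solve-∀ ℚring
      eq₂ : ∀ A B D a b d → A - a + (B - b) + (D - d) ≡ A + B + D - (a + b + d)
      eq₂ = solve-∀ ℚring
      eq₃ : ∀ a b d μ → a * μ + b * μ + d * μ ≡ (a + b + d) * μ
      eq₃ = solve-∀ ℚring
      eq₄ : ∀ t s m μ → 3ℚ * (t - s * μ) ≡ 3ℚ * t + m * μ + μ * (0ℚ - (3ℚ * s + m))
      eq₄ = solve-∀ ℚring
      eq : ∀ sa sb sd ma mb md xa xb xd μ →
        3ℚ * (sa * (xa - μ) + sb * (xb - μ) + sd * (xd - μ)) ≡
        3ℚ * (sa * xa + sb * xb + sd * xd) + (ma * μ + mb * μ + md * μ)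
        + μ * (0ℚ - (3ℚ * (sa + sb + sd) + (ma + mb + md)))
      eq sa sb sd ma mb md xa xb xd μ = trans
        (cong (3ℚ *_) (trans (cong₂ _+_ (cong₂ _+_ (eq₁ sa xa μ) (eq₁ sb xb μ)) (eq₁ sd xd μ))
          (trans (eq₂ (sa * xa) (sb * xb) (sd * xd) (sa * μ) (sb * μ) (sd * μ))
            (cong (λ z → sa * xa + sb * xb + sd * xd - z) (eq₃ sa sb sd μ)))))
        (trans (eq₄ (sa * xa + sb * xb + sd * xd) (sa + sb + sd) (ma + mb + md) μ)
          (cong (λ z → 3ℚ * (sa * xa + sb * xb + sd * xd) + z + μ * (0ℚ - (3ℚ * (sa + sb + sd) + (ma + mb + md))))
            (sym (eq₃ ma mb md μ))))

    pigeon₃ : ∀ t z₁ z₂ z₃ m₁ m₂ m₃ → 3ℚ * t + (m₁ + m₂ + m₃) ≤ 3ℚ * (z₁ + z₂ + z₃) →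
      t + m₁ ≤ 3ℚ * z₁ ⊎ t + m₂ ≤ 3ℚ * z₂ ⊎ t + m₃ ≤ 3ℚ * z₃
    pigeon₃ t z₁ z₂ z₃ m₁ m₂ m₃ h with ≤⊎> (t + m₁) (3ℚ * z₁) | ≤⊎> (t + m₂) (3ℚ * z₂) | ≤⊎> (t + m₃) (3ℚ * z₃)
    ... | inj₁ l  | _       | _       = inj₁ l
    ... | inj₂ _  | inj₁ l  | _       = inj₂ (inj₁ l)
    ... | inj₂ _  | inj₂ _  | inj₁ l  = inj₂ (inj₂ l)
    ... | inj₂ l₁ | inj₂ l₂ | inj₂ l₃ = contradiction h (<⇒¬≤ (subst₂ _<_ (eq z₁ z₂ z₃) (eq′ t m₁ m₂ m₃)
          (QP.+-mono-< (QP.+-mono-< l₁ l₂) l₃)))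
      where
      eq : ∀ z₁ z₂ z₃ → 3ℚ * z₁ + 3ℚ * z₂ + 3ℚ * z₃ ≡ 3ℚ * (z₁ + z₂ + z₃)
      eq = solve-∀ ℚring
      eq′ : ∀ t m₁ m₂ m₃ → t + m₁ + (t + m₂) + (t + m₃) ≡ 3ℚ * t + (m₁ + m₂ + m₃)
      eq′ = solve-∀ ℚring

    Ψ-large : ∀ j → a₀ j ≤ S₃ (suc j) → 1ℚ ≤ 9ℚ * Ψ j Ua a ⊎ 1ℚ ≤ 9ℚ * Ψ j Ub b ⊎ 1ℚ ≤ 9ℚ * Ψ j Ud d
    Ψ-large j h = go (pigeon₃ (a₀ j) (Zs j Ua a) (Zs j Ub b) (Zs j Ud d) (Ms j Ua a) (Ms j Ub b) (Ms j Ud d)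
      (QP.≤-trans (QP.+-monoˡ-≤ (M₃ j) (*-monoˡ (lit≤ {0ℚ} {3ℚ}) h)) (Z-large j)))
      where
      large : ∀ U w → a₀ j + Ms j U w ≤ 3ℚ * Zs j U w → 1ℚ ≤ 9ℚ * Ψ j U w
      large U w = Mo.Quadratic.ΨQ-large (suc j) U (a₀ j) (a₀-pos j) (Zs j U w) (Ms j U w) (Ms-nn j U w)
      go : a₀ j + Ms j Ua a ≤ 3ℚ * Zs j Ua a ⊎ a₀ j + Ms j Ub b ≤ 3ℚ * Zs j Ub b ⊎ a₀ j + Ms j Ud d ≤ 3ℚ * Zs j Ud d →
        1ℚ ≤ 9ℚ * Ψ j Ua a ⊎ 1ℚ ≤ 9ℚ * Ψ j Ub b ⊎ 1ℚ ≤ 9ℚ * Ψ j Ud d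
      go (inj₁ l)        = inj₁ (large Ua a l)
      go (inj₂ (inj₁ l)) = inj₂ (inj₁ (large Ub b l))
      go (inj₂ (inj₂ l)) = inj₂ (inj₂ (large Ud d l))

    Ψ≤dev : ∀ {j} U w → j ℕ.≤ k → 9ℚ * Ψ j U w ≤ dev U w
    Ψ≤dev U w l = QP.≤-trans (term≤sumN {f = λ i → 9ℚ * Ψ i U w} (9Ψ-nn U w) (ℕ.s≤s l))
      (≤-by (¼ * W U w) (*-nn (lit≤ {0ℚ} {¼}) (W-nn U w)) (QP.+-comm (¼ * W U w) (sumN (suc k) (λ i → 9ℚ * Ψ i U w))))

    W≤dev : ∀ U w → ¼ * W U w ≤ dev U w
    W≤dev U w = ≤-by (sumN (suc k) (λ j → 9ℚ * Ψ j U w)) (sumN-nn (suc k) (9Ψ-nn U w)) refl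

    ≤devs₁ : dev Ua a ≤ devs
    ≤devs₁ = ≤-by (dev Ub b + dev Ud d) (+-nn (dev-nn Ub b) (dev-nn Ud d)) (QP.+-assoc (dev Ua a) (dev Ub b) (dev Ud d))
    ≤devs₂ : dev Ub b ≤ devs
    ≤devs₂ = ≤-by (dev Ua a + dev Ud d) (+-nn (dev-nn Ua a) (dev-nn Ud d)) (eq (dev Ua a) (dev Ub b) (dev Ud d))
      where
      eq : ∀ x y z → x + y + z ≡ y + (x + z)
      eq = solve-∀ ℚring
    ≤devs₃ : dev Ud d ≤ devs
    ≤devs₃ = ≤-by (dev Ua a + dev Ub b) (+-nn (dev-nn Ua a) (dev-nn Ub b)) (QP.+-comm (dev Ua a + dev Ub b) (dev Ud d))

    module _
      (sa : ∀ l → K ≤ X l (λ v → V v ∨ y a v) a + rr l)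
      (sb : ∀ l → K ≤ X l (λ v → V v ∨ y b v) b + rr l)
      (sd : ∀ l → K ≤ X l (λ v → V v ∨ y d v) d + rr l)
      where

      -- `S` is the deficit left by the other two paths minus the deficit left by the own path, and
      -- the latter is at most `rr l`.
      S≥ : ∀ l U w → K ≤ X l (λ v → V v ∨ y w v) w + rr l → K - X l (λ v → V v ∨ U v) w - rr l ≤ S l U w
      S≥ l U w h = ≤-by ((X l (λ v → V v ∨ y w v) w + rr l) - K) (slack h)
        (trans (eq (S l U w) (X l (λ v → V v ∨ U v) w) K (rr l)) (cong (λ z → K - X l (λ v → V v ∨ U v) w - rr l + (z + rr l - K)) (X-diff l U w)))
        where
        eq : ∀ s x k r → s ≡ k - x - r + (s + x + r - k)
        eq = solve-∀ ℚring

      pos-S₀ : ∀ U w → K ≤ X 0 (λ v → V v ∨ y w v) w + rr 0 → X 0 (λ v → V v ∨ U v) w < K → 0ℚ < S 0 U w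
      pos-S₀ U w h l = QP.<-≤-trans (subst₂ _<_ (QP.+-inverseʳ x) (eq K x) (QP.+-monoˡ-< (- x) l)) (S≥ 0 U w h)
        where
        x = X 0 (λ v → V v ∨ U v) w
        eq : ∀ k x → k + - x ≡ k - x - 0ℚ
        eq = solve-∀ ℚring

      -- One slack suffices for the three worlds: `435 · 2ʲ` minus three losses of `2ʲ` is `a₀ j`.
      -- At level 0 there is neither slack nor loss, and the strict inequalities feed the product
      -- bound.
      core : ∀ l → l ℕ.≤ suc k → XaU l < K → XbU l < K → XdU l < K →
        XaU l + XbU l + XdU l + sl l ≤ K + K + K → 1ℚ ≤ devs
      core zero _ ha hb hd _ = QP.≤-trans (*-monoˡ (lit≤ {0ℚ} {¼}) (W-large (pos-S₀ Ua a (sa 0) ha) (pos-S₀ Ub b (sb 0) hb) (pos-S₀ Ud d (sd 0) hd)))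
        (QP.≤-trans (QP.≤-reflexive (eq (W Ua a) (W Ub b) (W Ud d)))
          (QP.+-mono-≤ (QP.+-mono-≤ (W≤dev Ua a) (W≤dev Ub b)) (W≤dev Ud d)))
        where
        eq : ∀ x y z → ¼ * (x + y + z) ≡ ¼ * x + ¼ * y + ¼ * z
        eq = solve-∀ ℚring
      core (suc j) (ℕ.s≤s j≤k) _ _ _ h = pick (Ψ-large j big)
        where
        t = pow 2ℚ j
        big : a₀ j ≤ S₃ (suc j)
        big = QP.≤-trans (≤-by (K + K + K - (XaU (suc j) + XbU (suc j) + XdU (suc j) + C₀ * t)) (slack h) (eq K (XaU (suc j)) (XbU (suc j)) (XdU (suc j)) t))
          (QP.+-mono-≤ (QP.+-mono-≤ (S≥ (suc j) Ua a (sa (suc j))) (S≥ (suc j) Ub b (sb (suc j)))) (S≥ (suc j) Ud d (sd (suc j))))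
          where
          eq : ∀ K x y z t → K - x - t + (K - y - t) + (K - z - t) ≡
            (⁺ 432 / 1) * t + (K + K + K - (x + y + z + C₀ * t))
          eq = solve-∀ ℚring
        pick : 1ℚ ≤ 9ℚ * Ψ j Ua a ⊎ 1ℚ ≤ 9ℚ * Ψ j Ub b ⊎ 1ℚ ≤ 9ℚ * Ψ j Ud d → 1ℚ ≤ devs
        pick (inj₁ l)        = QP.≤-trans l (QP.≤-trans (Ψ≤dev Ua a j≤k) ≤devs₁)
        pick (inj₂ (inj₁ l)) = QP.≤-trans l (QP.≤-trans (Ψ≤dev Ub b j≤k) ≤devs₂)
        pick (inj₂ (inj₂ l)) = QP.≤-trans l (QP.≤-trans (Ψ≤dev Ud d j≤k) ≤devs₃)

      -- The largest of the three failing levels serves all worlds. As `X` decreases in the level,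
      -- the other two deficits are still positive there, although their slack is lost.
      triple : ¬ Ok (λ v → V v ∨ Ua v) a → ¬ Ok (λ v → V v ∨ Ub v) b → ¬ Ok (λ v → V v ∨ Ud v) d → 1ℚ ≤ devs
      triple na nb nd = combine (fails {Ua′} {a} na) (fails {Ub′} {b} nb) (fails {Ud′} {d} nd)
        where
        Fail : (Fin n → Bool) → World n m → Set
        Fail U w = ∃ λ l → l ℕ.≤ suc k × X l U w + sl l < K
        drop : ∀ l i U w → i ℕ.≤ l → X i U w + sl i < K → X l U w < K
        drop l i U w i≤l h = QP.≤-<-trans (QP.≤-trans (X-anti U w i≤l) (≤-by (sl i) (sl-nn i) refl)) h
        Ua′ Ub′ Ud′ : Fin n → Bool
        Ua′ v = V v ∨ Ua v
        Ub′ v = V v ∨ Ub v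
        Ud′ v = V v ∨ Ud v
        sum₃ : ∀ x y z s → x + s < K → y < K → z < K → x + y + z + s ≤ K + K + K
        sum₃ x y z s h₁ h₂ h₃ = subst (_≤ K + K + K) (eq x y z s) (QP.+-mono-≤ (QP.+-mono-≤ (QP.<⇒≤ h₁) (QP.<⇒≤ h₂)) (QP.<⇒≤ h₃))
          where
          eq : ∀ x y z s → x + s + y + z ≡ x + y + z + s
          eq = solve-∀ ℚring
        combine : Fail Ua′ a → Fail Ub′ b → Fail Ud′ d → 1ℚ ≤ devs
        combine (la , la≤ , fa) (lb , lb≤ , fb) (ld , ld≤ , fd) = choose (ℕP.≤-total la lb) (ℕP.≤-total la ld) (ℕP.≤-total lb ld)
          where
          atA : lb ℕ.≤ la → ld ℕ.≤ la → 1ℚ ≤ devs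
          atA b≤ d≤ = core la la≤ A B D (sum₃ (XaU la) (XbU la) (XdU la) (sl la) fa B D)
            where
            A = drop la la Ua′ a ℕP.≤-refl fa
            B = drop la lb Ub′ b b≤ fb
            D = drop la ld Ud′ d d≤ fd
          atB : la ℕ.≤ lb → ld ℕ.≤ lb → 1ℚ ≤ devs
          atB a≤ d≤ = core lb lb≤ A B D (subst (_≤ K + K + K) (eq (XaU lb) (XbU lb) (XdU lb) (sl lb)) (sum₃ (XbU lb) (XaU lb) (XdU lb) (sl lb) fb A D))
            where
            A = drop lb la Ua′ a a≤ fa
            B = drop lb lb Ub′ b ℕP.≤-refl fb
            D = drop lb ld Ud′ d d≤ fd
            eq : ∀ x y z s → y + x + z + s ≡ x + y + z + s
            eq = solve-∀ ℚring
          atD : la ℕ.≤ ld → lb ℕ.≤ ld → 1ℚ ≤ devs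
          atD a≤ b≤ = core ld ld≤ A B D (subst (_≤ K + K + K) (eq (XaU ld) (XbU ld) (XdU ld) (sl ld)) (sum₃ (XdU ld) (XaU ld) (XbU ld) (sl ld) fd A B))
            where
            A = drop ld la Ua′ a a≤ fa
            B = drop ld lb Ub′ b b≤ fb
            D = drop ld ld Ud′ d ℕP.≤-refl fd
            eq : ∀ x y z s → z + x + y + s ≡ x + y + z + s
            eq = solve-∀ ℚring
          choose : la ℕ.≤ lb ⊎ lb ℕ.≤ la → la ℕ.≤ ld ⊎ ld ℕ.≤ la → lb ℕ.≤ ld ⊎ ld ℕ.≤ lb → 1ℚ ≤ devs
          choose (inj₂ b≤a) (inj₂ d≤a) _          = atA b≤a d≤a
          choose (inj₂ b≤a) (inj₁ a≤d) _          = atD a≤d (ℕP.≤-trans b≤a a≤d)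
          choose (inj₁ a≤b) _          (inj₂ d≤b) = atB a≤b d≤b
          choose (inj₁ a≤b) _          (inj₁ b≤d) = atD (ℕP.≤-trans a≤b b≤d) b≤d

-- One phase: averaging over three worlds.

inv-unique : ∀ {x z} → 0ℚ < x → x * z ≡ 1ℚ → inv x ≡ z
inv-unique {x} {z} 0<x h = trans (sym (QP.*-identityʳ (inv x))) (trans (cong (inv x *_) (sym h))
  (trans (eq (inv x) x z) (trans (cong (_* z) (*-inv 0<x)) (QP.*-identityˡ z))))
  where
  eq : ∀ u x z → u * (x * z) ≡ (x * u) * z
  eq = solve-∀ ℚring

½ℚ : ℚ
½ℚ = ⁺ 1 / 2

geometric : ∀ J → sumN J (pow ½ℚ) ≡ 2ℚ - 2ℚ * pow ½ℚ J
geometric zero    = refl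
geometric (suc J) = trans (cong (_+ pow ½ℚ J) (geometric J)) (eq (pow ½ℚ J))
  where
  eq : ∀ z → 2ℚ - 2ℚ * z + z ≡ 2ℚ - 2ℚ * (½ℚ * z)
  eq = solve-∀ ℚring

sumN-cong : ∀ J {f g} → (∀ j → f j ≡ g j) → sumN J f ≡ sumN J g
sumN-cong zero    h = refl
sumN-cong (suc J) h = cong₂ _+_ (sumN-cong J h) (h J)

sumN-mono : ∀ J {f g} → (∀ j → f j ≤ g j) → sumN J f ≤ sumN J g
sumN-mono zero    h = QP.≤-refl
sumN-mono (suc J) h = QP.+-mono-≤ (sumN-mono J h) (h J)

sumN-* : ∀ J c f → sumN J (λ j → c * f j) ≡ c * sumN J f
sumN-* zero    c f = sym (QP.*-zeroʳ c)
sumN-* (suc J) c f = trans (cong (_+ c * f J) (sumN-* J c f)) (sym (QP.*-distribˡ-+ c (sumN J f) (f J)))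

E-sumN : ∀ {n m} {p : Weights n m} → IsProb p → ∀ J (f : ℕ → World n m → ℚ) →
  E p (λ w → sumN J (λ j → f j w)) ≡ sumN J (λ j → E p (f j))
E-sumN P zero    f = E-const P 0ℚ
E-sumN {p = p} P (suc J) f = trans (E-+ p (λ w → sumN J (λ j → f j w)) (f J)) (cong (_+ E p (f J)) (E-sumN P J f))

module _ {n : ℕ} {m : Fin n → ℕ} (p : Weights n m) where

  -- The world `a` is integrated innermost: the supermartingale bounds hold for each fixed pair `b`,
  -- `d`.
  E₃ : (World n m → World n m → World n m → ℚ) → ℚ
  E₃ h = E p (λ b → E p (λ d → E p (λ a → h a b d)))

  E₃-sym₁ : ∀ h → E₃ (λ a b d → h b a d) ≡ E₃ h
  E₃-sym₁ h = trans (E-cong p (λ b → E-swap p p (λ d a → h b a d)))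
    (trans (E-swap p p (λ b a → E p (λ d → h b a d))) (E-cong p (λ a → E-swap p p (λ b d → h b a d))))

  E₃-sym₂ : ∀ h → E₃ (λ a b d → h d a b) ≡ E₃ h
  E₃-sym₂ h = trans (E-cong p (λ b → E-swap p p (λ d a → h d a b)))
    (E-swap p p (λ b a → E p (λ d → h d a b)))

  E₃-+ : ∀ f g → E₃ (λ a b d → f a b d + g a b d) ≡ E₃ f + E₃ g
  E₃-+ f g = trans (E-cong p (λ b → trans (E-cong p (λ d → E-+ p (λ a → f a b d) (λ a → g a b d)))
      (E-+ p (λ d → E p (λ a → f a b d)) (λ d → E p (λ a → g a b d)))))
    (E-+ p (λ b → E p (λ d → E p (λ a → f a b d))) (λ b → E p (λ d → E p (λ a → g a b d))))

  E₃-sym : ∀ h → E₃ (λ a b d → h a b d + h b a d + h d a b) ≡ 3ℚ * E₃ h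
  E₃-sym h = trans (E₃-+ (λ a b d → h a b d + h b a d) (λ a b d → h d a b))
    (trans (cong₂ _+_ (trans (E₃-+ h (λ a b d → h b a d)) (cong (E₃ h +_) (E₃-sym₁ h))) (E₃-sym₂ h)) (eq (E₃ h)))
    where
    eq : ∀ z → z + z + z ≡ 3ℚ * z
    eq = solve-∀ ℚring

α₀ : ℚ
α₀ = ⁺ 23 / 24

module Step
  {n : ℕ} {m : Fin n → ℕ} {k : ℕ} {p : Weights n m} (P : IsProb p)
  (c : (v : Fin n) → Fin (m v) → ℚ) (c-nn : ∀ v o → 0ℚ ≤ c v o)
  (V : Fin n → Bool) (T : Tree m k (allFin n))
  (good : World n m → Bool)
  (good-sum : ∀ w → good w ≡ true → sumL (chosen T w) (λ v → c v (get w v)) ≤ 1ℚ)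
  where

  open Levels {m = m} k c c-nn
  open Triple P c c-nn V T

  φ : World n m → ℚ
  φ = fl V

  ψ q : ℚ
  ψ = E p φ
  q = E p (λ w → 𝟙 (not (good w)))

  ψ-nn : 0ℚ ≤ ψ
  ψ-nn = E-nn P (fl-nn V)

  q-nn : 0ℚ ≤ q
  q-nn = E-nn P (λ w → 𝟙-nn (not (good w)))

  E-W : ∀ U → E p (λ w → φ w * W U w) ≤ ψ
  E-W U = Mo.Product.product-bound 0 U T us₀-unique φ (fl-set V) (fl-nn V)

  E-Ψ : ∀ U j → E p (λ w → φ w * Ψ j U w) ≤ inv (a₀ j) * ψ
  E-Ψ U j = Mo.Quadratic.quadratic-bound (suc j) U (a₀ j) (a₀-pos j) T us₀-unique φ (fl-set V) (fl-nn V)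

  1/432 : ℚ
  1/432 = ⁺ 1 / 432

  inv-a₀ : ∀ j → inv (a₀ j) ≡ 1/432 * pow ½ℚ j
  inv-a₀ j = inv-unique (a₀-pos j) (trans (eq (pow 2ℚ j) (pow ½ℚ j)) (go j))
    where
    eq : ∀ a b → (⁺ 432 / 1) * a * (1/432 * b) ≡ a * b
    eq = solve-∀ ℚring
    eq′ : ∀ a b → 2ℚ * a * (½ℚ * b) ≡ a * b
    eq′ = solve-∀ ℚring
    go : ∀ j → pow 2ℚ j * pow ½ℚ j ≡ 1ℚ
    go zero    = refl
    go (suc j) = trans (eq′ (pow 2ℚ j) (pow ½ℚ j)) (go j)

  -- `7/24` is `1/4` from the product term plus `1/24` from the quadratic terms, as
  -- `Σ 9 / (432 · 2ʲ) ≤ 1/24`.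
  E-dev : ∀ U → E p (λ w → φ w * dev U w) ≤ (⁺ 7 / 24) * ψ
  E-dev U = QP.≤-trans (QP.≤-reflexive split) (QP.≤-trans
    (QP.+-mono-≤ (*-monoˡ (lit≤ {0ℚ} {¼}) (E-W U)) (sumN-mono (suc k) (λ j → *-monoˡ (lit≤ {0ℚ} {9ℚ}) (E-Ψ U j))))
    (QP.≤-trans (QP.+-monoʳ-≤ (¼ * ψ) (QP.≤-reflexive sum-eq))
      (≤-by ((⁺ 1 / 24) * (pow ½ℚ (suc k) * ψ)) (*-nn (lit≤ {0ℚ} {⁺ 1 / 24}) (*-nn (pow-nn (suc k) (lit≤ {0ℚ} {½ℚ})) ψ-nn))
        (fin-eq ψ (pow ½ℚ (suc k))))))
    where
    term : ℕ → World n m → ℚ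
    term j w = 9ℚ * (φ w * Ψ j U w)
    eq₁ : ∀ f x s → f * (¼ * x + s) ≡ ¼ * (f * x) + f * s
    eq₁ = solve-∀ ℚring
    eq₂ : ∀ f x → f * (9ℚ * x) ≡ 9ℚ * (f * x)
    eq₂ = solve-∀ ℚring
    split : E p (λ w → φ w * dev U w) ≡ ¼ * E p (λ w → φ w * W U w) + sumN (suc k) (λ j → 9ℚ * E p (λ w → φ w * Ψ j U w))
    split = trans (E-cong p (λ w → trans (eq₁ (φ w) (W U w) (sumN (suc k) (λ j → 9ℚ * Ψ j U w)))
        (cong (¼ * (φ w * W U w) +_) (trans (sym (sumN-* (suc k) (φ w) (λ j → 9ℚ * Ψ j U w)))
          (sumN-cong (suc k) (λ j → eq₂ (φ w) (Ψ j U w)))))))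
      (trans (E-+ p (λ w → ¼ * (φ w * W U w)) (λ w → sumN (suc k) (λ j → term j w)))
        (cong₂ _+_ (E-* p ¼ (λ w → φ w * W U w))
          (trans (E-sumN P (suc k) term) (sumN-cong (suc k) (λ j → E-* p 9ℚ (λ w → φ w * Ψ j U w))))))
    eq₃ : ∀ x s → 9ℚ * (1/432 * x * s) ≡ (⁺ 1 / 48) * s * x
    eq₃ = solve-∀ ℚring
    sum-eq : sumN (suc k) (λ j → 9ℚ * (inv (a₀ j) * ψ)) ≡ (⁺ 1 / 48) * ψ * (2ℚ - 2ℚ * pow ½ℚ (suc k))
    sum-eq = trans (sumN-cong (suc k) (λ j → trans (cong (λ z → 9ℚ * (z * ψ)) (inv-a₀ j)) (eq₃ (pow ½ℚ j) ψ)))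
      (trans (sumN-* (suc k) ((⁺ 1 / 48) * ψ) (pow ½ℚ)) (cong ((⁺ 1 / 48) * ψ *_) (geometric (suc k))))
    fin-eq : ∀ s x → (⁺ 7 / 24) * s ≡ ¼ * s + (⁺ 1 / 48) * s * (2ℚ - 2ℚ * x) + (⁺ 1 / 24) * (x * s)
    fin-eq = solve-∀ ℚring

  -- On a world where the optimum overruns the budget the path may be too long, so it adds nothing
  -- to the tour.
  P′ : World n m → List (Fin n)
  P′ w = if good w then path T w else []

  V′ : World n m → World n m → Fin n → Bool
  V′ b d v = V v ∨ (mem (P′ b) v ∨ mem (P′ d) v)

  ng : World n m → ℚ
  ng w = 𝟙 (not (good w))

  H Ff : World n m → World n m → World n m → ℚ
  H a b d = dev (λ v → y b v ∨ y d v) a + ng a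
  Ff a b d = fl (V′ b d) a

  H-nn : ∀ a b d → 0ℚ ≤ H a b d
  H-nn a b d = +-nn (dev-nn (λ v → y b v ∨ y d v) a) (𝟙-nn (not (good a)))

  V′-good : ∀ b d → good b ≡ true → good d ≡ true → ∀ v → (V v ∨ (y b v ∨ y d v)) ≡ true → V′ b d v ≡ true
  V′-good b d gb gd v h rewrite gb | gd = h

  H₃ F₃ : World n m → World n m → World n m → ℚ
  H₃ a b d = H a b d + H b a d + H d a b
  F₃ a b d = Ff a b d + Ff b a d + Ff d a b

  -- Unless all three fail, two indicators at most are 1. If all three fail, either a world is bad,
  -- which `ng` records, or `triple` applies.
  pointwise : ∀ a b d → F₃ a b d ≤ 2ℚ + H₃ a b d
  pointwise a b d = cases (ok? (V′ b d) a) (ok? (V′ a d) b) (ok? (V′ a b) d)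
    where
    H₃-nn : 0ℚ ≤ H₃ a b d
    H₃-nn = +-nn (+-nn (H-nn a b d) (H-nn b a d)) (H-nn d a b)
    2≤ : 2ℚ ≤ 2ℚ + H₃ a b d
    2≤ = ≤-by (H₃ a b d) H₃-nn refl
    fa≤1 = fl≤1 (V′ b d) a
    fb≤1 = fl≤1 (V′ a d) b
    fd≤1 = fl≤1 (V′ a b) d
    sum≤ : ∀ {x y z x′ y′ z′} → x ≤ x′ → y ≤ y′ → z ≤ z′ → x + y + z ≤ x′ + y′ + z′
    sum≤ h₁ h₂ h₃ = QP.+-mono-≤ (QP.+-mono-≤ h₁ h₂) h₃
    3≤ : 1ℚ ≤ H₃ a b d → F₃ a b d ≤ 2ℚ + H₃ a b d
    3≤ h = QP.≤-trans (sum≤ fa≤1 fb≤1 fd≤1) (QP.+-monoʳ-≤ 2ℚ h)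
    dev≤H : ∀ x y′ z → dev (λ v → y y′ v ∨ y z v) x ≤ H x y′ z
    dev≤H x y′ z = ≤-by (ng x) (𝟙-nn (not (good x))) refl
    devs≤ : dev (λ v → y b v ∨ y d v) a + dev (λ v → y a v ∨ y d v) b + dev (λ v → y a v ∨ y b v) d ≤ H₃ a b d
    devs≤ = sum≤ (dev≤H a b d) (dev≤H b a d) (dev≤H d a b)
    bad : ∀ w → good w ≡ false → 1ℚ ≤ ng w
    bad w g rewrite g = QP.≤-refl
    ng≤H : ∀ x y z → ng x ≤ H x y z
    ng≤H x y′ z = ≤-by (dev (λ v → y y′ v ∨ y z v) x) (dev-nn (λ v → y y′ v ∨ y z v) x) (QP.+-comm (dev (λ v → y y′ v ∨ y z v) x) (ng x))
    allGood : good a ≡ true → good b ≡ true → good d ≡ true →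
      ¬ Ok (V′ b d) a → ¬ Ok (V′ a d) b → ¬ Ok (V′ a b) d → F₃ a b d ≤ 2ℚ + H₃ a b d
    allGood ga gb gd na nb nd = 3≤ (QP.≤-trans (Three.triple a b d
        (λ l → success T l V a (good-sum a ga)) (λ l → success T l V b (good-sum b gb)) (λ l → success T l V d (good-sum d gd))
        (λ ok → na (Ok-mono a (V′-good b d gb gd) ok)) (λ ok → nb (Ok-mono b (V′-good a d ga gd) ok)) (λ ok → nd (Ok-mono d (V′-good a b ga gb) ok)))
      devs≤)
    fails₃ : ∀ ga gb gd → good a ≡ ga → good b ≡ gb → good d ≡ gd →
      ¬ Ok (V′ b d) a → ¬ Ok (V′ a d) b → ¬ Ok (V′ a b) d → F₃ a b d ≤ 2ℚ + H₃ a b d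
    fails₃ true true true ga gb gd na nb nd = allGood ga gb gd na nb nd
    fails₃ false _ _ ga _ _ _ _ _ = 3≤ (QP.≤-trans (bad a ga) (QP.≤-trans (ng≤H a b d)
      (≤-by (H b a d + H d a b) (+-nn (H-nn b a d) (H-nn d a b)) (QP.+-assoc (H a b d) (H b a d) (H d a b)))))
    fails₃ true false _ _ gb _ _ _ _ = 3≤ (QP.≤-trans (bad b gb) (QP.≤-trans (ng≤H b a d)
      (≤-by (H a b d + H d a b) (+-nn (H-nn a b d) (H-nn d a b)) (eq (H a b d) (H b a d) (H d a b)))))
      where
      eq : ∀ x y z → x + y + z ≡ y + (x + z)
      eq = solve-∀ ℚring
    fails₃ true true false _ _ gd _ _ _ = 3≤ (QP.≤-trans (bad d gd) (QP.≤-trans (ng≤H d a b)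
      (≤-by (H a b d + H b a d) (+-nn (H-nn a b d) (H-nn b a d)) (QP.+-comm (H a b d + H b a d) (H d a b)))))
    cases : Dec (Ok (V′ b d) a) → Dec (Ok (V′ a d) b) → Dec (Ok (V′ a b) d) → F₃ a b d ≤ 2ℚ + H₃ a b d
    cases (yes ok) _ _ = QP.≤-trans (sum≤ (QP.≤-reflexive (fl-ok ok)) fb≤1 fd≤1) 2≤
    cases (no _) (yes ok) _ = QP.≤-trans (sum≤ fa≤1 (QP.≤-reflexive (fl-ok ok)) fd≤1) 2≤
    cases (no _) (no _) (yes ok) = QP.≤-trans (sum≤ fa≤1 fb≤1 (QP.≤-reflexive (fl-ok ok))) 2≤
    cases (no na) (no nb) (no nd) = fails₃ (good a) (good b) (good d) refl refl refl na nb nd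

  φ₃ hF hH : World n m → World n m → World n m → ℚ
  φ₃ x y z = φ x * (φ y * φ z)
  hF x y z = φ₃ x y z * Ff x y z
  hH x y z = φ₃ x y z * H x y z

  weighted : ∀ a b d → hF a b d + hF b a d + hF d a b ≤ 2ℚ * φ₃ a b d + (hH a b d + hH b a d + hH d a b)
  weighted a b d = subst₂ _≤_ (eq (φ a) (φ b) (φ d) (Ff a b d) (Ff b a d) (Ff d a b))
    (trans (QP.*-distribˡ-+ (φ₃ a b d) 2ℚ (H₃ a b d)) (cong₂ _+_ (QP.*-comm (φ₃ a b d) 2ℚ)
      (eq (φ a) (φ b) (φ d) (H a b d) (H b a d) (H d a b))))
    (*-monoˡ (*-nn (fl-nn V a) (*-nn (fl-nn V b) (fl-nn V d))) (pointwise a b d))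
    where
    eq : ∀ x y z A B D → x * (y * z) * (A + B + D) ≡ x * (y * z) * A + y * (x * z) * B + z * (x * y) * D
    eq = solve-∀ ℚring

  E₃-mono : ∀ {f g} → (∀ a b d → f a b d ≤ g a b d) → E₃ p f ≤ E₃ p g
  E₃-mono h = E-mono P (λ b → E-mono P (λ d → E-mono P (λ a → h a b d)))

  ψ² : ℚ
  ψ² = E p (λ b → E p (λ d → φ b * φ d))

  ψ²-eq : ψ² ≡ ψ * ψ
  ψ²-eq = trans (E-cong p (λ b → trans (E-* p (φ b) φ) (QP.*-comm (φ b) ψ))) (E-* p ψ φ)

  E₂-const : ∀ z → E p (λ b → E p (λ d → (φ b * φ d) * z)) ≡ ψ² * z
  E₂-const z = trans (E-cong p (λ b → trans (E-cong p (λ d → QP.*-comm (φ b * φ d) z)) (E-* p z (λ d → φ b * φ d))))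
    (trans (E-* p z (λ b → E p (λ d → φ b * φ d))) (QP.*-comm z ψ²))

  inner : ∀ (G : World n m → World n m → World n m → ℚ) b d →
    E p (λ a → φ₃ a b d * G a b d) ≡ (φ b * φ d) * E p (λ a → φ a * G a b d)
  inner G b d = trans (E-cong p (λ a → eq (φ a) (φ b * φ d) (G a b d))) (E-* p (φ b * φ d) (λ a → φ a * G a b d))
    where
    eq : ∀ x y z → x * y * z ≡ y * (x * z)
    eq = solve-∀ ℚring

  E₃-φ₃ : E₃ p φ₃ ≡ ψ² * ψ
  E₃-φ₃ = trans (E-cong p (λ b → E-cong p (λ d → trans (E-cong p (λ a → QP.*-comm (φ a) (φ b * φ d))) (E-* p (φ b * φ d) φ)))) (E₂-const ψ)

  E-H : ∀ b d → E p (λ a → φ a * H a b d) ≤ (⁺ 7 / 24) * ψ + q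
  E-H b d = QP.≤-trans (QP.≤-reflexive (trans (E-cong p (λ a → QP.*-distribˡ-+ (φ a) (dev U a) (ng a)))
      (E-+ p (λ a → φ a * dev U a) (λ a → φ a * ng a))))
    (QP.+-mono-≤ (E-dev U) (E-mono P (λ a → QP.≤-trans (*-monoʳ (𝟙-nn (not (good a))) (fl≤1 V a)) (QP.≤-reflexive (QP.*-identityˡ (ng a))))))
    where
    U : Fin n → Bool
    U v = y b v ∨ y d v

  G : World n m → World n m → ℚ
  G b d = E p (λ a → φ a * Ff a b d)

  -- The origin of `α₀`: `2 + 3 · 7/24 = 3 · 23/24`.
  total-bound : ∀ g₀ → (∀ b d → g₀ ≤ G b d) → ψ² * (3ℚ * g₀) ≤ ψ² * (3ℚ * (α₀ * ψ + q))
  total-bound g₀ h = QP.≤-trans (QP.≤-reflexive (eq₁ ψ² g₀)) (QP.≤-trans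
    (*-monoˡ (lit≤ {0ℚ} {3ℚ}) lower) (QP.≤-trans (QP.≤-reflexive (sym (E₃-sym p hF)))
    (QP.≤-trans (E₃-mono weighted) (QP.≤-trans (QP.≤-reflexive upper-eq)
      (QP.≤-trans (QP.+-monoʳ-≤ (2ℚ * (ψ² * ψ)) (*-monoˡ (lit≤ {0ℚ} {3ℚ}) upper)) (QP.≤-reflexive (eq₂ ψ² ψ q)))))))
    where
    eq₁ : ∀ s g → s * (3ℚ * g) ≡ 3ℚ * (s * g)
    eq₁ = solve-∀ ℚring
    eq₂ : ∀ s x q → 2ℚ * (s * x) + 3ℚ * (s * ((⁺ 7 / 24) * x + q)) ≡ s * (3ℚ * (α₀ * x + q))
    eq₂ = solve-∀ ℚring
    lower : ψ² * g₀ ≤ E₃ p hF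
    lower = subst (_≤ E₃ p hF) (E₂-const g₀) (E-mono P (λ b → E-mono P (λ d →
      QP.≤-trans (*-monoˡ (*-nn (fl-nn V b) (fl-nn V d)) (h b d)) (QP.≤-reflexive (sym (inner Ff b d))))))
    upper : E₃ p hH ≤ ψ² * ((⁺ 7 / 24) * ψ + q)
    upper = subst (E₃ p hH ≤_) (E₂-const ((⁺ 7 / 24) * ψ + q)) (E-mono P (λ b → E-mono P (λ d →
      QP.≤-trans (QP.≤-reflexive (inner H b d)) (*-monoˡ (*-nn (fl-nn V b) (fl-nn V d)) (E-H b d)))))
    E₃-2φ₃ : E₃ p (λ a b d → 2ℚ * φ₃ a b d) ≡ 2ℚ * (ψ² * ψ)
    E₃-2φ₃ = trans (E-cong p (λ b → trans (E-cong p (λ d → E-* p 2ℚ (λ a → φ₃ a b d))) (E-* p 2ℚ (λ d → E p (λ a → φ₃ a b d)))))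
      (trans (E-* p 2ℚ (λ b → E p (λ d → E p (λ a → φ₃ a b d)))) (cong (2ℚ *_) E₃-φ₃))
    upper-eq : E₃ p (λ a b d → 2ℚ * φ₃ a b d + (hH a b d + hH b a d + hH d a b)) ≡ 2ℚ * (ψ² * ψ) + 3ℚ * E₃ p hH
    upper-eq = trans (E₃-+ p (λ a b d → 2ℚ * φ₃ a b d) (λ a b d → hH a b d + hH b a d + hH d a b)) (cong₂ _+_ E₃-2φ₃ (E₃-sym p hH))

  V′-⊇ : ∀ b d v → V v ≡ true → V′ b d v ≡ true
  V′-⊇ b d v h rewrite h = refl

  new≤G : ∀ b d → E p (fl (V′ b d)) ≤ G b d
  new≤G b d = E-mono P (λ a → fl-mono a (V′-⊇ b d))

  step-lemma : ∃ λ b → ∃ λ d → E p (fl (V′ b d)) ≤ α₀ * ψ + q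
  step-lemma = b₀ , d₀ , conclude (≤⊎> ψ 0ℚ)
    where
    best : ∀ b → ∃ λ d → ∀ d′ → G b d ≤ G b d′
    best b = argminWorld P (G b)
    outer = argminWorld P (λ b → G b (proj₁ (best b)))
    b₀ = proj₁ outer
    d₀ = proj₁ (best b₀)
    g-min : ∀ b d → G b₀ d₀ ≤ G b d
    g-min b d = QP.≤-trans (proj₂ outer b) (proj₂ (best b) d)
    new≤ψ : E p (fl (V′ b₀ d₀)) ≤ ψ
    new≤ψ = QP.≤-trans (new≤G b₀ d₀) (E-mono P (λ a →
      QP.≤-trans (*-monoˡ (fl-nn V a) (fl≤1 (V′ b₀ d₀) a)) (QP.≤-reflexive (QP.*-identityʳ (φ a)))))
    conclude : ψ ≤ 0ℚ ⊎ 0ℚ < ψ → E p (fl (V′ b₀ d₀)) ≤ α₀ * ψ + q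
    -- Here `ψ²` cannot be cancelled, but enlarging `V` never increases the failure probability.
    conclude (inj₁ ψ≤0) = QP.≤-trans new≤ψ (≤-by ((⁺ 1 / 24) * (0ℚ - ψ) + q) (+-nn (*-nn (lit≤ {0ℚ} {⁺ 1 / 24}) (slack ψ≤0)) q-nn) (eq ψ q))
      where
      eq : ∀ x q → α₀ * x + q ≡ x + ((⁺ 1 / 24) * (0ℚ - x) + q)
      eq = solve-∀ ℚring
    conclude (inj₂ 0<ψ) = QP.≤-trans (new≤G b₀ d₀) (*-cancelˡ (QP.positive⁻¹ 3ℚ)
      (*-cancelˡ (subst (0ℚ <_) (sym ψ²-eq) (*-pos 0<ψ 0<ψ)) (total-bound (G b₀ d₀) g-min)))

-- From a passed test to `k` cheap vertices.

leq-true : ∀ {p q} → leq p q ≡ true → p ≤ q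
leq-true {p} {q} h with ≤⊎> p q
... | inj₁ l = l
leq-true () | inj₂ _

leq-false : ∀ {p q} → leq p q ≡ false → q < p
leq-false {p} {q} h with ≤⊎> p q
... | inj₂ l = l
leq-false () | inj₁ _

∧-true : ∀ {a b} → a ∧ b ≡ true → a ≡ true × b ≡ true
∧-true {true} {true} refl = refl , refl

module _ {A : Set} where

  keep : (A → Bool) → List A → List A
  keep = L.filterᵇ

  keep-true : ∀ f x xs → f x ≡ true → keep f (x ∷ xs) ≡ x ∷ keep f xs
  keep-true f x xs h rewrite h = refl

  keep-false : ∀ f x xs → f x ≡ false → keep f (x ∷ xs) ≡ keep f xs
  keep-false f x xs h rewrite h = refl

  ∈-keep : ∀ f xs {v} → v ∈ keep f xs → v ∈ xs × f v ≡ true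
  ∈-keep f (x ∷ xs) i with f x in eq
  ∈-keep f (x ∷ xs) (here refl) | true  = here refl , eq
  ∈-keep f (x ∷ xs) (there i)   | true  = there (proj₁ (∈-keep f xs i)) , proj₂ (∈-keep f xs i)
  ∈-keep f (x ∷ xs) i           | false = there (proj₁ (∈-keep f xs i)) , proj₂ (∈-keep f xs i)

  keep-unique : ∀ f {xs} → Unique xs → Unique (keep f xs)
  keep-unique f {[]}     []      = []
  keep-unique f {x ∷ xs} (p ∷ u) with f x
  ... | true  = All.tabulate (λ i → All.lookup p (proj₁ (∈-keep f xs i))) ∷ keep-unique f u
  ... | false = keep-unique f u

  keep-split : ∀ f h xs → length (keep f xs) ℕ.≤ length (keep h xs) ℕ.+ length (keep (λ v → f v ∧ not (h v)) xs)
  keep-split f h []       = ℕ.z≤n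
  keep-split f h (x ∷ xs) with f x | h x
  ... | true  | true  = ℕ.s≤s (keep-split f h xs)
  ... | true  | false = subst (suc (length (keep f xs)) ℕ.≤_) (sym (ℕP.+-suc (length (keep h xs)) _)) (ℕ.s≤s (keep-split f h xs))
  ... | false | true  = ℕP.m≤n⇒m≤1+n (keep-split f h xs)
  ... | false | false = keep-split f h xs

  ∈-take : ∀ j (xs : List A) {v} → v ∈ L.take j xs → v ∈ xs
  ∈-take (suc j) (x ∷ xs) (here p)  = here p
  ∈-take (suc j) (x ∷ xs) (there i) = there (∈-take j xs i)

length-take′ : ∀ {A : Set} j (xs : List A) → j ℕ.≤ length xs → length (L.take j xs) ≡ j
length-take′ j xs h = trans (LP.length-take j xs) (ℕP.m≤n⇒m⊓n≡m h)

record Selection {n} (k : ℕ) (V : Fin n → Bool) (c : Fin n → ℚ) (b : ℚ) : Set where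
  constructor selection
  field
    sel-list   : List (Fin n)
    sel-unique : Unique sel-list
    sel-length : length sel-list ≡ k
    sel-in     : ∀ {v} → v ∈ sel-list → V v ≡ true
    sel-cost   : sumL sel-list c ≤ b

open Selection public

module Greedy
  {n : ℕ} {m : Fin n → ℕ} (k : ℕ)
  (c : (v : Fin n) → Fin (m v) → ℚ) (c-nn : ∀ v o → 0ℚ ≤ c v o)
  (V : Fin n → Bool) (w : World n m) (ok : Levels.Ok {m = m} k c c-nn V w)
  where

  open Levels {m = m} k c c-nn

  cv : Fin n → ℚ
  cv v = c v (get w v)

  f : ℕ → Fin n → Bool
  f j v = V v ∧ leq (pow 2ℚ j * cv v) 1ℚ

  g : ℕ → Fin n → Bool
  g j v = f j v ∧ not (f (suc j) v)

  N : ℕ → ℕ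
  N j = length (keep (f j) us₀)

  bound : ℚ
  bound = 2ℚ * C₀

  2ʲ-nn : ∀ j → 0ℚ ≤ pow 2ℚ j
  2ʲ-nn j = pow-nn j (lit≤ {0ℚ} {2ℚ})

  f-cost : ∀ j {v} → f j v ≡ true → pow 2ℚ j * cv v ≤ 1ℚ
  f-cost j {v} h = leq-true (proj₂ (∧-true {V v} h))

  X₀≡N₀ : ∀ us → sumL us (λ v → 𝟙 (V v) * lv 0 v (get w v)) ≡ ℕ→ℚ (length (keep (f 0) us))
  X₀≡N₀ []       = refl
  X₀≡N₀ (v ∷ us) = step (V v) (leq (cv v) 1ℚ) refl refl
    where
    f₀ : f 0 v ≡ V v ∧ leq (cv v) 1ℚ
    f₀ = cong (λ z → V v ∧ leq z 1ℚ) (QP.*-identityˡ (cv v))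
    keep-len : f 0 v ≡ false → ℕ→ℚ (length (keep (f 0) (v ∷ us))) ≡ ℕ→ℚ (length (keep (f 0) us))
    keep-len h = cong (λ l → ℕ→ℚ (length l)) (keep-false (f 0) v us h)
    step : ∀ a b → V v ≡ a → leq (cv v) 1ℚ ≡ b →
      𝟙 (V v) * lv 0 v (get w v) + sumL us (λ v → 𝟙 (V v) * lv 0 v (get w v)) ≡ ℕ→ℚ (length (keep (f 0) (v ∷ us)))
    step true true ha hb = trans (cong₂ _+_ (cong₂ (λ x y → 𝟙 x * 𝟙 y) ha hb) (X₀≡N₀ us))
      (sym (trans (cong (λ l → ℕ→ℚ (length l)) (keep-true (f 0) v us (trans f₀ (cong₂ _∧_ ha hb)))) (ℕ→ℚ-suc (length (keep (f 0) us)))))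
    step true false ha hb = trans (cong₂ _+_ (cong₂ (λ x y → 𝟙 x * 𝟙 y) ha hb) (X₀≡N₀ us))
      (trans (QP.+-identityˡ (ℕ→ℚ (length (keep (f 0) us)))) (sym (keep-len (trans f₀ (cong₂ _∧_ ha hb)))))
    step false b ha hb = trans (cong₂ _+_ (trans (cong (λ x → 𝟙 x * lv 0 v (get w v)) ha) (QP.*-zeroˡ (lv 0 v (get w v)))) (X₀≡N₀ us))
      (trans (QP.+-identityˡ (ℕ→ℚ (length (keep (f 0) us)))) (sym (keep-len (trans f₀ (cong (_∧ leq (cv v) 1ℚ) ha)))))

  -- A vertex dearer than the price `2⁻ʲ` has truncated value 0; on the others truncation does
  -- nothing.
  X≤keep : ∀ j us → sumL us (λ v → 𝟙 (V v) * lv (suc j) v (get w v)) ≤ sumL (keep (f j) us) (λ v → 1ℚ - pow 2ℚ j * cv v)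
  X≤keep j []       = QP.≤-refl
  X≤keep j (v ∷ us) = step (V v) (leq (pow 2ℚ j * cv v) 1ℚ) refl refl
    where
    h : Fin n → ℚ
    h v = 1ℚ - pow 2ℚ j * cv v
    rest = sumL us (λ v → 𝟙 (V v) * lv (suc j) v (get w v))
    skip : f j v ≡ false → 𝟙 (V v) * lv (suc j) v (get w v) ≤ 0ℚ →
      𝟙 (V v) * lv (suc j) v (get w v) + rest ≤ sumL (keep (f j) (v ∷ us)) h
    skip e l = QP.≤-trans (QP.+-mono-≤ l (X≤keep j us)) (QP.≤-reflexive
      (trans (QP.+-identityˡ (sumL (keep (f j) us) h)) (cong (λ l → sumL l h) (sym (keep-false (f j) v us e)))))
    step : ∀ a b → V v ≡ a → leq (pow 2ℚ j * cv v) 1ℚ ≡ b →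
      𝟙 (V v) * lv (suc j) v (get w v) + rest ≤ sumL (keep (f j) (v ∷ us)) h
    step true true ha hb = QP.≤-trans (QP.+-mono-≤
      (QP.≤-trans (QP.≤-reflexive (trans (cong (λ x → 𝟙 x * lv (suc j) v (get w v)) ha) (QP.*-identityˡ (lv (suc j) v (get w v)))))
        (posPart-lub (slack (leq-true hb)) QP.≤-refl))
      (X≤keep j us)) (QP.≤-reflexive (cong (λ l → sumL l h) (sym (keep-true (f j) v us (cong₂ _∧_ ha hb)))))
    step true false ha hb = skip (cong₂ _∧_ ha hb)
      (QP.≤-trans (QP.≤-reflexive (trans (cong (λ x → 𝟙 x * lv (suc j) v (get w v)) ha) (QP.*-identityˡ (lv (suc j) v (get w v)))))
        (posPart-lub QP.≤-refl (slack⁻¹ (subst (0ℚ ≤_) (eq (pow 2ℚ j * cv v)) (slack (QP.<⇒≤ (leq-false hb)))))))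
      where
      eq : ∀ z → z - 1ℚ ≡ 0ℚ - (1ℚ - z)
      eq = solve-∀ ℚring
    step false b ha hb = skip (cong (_∧ leq (pow 2ℚ j * cv v) 1ℚ) ha)
      (QP.≤-reflexive (trans (cong (λ x → 𝟙 x * lv (suc j) v (get w v)) ha) (QP.*-zeroˡ (lv (suc j) v (get w v)))))

  Found : Set
  Found = Selection k V cv bound

  -- The total is at most `k · 2⁻ᵏ ≤ 1`.
  allCheap : k ℕ.≤ N k → Found
  allCheap h = selection S (UP.take⁺ k (keep-unique (f k) us₀-unique)) (length-take′ k _ h)
    (λ i → proj₁ (∧-true (in-f i))) (QP.≤-trans cost≤1 (lit≤ {1ℚ} {bound}))
    where
    S = L.take k (keep (f k) us₀)
    in-f : ∀ {v} → v ∈ S → f k v ≡ true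
    in-f i = proj₂ (∈-keep (f k) us₀ (∈-take k _ i))
    cost≤1 : sumL S cv ≤ 1ℚ
    cost≤1 = *-cancelˡ (0<2^ k) (QP.≤-trans (QP.≤-reflexive (sym (sumL-* S (pow 2ℚ k) cv)))
      (QP.≤-trans (sumL-mono S {g = λ _ → 1ℚ} (λ i → f-cost k (in-f i))) (QP.≤-trans (QP.≤-reflexive (trans (sumL-1 S) (cong ℕ→ℚ (length-take′ k _ h))))
        (QP.≤-trans (ℕ→ℚ≤pow2 k) (QP.≤-reflexive (sym (QP.*-identityʳ (pow 2ℚ k))))))))

  -- With `t = 2ʲ⁺¹`, the `k`-th cheapest vertex costs between `1/t` and `2/t`. The test at price
  -- `1/t` bounds the cost of `L₁` plus `1/t` for each of the `r` missing vertices by `C₀`; a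
  -- missing vertex is bought for at most `2/t`, hence `2 C₀`.
  mixed : ∀ j → j ℕ.< k → N (suc j) ℕ.< k → k ℕ.≤ N j → Found
  mixed j j<k lt ge = selection (L₁ ++ L₂)
    (UP.++⁺ (keep-unique (f (suc j)) us₀-unique) (UP.take⁺ r (keep-unique (g j) us₀-unique)) disjoint)
    (trans (LP.length-++ L₁) (trans (cong (N (suc j) ℕ.+_) len₂) (ℕP.m+[n∸m]≡n (ℕP.<⇒≤ lt))))
    (λ {v} i → in-V (MP.∈-++⁻ L₁ i)) cost≤
    where
    t = pow 2ℚ (suc j)
    r = k ℕ.∸ N (suc j)
    L₁ = keep (f (suc j)) us₀
    L₂ = L.take r (keep (g j) us₀)
    len₂ : length L₂ ≡ r
    len₂ = length-take′ r _ (ℕP.m≤n+o⇒m∸n≤o k (N (suc j)) (ℕP.≤-trans ge (keep-split (f j) (f (suc j)) us₀)))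
    in₂ : ∀ {v} → v ∈ L₂ → f j v ≡ true × not (f (suc j) v) ≡ true
    in₂ i = ∧-true (proj₂ (∈-keep (g j) us₀ (∈-take r _ i)))
    disjoint : ∀ {v} → ¬ (v ∈ L₁ × v ∈ L₂)
    disjoint {v} (i , i′) with f (suc j) v | proj₂ (∈-keep (f (suc j)) us₀ i) | proj₂ (in₂ i′)
    ... | true | refl | ()
    in-V : ∀ {v} → v ∈ L₁ ⊎ v ∈ L₂ → V v ≡ true
    in-V (inj₁ i) = proj₁ (∧-true (proj₂ (∈-keep (f (suc j)) us₀ i)))
    in-V (inj₂ i) = proj₁ (∧-true (proj₁ (in₂ i)))
    -- Level `j + 2` stands for the price `1/t`; by `j < k` it is one of the `k + 2` levels tested.
    cheap : ℕ→ℚ k ≤ X (suc (suc j)) V w + C₀ * t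
    cheap = subst (λ l → K ≤ X l V w + sl l) (FP.toℕ-fromℕ< (ℕ.s≤s (ℕ.s≤s j<k))) (ok (F.fromℕ< (ℕ.s≤s (ℕ.s≤s j<k))))
    R = ℕ→ℚ r
    Σ₁ = sumL L₁ cv
    K≡ : ℕ→ℚ k ≡ ℕ→ℚ (length L₁) + R
    K≡ = trans (cong ℕ→ℚ (sym (ℕP.m+[n∸m]≡n (ℕP.<⇒≤ lt)))) (ℕ→ℚ-+ (N (suc j)) r)
    lower : sumL L₁ (λ v → 1ℚ - t * cv v) ≡ ℕ→ℚ (length L₁) - t * Σ₁
    lower = trans (sumL-+ L₁ (λ _ → 1ℚ) (λ v → - (t * cv v))) (cong₂ _+_ (sumL-1 L₁)
      (trans (sumL-cong L₁ (λ {v} _ → QP.neg-distribˡ-* t (cv v))) (trans (sumL-* L₁ (- t) cv) (sym (QP.neg-distribˡ-* t Σ₁)))))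
    deficit : t * Σ₁ + R ≤ C₀ * t
    deficit = slack⁻¹ (subst (0ℚ ≤_) (eq (ℕ→ℚ (length L₁)) R (t * Σ₁) (C₀ * t))
      (slack (subst (_≤ ℕ→ℚ (length L₁) - t * Σ₁ + C₀ * t) K≡ (QP.≤-trans cheap
        (QP.+-monoˡ-≤ (C₀ * t) (QP.≤-trans (X≤keep (suc j) us₀) (QP.≤-reflexive lower)))))))
      where
      eq : ∀ l r s d → l - s + d - (l + r) ≡ d - (s + r)
      eq = solve-∀ ℚring
    dear : t * sumL L₂ cv ≤ 2ℚ * R
    dear = subst₂ _≤_ (sumL-* L₂ t cv) (trans (sumL-* L₂ 2ℚ (λ _ → 1ℚ)) (cong (2ℚ *_) (trans (sumL-1 L₂) (cong ℕ→ℚ len₂))))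
      (sumL-mono L₂ (λ {v} i → QP.≤-trans (QP.≤-reflexive (QP.*-assoc 2ℚ (pow 2ℚ j) (cv v)))
        (*-monoˡ (lit≤ {0ℚ} {2ℚ}) (f-cost j (proj₁ (in₂ i))))))
    Σ₁-nn : 0ℚ ≤ Σ₁
    Σ₁-nn = sumL-nn L₁ (λ v → c-nn v (get w v))
    cost≤ : sumL (L₁ ++ L₂) cv ≤ bound
    cost≤ = *-cancelˡ (0<2^ (suc j)) (QP.≤-trans (QP.≤-reflexive (trans (cong (t *_) (sumL-++ L₁ L₂ cv)) (QP.*-distribˡ-+ t Σ₁ (sumL L₂ cv))))
      (QP.≤-trans (QP.+-monoʳ-≤ (t * Σ₁) dear) (QP.≤-trans (≤-by (t * Σ₁) (*-nn (2ʲ-nn (suc j)) Σ₁-nn) (eq₁ (t * Σ₁) R))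
        (QP.≤-trans (*-monoˡ (lit≤ {0ℚ} {2ℚ}) deficit) (QP.≤-reflexive (eq₂ C₀ t))))))
      where
      eq₁ : ∀ s r → 2ℚ * (s + r) ≡ s + 2ℚ * r + s
      eq₁ = solve-∀ ℚring
      eq₂ : ∀ c t → 2ℚ * (c * t) ≡ t * (2ℚ * c)
      eq₂ = solve-∀ ℚring

  -- The price is halved until fewer than `k` vertices are affordable; `i` counts the halvings that
  -- remain.
  search : ∀ i j → i ℕ.+ j ≡ k → k ℕ.≤ N j → Found
  search zero    j refl ge = allCheap ge
  search (suc i) j eq   ge = branch (k ℕP.≤? N (suc j))
    where
    branch : Dec (k ℕ.≤ N (suc j)) → Found
    branch (yes ge′) = search i (suc j) (trans (ℕP.+-suc i j) eq) ge′
    branch (no  lt)  = mixed j (subst (j ℕ.<_) eq (ℕ.s≤s (ℕP.m≤n+m j i))) (ℕP.≰⇒> lt) ge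

  ℕ→ℚ-cancel : ∀ {a b} → ℕ→ℚ a ≤ ℕ→ℚ b → a ℕ.≤ b
  ℕ→ℚ-cancel {a} {b} h = branch (a ℕP.≤? b)
    where
    branch : Dec (a ℕ.≤ b) → a ℕ.≤ b
    branch (yes l) = l
    branch (no  l) = contradiction (QP.≤-trans (ℕ→ℚ-< (ℕP.≰⇒> l)) h)
      (<⇒¬≤ (subst (_< 1ℚ + ℕ→ℚ b) (QP.+-identityˡ (ℕ→ℚ b)) (QP.+-monoˡ-< (ℕ→ℚ b) (QP.positive⁻¹ 1ℚ))))

  found : Found
  found = search k 0 (ℕP.+-identityʳ k) (ℕ→ℚ-cancel (QP.≤-trans (ok zero)
    (QP.≤-reflexive (trans (QP.+-identityʳ (X 0 V w)) (X₀≡N₀ us₀)))))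

-- The optimal exploration tree.

argmin : ∀ {A : Set} → (A → ℚ) → A → List A → A
argmin f x []       = x
argmin f x (y ∷ ys) with ≤⊎> (f x) (f y)
... | inj₁ _ = argmin f x ys
... | inj₂ _ = argmin f y ys

argmin-∈ : ∀ {A : Set} (f : A → ℚ) x ys → argmin f x ys ∈ (x ∷ ys)
argmin-∈ f x []       = here refl
argmin-∈ f x (y ∷ ys) with ≤⊎> (f x) (f y)
... | inj₂ _ = there (argmin-∈ f y ys)
... | inj₁ _ with argmin-∈ f x ys
...   | here e  = here e
...   | there i = there (there i)

argmin-≤-head : ∀ {A : Set} (f : A → ℚ) x ys → f (argmin f x ys) ≤ f x
argmin-≤-head f x []       = QP.≤-refl
argmin-≤-head f x (y ∷ ys) with ≤⊎> (f x) (f y)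
... | inj₁ _ = argmin-≤-head f x ys
... | inj₂ l = QP.≤-trans (argmin-≤-head f y ys) (QP.<⇒≤ l)

argmin-≤ : ∀ {A : Set} (f : A → ℚ) x ys {y} → y ∈ (x ∷ ys) → f (argmin f x ys) ≤ f y
argmin-≤ f x ys       (here refl) = argmin-≤-head f x ys
argmin-≤ f x (y ∷ ys) (there i) with ≤⊎> (f x) (f y)
argmin-≤ f x (y ∷ ys) (there (here refl)) | inj₁ l = QP.≤-trans (argmin-≤-head f x ys) l
argmin-≤ f x (y ∷ ys) (there (there i))   | inj₁ _ = argmin-≤ f x ys (there i)
argmin-≤ f x (y ∷ ys) (there i)           | inj₂ _ = argmin-≤ f y ys i

members : ∀ {A : Set} (xs : List A) → List (∃ λ v → v ∈ xs)
members []       = []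
members (x ∷ xs) = (x , here refl) ∷ map (λ (v , i) → v , there i) (members xs)

∈-members : ∀ {A : Set} {xs : List A} {v} (i : v ∈ xs) → (v , i) ∈ members xs
∈-members (here refl) = here refl
∈-members (there i)   = there (MP.∈-map⁺ _ (∈-members i))

listsOf : ∀ n → ℕ → List (List (Fin n))
listsOf n zero    = [] ∷ []
listsOf n (suc j) = concatMap (λ v → map (v ∷_) (listsOf n j)) (allFin n)

∈-listsOf : ∀ {n} (S : List (Fin n)) → S ∈ listsOf n (length S)
∈-listsOf []      = here refl
∈-listsOf (v ∷ S) = MP.∈-concat⁺′ (MP.∈-map⁺ (v ∷_) (∈-listsOf S)) (MP.∈-map⁺ _ (MP.∈-allFin v))

leavesFrom : ∀ {n k} (us : List (Fin n)) → List (List (Fin n)) → List (Leaf k us)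
leavesFrom us [] = []
leavesFrom {n} {k} us (S ∷ Ss) with DecUnique.unique? FP._≟_ S | length S ℕP.≟ k | All.all? (λ v → ¬? (DecMem._∈?_ FP._≟_ v us)) S
... | yes u | yes e | yes o = leaf S u e o ∷ leavesFrom us Ss
... | _     | _     | _     = leavesFrom us Ss

∈-leavesFrom : ∀ {n k} (us : List (Fin n)) Ss {S} → S ∈ Ss → Unique S → length S ≡ k → All (_∉ us) S →
  ∃ λ l → l ∈ leavesFrom {n} {k} us Ss × picks l ≡ S
∈-leavesFrom {n} {k} us (S′ ∷ Ss) i u e o with DecUnique.unique? FP._≟_ S′ | length S′ ℕP.≟ k | All.all? (λ v → ¬? (DecMem._∈?_ FP._≟_ v us)) S′
∈-leavesFrom us (S′ ∷ Ss) (here refl) u e o | yes u′ | yes e′ | yes o′ = leaf S′ u′ e′ o′ , here refl , refl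
∈-leavesFrom us (S′ ∷ Ss) (here refl) u e o | no ¬u | _     | _     = contradiction u ¬u
∈-leavesFrom us (S′ ∷ Ss) (here refl) u e o | yes _ | no ¬e | _     = contradiction e ¬e
∈-leavesFrom us (S′ ∷ Ss) (here refl) u e o | yes _ | yes _ | no ¬o = contradiction o ¬o
∈-leavesFrom us (S′ ∷ Ss) (there i) u e o | yes u′ | yes e′ | yes o′ with ∈-leavesFrom us Ss i u e o
... | l , j , eq = l , there j , eq
∈-leavesFrom us (S′ ∷ Ss) (there i) u e o | no _  | _     | _    = ∈-leavesFrom us Ss i u e o
∈-leavesFrom us (S′ ∷ Ss) (there i) u e o | yes _ | no _  | _    = ∈-leavesFrom us Ss i u e o
∈-leavesFrom us (S′ ∷ Ss) (there i) u e o | yes _ | yes _ | no _ = ∈-leavesFrom us Ss i u e o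

-- `w₀` stores the outcomes already revealed, `w` supplies fresh ones for the vertices in `us`.
mix : ∀ {n m} → List (Fin n) → World n m → World n m → World n m
mix us w w₀ = foldr (λ v acc → set acc v (get w v)) w₀ us

get-mix-∈ : ∀ {n m} (us : List (Fin n)) (w w₀ : World n m) {v} → v ∈ us → get (mix us w w₀) v ≡ get w v
get-mix-∈ (u ∷ us) w w₀ {v} i with v FP.≟ u
... | yes refl = get-set (mix us w w₀) u (get w u)
get-mix-∈ (u ∷ us) w w₀ (here e)  | no h = contradiction e h
get-mix-∈ (u ∷ us) w w₀ (there i) | no h = trans (get-set-≢ (mix us w w₀) (get w u) h) (get-mix-∈ us w w₀ i)

get-mix-∉ : ∀ {n m} (us : List (Fin n)) (w w₀ : World n m) {v} → v ∉ us → get (mix us w w₀) v ≡ get w₀ v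
get-mix-∉ []       w w₀ h = refl
get-mix-∉ (u ∷ us) w w₀ h = trans (get-set-≢ (mix us w w₀) (get w u) (λ e → h (here e))) (get-mix-∉ us w w₀ (h ∘ there))

mix-─ : ∀ {n m} {us : List (Fin n)} {v} (i : v ∈ us) → Unique us → ∀ (w w₀ : World n m) o →
  mix us (set w v o) w₀ ≡ mix (us ─ i) w (set w₀ v o)
mix-─ {us = us} {v} i u w w₀ o = world-ext _ _ go
  where
  go : ∀ x → get (mix us (set w v o) w₀) x ≡ get (mix (us ─ i) w (set w₀ v o)) x
  go x with x FP.≟ v
  ... | yes refl = trans (trans (get-mix-∈ us (set w v o) w₀ i) (get-set w v o))
                     (sym (trans (get-mix-∉ (us ─ i) w (set w₀ v o) (∉-─ i u)) (get-set w₀ v o)))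
  ... | no x≢v with DecMem._∈?_ FP._≟_ x us
  ...   | yes j = trans (trans (get-mix-∈ us (set w v o) w₀ j) (get-set-≢ w o x≢v))
                    (sym (get-mix-∈ (us ─ i) w (set w₀ v o) (∈-─⁺ i j x≢v)))
  ...   | no  j = trans (get-mix-∉ us (set w v o) w₀ j)
                    (sym (trans (get-mix-∉ (us ─ i) w (set w₀ v o) (j ∘ ∈-─⁻ i)) (get-set-≢ w₀ o x≢v)))

module Canonical (I : Instance) (VI : ValidInstance I) where

  open ValidInstance VI

  W : Set
  W = World (n I) (m I)

  P : IsProb (prob I)
  P = record { p-nn = λ v o → QP.<⇒≤ (prob-pos v o) ; p-sum = prob-sum }

  Tr : List (Fin (n I)) → Set
  Tr = Tree (m I) (k I)

  vl : W → Fin (n I) → ℚ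
  vl w v = val I v (get w v)

  tour : Fin (n I) → List (Fin (n I)) → ℚ
  tour u []       = d I u (root I)
  tour u (v ∷ xs) = d I u v + tour v xs

  total : ∀ {us} → Tr us → Fin (n I) → W → ℚ
  total T u w = tour u (path T w) + sumL (chosen T w) (vl w)

  -- The world argument accumulates the revealed outcomes, so that a leaf can price picks visited
  -- long before.
  treecost : ∀ {us} → Tr us → Fin (n I) → W → ℚ
  treecost (fin l)             u w = d I u (root I) + sumL (picks l) (vl w)
  treecost (visit {v = v} i f) u w = d I u v + sumFin (m I v) (λ o → prob I v o * treecost (f o) v (set w v o))

  treecost≡E : ∀ {us} (T : Tr us) → Unique us → ∀ u w₀ →
    treecost T u w₀ ≡ E (prob I) (λ w → total T u (mix us w w₀))
  treecost≡E {us} (fin l) un u w₀ = sym (trans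
    (E-cong (prob I) (λ w → cong (d I u (root I) +_) (sumL-cong (picks l)
      (λ {v} i → cong (val I v) (get-mix-∉ us w w₀ (All.lookup (out l) i))))))
    (E-const P (d I u (root I) + sumL (picks l) (vl w₀))))
  treecost≡E {us} (visit {v = v} i f) un u w₀ = sym (trans
    (E-cong (prob I) (λ w → trans (QP.+-assoc (d I u v) (tour v (path (f (get (mix us w w₀) v)) (mix us w w₀))) (sumL (chosen (f (get (mix us w w₀) v)) (mix us w w₀)) (vl (mix us w w₀))))
      (cong (λ o → d I u v + total (f o) v (mix us w w₀)) (get-mix-∈ us w w₀ i))))
    (trans (E-+ (prob I) (λ _ → d I u v) (λ w → total (f (get w v)) v (mix us w w₀)))
      (cong₂ _+_ (E-const P (d I u v)) (trans (E-set P v (λ w → total (f (get w v)) v (mix us w w₀)))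
        (sumFin-cong (m I v) (λ o → cong (prob I v o *_) (trans
          (E-cong (prob I) (λ w → cong₂ (λ o′ M → total (f o′) v M) (get-set w v o) (mix-─ i un w w₀ o)))
          (sym (treecost≡E (f o) (Unique-─ i un) v (set w₀ v o))))))))))

  triangle : ∀ {us} (T : Tr us) u v w → treecost T u w ≤ d I u v + treecost T v w
  triangle (fin l) u v w = QP.≤-trans (QP.+-monoˡ-≤ (sumL (picks l) (vl w)) (d-tri u v (root I)))
    (QP.≤-reflexive (QP.+-assoc (d I u v) (d I v (root I)) (sumL (picks l) (vl w))))
  triangle (visit {v = x} i f) u v w = QP.≤-trans (QP.+-monoˡ-≤ s (d-tri u v x))
    (QP.≤-reflexive (QP.+-assoc (d I u v) (d I v x) s))
    where s = sumFin (m I x) (λ o → prob I x o * treecost (f o) x (set w x o))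

  leaves : ∀ us → List (Leaf (k I) us)
  leaves us = leavesFrom us (listsOf (n I) (k I))

  defaultLeaf : Leaf (k I) []
  defaultLeaf = leaf (L.take (k I) (allFin (n I))) (UP.take⁺ (k I) (UP.allFin⁺ (n I)))
    (length-take′ (k I) (allFin (n I)) (subst (k I ℕ.≤_) (sym (LP.length-tabulate (λ i → i))) k≤n))
    (All.tabulate (λ _ ()))

  pred-─ : ∀ {us : List (Fin (n I))} {v j} (i : v ∈ us) → length us ≡ suc j → length (us ─ i) ≡ j
  pred-─ i eq = ℕP.suc-injective (trans (sym (length-─ i)) eq)

  -- `argmin` wants a first candidate: some visit, or an arbitrary leaf once everything is visited.
  -- The recursion runs on the number `j` of unvisited vertices.
  heads : ∀ j us → length us ≡ j → W → Tr us
  tails : ∀ j us → length us ≡ j → W → List (Tr us)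
  best  : ∀ j us → length us ≡ j → Fin (n I) → W → Tr us
  visitBest    : ∀ {v} j us → length us ≡ suc j → W → v ∈ us → Tr us

  visitBest {v} j us eq w i = visit i (λ o → best j (us ─ i) (pred-─ i eq) v (set w v o))
  heads zero    []       eq w = fin defaultLeaf
  heads (suc j) (x ∷ us) eq w = visitBest j (x ∷ us) eq w (here refl)
  tails zero    us eq w = map fin (leaves us)
  tails (suc j) us eq w = map fin (leaves us) ++ map (λ (v , i) → visitBest j us eq w i) (members us)
  best j us eq u w = argmin (λ T → treecost T u w) (heads j us eq w) (tails j us eq w)

  opt : ∀ j us → length us ≡ j → Fin (n I) → W → ℚ
  opt j us eq u w = treecost (best j us eq u w) u w

  opt-leaf : ∀ j us eq u w S → Unique S → length S ≡ k I → All (_∉ us) S →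
    opt j us eq u w ≤ d I u (root I) + sumL S (vl w)
  opt-leaf j us eq u w S un e o with ∈-leavesFrom us (listsOf (n I) (k I)) (subst (λ z → S ∈ listsOf (n I) z) e (∈-listsOf S)) un e o
  ... | l , i , refl = argmin-≤ (λ T → treecost T u w) (heads j us eq w) (tails j us eq w) {fin l} (there (in-tails j us eq i))
    where
    in-tails : ∀ j us eq {l : Leaf (k I) us} → l ∈ leaves us → fin l ∈ tails j us eq w
    in-tails zero    us eq i = MP.∈-map⁺ fin i
    in-tails (suc j) us eq i = MP.∈-++⁺ˡ (MP.∈-map⁺ fin i)

  opt-visit : ∀ j us eq u w {v} (i : v ∈ us) →
    opt (suc j) us eq u w ≤ d I u v + sumFin (m I v) (λ o → prob I v o * opt j (us ─ i) (pred-─ i eq) v (set w v o))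
  opt-visit j us eq u w {v} i = argmin-≤ (λ T → treecost T u w) (heads (suc j) us eq w) (tails (suc j) us eq w)
    (there (MP.∈-++⁺ʳ (map fin (leaves us)) (MP.∈-map⁺ (λ (v , i) → visitBest j us eq w i) (∈-members i))))

  opt-triangle : ∀ j us eq u v w → opt j us eq u w ≤ d I u v + opt j us eq v w
  opt-triangle j us eq u v w = QP.≤-trans
    (argmin-≤ (λ T → treecost T u w) (heads j us eq w) (tails j us eq w)
      (argmin-∈ (λ T → treecost T v w) (heads j us eq w) (tails j us eq w)))
    (triangle (best j us eq v w) u v w)

  lookup-here : ∀ r v o → lookupRev I ((v , o) ∷ r) v ≡ just o
  lookup-here r v o with v F.≟ v
  ... | yes refl = refl
  ... | no  h    = contradiction refl h

  lookup-there : ∀ r {u v} o → u ≢ v → lookupRev I ((u , o) ∷ r) v ≡ lookupRev I r v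
  lookup-there r {u} {v} o u≢v with u F.≟ v
  ... | yes e = contradiction e u≢v
  ... | no  _ = refl

  record Consistent (s : State I) (us : List (Fin (n I))) (w : W) : Set where
    field
      unseen  : ∀ {v} → v ∈ us → lookupRev I (rev s) v ≡ nothing
      unseen′ : ∀ {v} → lookupRev I (rev s) v ≡ nothing → v ∈ us
      seen    : ∀ {v o} → lookupRev I (rev s) v ≡ just o → get w v ≡ o
      us-uniq : Unique us
      s-uniq  : Unique (sel s)
      s-out   : All (_∉ us) (sel s)

  open Consistent

  -- A tree pays for its picks only at the leaf, a policy at once; hence the selected costs on the
  -- right. Picking at the leaf, away from the vertex, relaxes the problem, and returns to visited
  -- vertices are shortcut by the triangle inequality.
  optimal : ∀ t s j us eq w → Consistent s us w → Feasible I t s →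
    opt j us eq (pos s) w ≤ cost I t s + sumL (sel s) (vl w)
  optimal stop s j us eq w C fe = opt-leaf j us eq (pos s) w (sel s) (s-uniq C) fe (s-out C)
  optimal (select t) s j us eq w C fe with lookupRev I (rev s) (pos s) in e
  ... | just o = QP.≤-trans
      (optimal t (st (pos s) (rev s) (pos s ∷ sel s)) j us eq w
        (record { unseen = unseen C ; unseen′ = unseen′ C ; seen = seen C ; us-uniq = us-uniq C
                ; s-uniq = All.tabulate (λ { i refl → proj₁ fe i }) ∷ s-uniq C
                ; s-out = (λ i → nothing≢just (trans (sym (unseen C i)) e)) ∷ s-out C }) (proj₂ fe))
      (QP.≤-reflexive (trans (cong (λ z → c′ + (val I (pos s) z + sumL (sel s) (vl w))) (seen C e)) (eq′ c′ (val I (pos s) o) (sumL (sel s) (vl w)))))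
    where
    c′ = cost I t (st (pos s) (rev s) (pos s ∷ sel s))
    nothing≢just : ∀ {A : Set} {x : A} → nothing ≡ just x → ⊥
    nothing≢just ()
    eq′ : ∀ a b c → a + (b + c) ≡ b + a + c
    eq′ = solve-∀ ℚring
  optimal (move v f) s j us eq w C fe with lookupRev I (rev s) v in e
  ... | just o = QP.≤-trans (opt-triangle j us eq (pos s) v w) (QP.≤-trans
      (QP.+-monoʳ-≤ (d I (pos s) v) (optimal (f o) (st v (rev s) (sel s)) j us eq w
        (record { unseen = unseen C ; unseen′ = unseen′ C ; seen = seen C ; us-uniq = us-uniq C ; s-uniq = s-uniq C ; s-out = s-out C }) fe))
      (QP.≤-reflexive (sym (QP.+-assoc (d I (pos s) v) (cost I (f o) (st v (rev s) (sel s))) (sumL (sel s) (vl w))))))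
  ... | nothing = unrevealed j eq
    where
    i : v ∈ us
    i = unseen′ C e
    s′ : Fin (m I v) → State I
    s′ o = st v ((v , o) ∷ rev s) (sel s)
    unrevealed : ∀ j eq → opt j us eq (pos s) w ≤
      d I (pos s) v + sumFin (m I v) (λ o → prob I v o * cost I (f o) (s′ o)) + sumL (sel s) (vl w)
    unrevealed zero eq = contradiction (trans (sym eq) (length-─ i)) (λ ())
    unrevealed (suc j) eq = QP.≤-trans (opt-visit j us eq (pos s) w i) (QP.≤-trans
      (QP.+-monoʳ-≤ (d I (pos s) v) (sumFin-mono (m I v) (λ o → *-monoˡ (p-nn P v o) (sub o))))
      (QP.≤-reflexive (trans (cong (d I (pos s) v +_) (trans
        (sumFin-cong (m I v) (λ o → QP.*-distribˡ-+ (prob I v o) (cost I (f o) (s′ o)) Σs))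
        (trans (sumFin-+ (m I v) (λ o → prob I v o * cost I (f o) (s′ o)) (λ o → prob I v o * Σs))
          (cong (sumFin (m I v) (λ o → prob I v o * cost I (f o) (s′ o)) +_)
            (trans (sumFin-*ʳ (m I v) Σs (prob I v)) (trans (cong (_* Σs) (prob-sum v)) (QP.*-identityˡ Σs)))))))
        (sym (QP.+-assoc (d I (pos s) v) (sumFin (m I v) (λ o → prob I v o * cost I (f o) (s′ o))) Σs)))))
      where
      Σs = sumL (sel s) (vl w)
      new-unseen : ∀ o x → Dec (v ≡ x) → lookupRev I ((v , o) ∷ rev s) x ≡ nothing → x ∈ (us ─ i)
      new-unseen o x (yes refl) h = contradiction (trans (sym h) (lookup-here (rev s) v o)) (λ ())
      new-unseen o x (no v≢x)   h = ∈-─⁺ i (unseen′ C (trans (sym (lookup-there (rev s) o v≢x)) h)) (v≢x ∘ sym)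
      just-inj : ∀ {A : Set} {x y : A} → just x ≡ just y → x ≡ y
      just-inj refl = refl
      new-seen : ∀ o x {o′} → Dec (v ≡ x) → lookupRev I ((v , o) ∷ rev s) x ≡ just o′ → get (set w v o) x ≡ o′
      new-seen o x (yes refl) h = trans (get-set w v o) (just-inj (trans (sym (lookup-here (rev s) v o)) h))
      new-seen o x (no v≢x)   h = trans (get-set-≢ w o (v≢x ∘ sym)) (seen C (trans (sym (lookup-there (rev s) o v≢x)) h))
      consistent : ∀ o → Consistent (s′ o) (us ─ i) (set w v o)
      unseen  (consistent o) {x} h = trans (lookup-there (rev s) o (λ { refl → ∉-─ i (us-uniq C) h })) (unseen C (∈-─⁻ i h))
      unseen′ (consistent o) {x} h = new-unseen o x (v FP.≟ x) h
      seen    (consistent o) {x} h = new-seen o x (v FP.≟ x) h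
      us-uniq (consistent o) = Unique-─ i (us-uniq C)
      s-uniq  (consistent o) = s-uniq C
      s-out   (consistent o) = All.map (λ h j → h (∈-─⁻ i j)) (s-out C)
      sub : ∀ o → opt j (us ─ i) (pred-─ i eq) v (set w v o) ≤ cost I (f o) (s′ o) + Σs
      sub o = QP.≤-trans (optimal (f o) (s′ o) j (us ─ i) (pred-─ i eq) (set w v o) (consistent o) (fe o))
        (QP.+-monoʳ-≤ (cost I (f o) (s′ o)) (QP.≤-reflexive (sumL-cong (sel s) (λ {x} h →
          cong (val I x) (get-set-≢ w o (λ { refl → All.lookup (s-out C) h i }))))))

  w₀ : W
  w₀ = someWorld P

  T* : Tr (allFin (n I))
  T* = best (length (allFin (n I))) (allFin (n I)) refl (root I) w₀

  A* : ℚ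
  A* = E (prob I) (total T* (root I))

  A*≤ : ∀ t → Feasible I t (start I) → A* ≤ cost I t (start I)
  A*≤ t fe = QP.≤-trans (QP.≤-reflexive (sym (trans (treecost≡E T* (UP.allFin⁺ (n I)) (root I) w₀)
      (E-cong (prob I) (λ w → cong (total T* (root I)) (world-ext (mix (allFin (n I)) w w₀) w (λ v → get-mix-∈ (allFin (n I)) w w₀ (MP.∈-allFin v))))))))
    (QP.≤-trans (optimal t (start I) _ (allFin (n I)) refl w₀
      (record { unseen = λ _ → refl ; unseen′ = λ {v} _ → MP.∈-allFin v ; seen = λ () ; us-uniq = UP.allFin⁺ (n I) ; s-uniq = [] ; s-out = [] }) fe)
      (QP.≤-reflexive (QP.+-identityʳ (cost I t (start I)))))

-- Non-adaptive policies in phases.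

module Policies (I : Instance) (VI : ValidInstance I) where

  open ValidInstance VI
  open Canonical I VI

  V₁ : Set
  V₁ = Fin (n I)

  _∈?_ : (v : V₁) (S : List V₁) → Dec (v ∈ S)
  _∈?_ = DecMem._∈?_ FP._≟_

  walkLen : V₁ → List V₁ → ℚ
  walkLen u []       = 0ℚ
  walkLen u (v ∷ xs) = d I u v + walkLen v xs

  lastPos : V₁ → List V₁ → V₁
  lastPos u []       = u
  lastPos u (v ∷ xs) = lastPos v xs

  closed : List V₁ → List V₁
  closed xs = xs ++ (root I ∷ [])

  walkLen-closed : ∀ u xs R → walkLen u (closed xs ++ R) ≡ tour u xs + walkLen (root I) R
  walkLen-closed u []       R = refl
  walkLen-closed u (v ∷ xs) R = trans (cong (d I u v +_) (walkLen-closed v xs R)) (sym (QP.+-assoc (d I u v) (tour v xs) (walkLen (root I) R)))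

  lastPos-closed : ∀ u xs R → lastPos u (closed xs ++ R) ≡ lastPos (root I) R
  lastPos-closed u []       R = refl
  lastPos-closed u (v ∷ xs) R = lastPos-closed v xs R

  tour-nn : ∀ u xs → 0ℚ ≤ tour u xs
  tour-nn u []       = d-nonneg u (root I)
  tour-nn u (v ∷ xs) = +-nn (d-nonneg u v) (tour-nn v xs)

  walkLen-nn : ∀ u xs → 0ℚ ≤ walkLen u xs
  walkLen-nn u []       = QP.≤-refl
  walkLen-nn u (v ∷ xs) = +-nn (d-nonneg u v) (walkLen-nn v xs)

  runcost : Policy I → W → V₁ → ℚ
  runcost stop       M x = d I x (root I)
  runcost (select t) M x = val I x (get M x) + runcost t M x
  runcost (move v f) M x = d I x v + runcost (f (get M v)) M v

  -- Revealed outcomes override the sampled world. One expectation over complete worlds then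
  -- describes the rest of a run from any state.
  ov : Revealed I → W → W
  ov []            w = w
  ov ((v , o) ∷ r) w = set (ov r w) v o

  get-ov : ∀ r w {v o} → lookupRev I r v ≡ just o → get (ov r w) v ≡ o
  get-ov ((u , a) ∷ r) w {v} {o} h = go (u FP.≟ v) h
    where
    just-inj : ∀ {A : Set} {x y : A} → just x ≡ just y → x ≡ y
    just-inj refl = refl
    go : Dec (u ≡ v) → lookupRev I ((u , a) ∷ r) v ≡ just o → get (set (ov r w) u a) v ≡ o
    go (yes refl) h = trans (get-set (ov r w) u a) (just-inj (trans (sym (lookup-here r u a)) h))
    go (no u≢v)   h = trans (get-set-≢ (ov r w) a (u≢v ∘ sym)) (get-ov r w (trans (sym (lookup-there r a u≢v)) h))

  ov-set : ∀ r w {v} o → lookupRev I r v ≡ nothing → ov r (set w v o) ≡ set (ov r w) v o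
  ov-set []            w o h = refl
  ov-set ((u , a) ∷ r) w {v} o h = go (u FP.≟ v)
    where
    go : Dec (u ≡ v) → set (ov r (set w v o)) u a ≡ set (set (ov r w) u a) v o
    go (yes refl) = contradiction (trans (sym h) (lookup-here r u a)) (λ ())
    go (no u≢v)   = trans (cong (λ M → set M u a) (ov-set r w o (trans (sym (lookup-there r a u≢v)) h)))
      (set-comm (ov r w) o a (u≢v ∘ sym))

  cost≡E : ∀ t s → Feasible I t s → cost I t s ≡ E (prob I) (λ w → runcost t (ov (rev s) w) (pos s))
  cost≡E stop s fe = sym (E-const P (d I (pos s) (root I)))
  cost≡E (select t) s fe with lookupRev I (rev s) (pos s) in e
  ... | just o = sym (trans (E-+ (prob I) (λ w → val I (pos s) (get (ov (rev s) w) (pos s))) (λ w → runcost t (ov (rev s) w) (pos s)))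
      (cong₂ _+_ (trans (E-cong (prob I) (λ w → cong (val I (pos s)) (get-ov (rev s) w e))) (E-const P (val I (pos s) o)))
        (sym (cost≡E t (st (pos s) (rev s) (pos s ∷ sel s)) (proj₂ fe)))))
  cost≡E (move v f) s fe with lookupRev I (rev s) v in e
  ... | just o = sym (trans (E-+ (prob I) (λ _ → d I (pos s) v) (λ w → runcost (f (get (ov (rev s) w) v)) (ov (rev s) w) v))
      (cong₂ _+_ (E-const P (d I (pos s) v)) (trans (E-cong (prob I) (λ w → cong (λ o → runcost (f o) (ov (rev s) w) v) (get-ov (rev s) w e)))
        (sym (cost≡E (f o) (st v (rev s) (sel s)) fe)))))
  ... | nothing = sym (trans (E-+ (prob I) (λ _ → d I (pos s) v) (λ w → runcost (f (get (ov (rev s) w) v)) (ov (rev s) w) v))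
      (cong₂ _+_ (E-const P (d I (pos s) v)) (trans (E-set P v (λ w → runcost (f (get (ov (rev s) w) v)) (ov (rev s) w) v))
        (sumFin-cong (m I v) (λ o → cong (prob I v o *_) (trans
          (E-cong (prob I) (λ w → trans (cong (λ M → runcost (f (get M v)) M v) (ov-set (rev s) w o e))
            (cong (λ o′ → runcost (f o′) (set (ov (rev s) w) v o) v) (get-set (ov (rev s) w) v o))))
          (sym (cost≡E (f o) (st v ((v , o) ∷ rev s) (sel s)) (fe o)))))))))

  -- The continuation receives the costs seen so far in the form of a world, whose unseen
  -- coordinates keep their initial values.
  walk : List V₁ → (W → Policy I) → W → Policy I
  walk []      κ u = κ u
  walk (v ∷ L) κ u = move v (λ o → walk L κ (set u v o))

  -- Each vertex of `S` is selected when `L` first reaches it; removing it from `S` prevents a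
  -- second selection.
  selWalk : List V₁ → List V₁ → Policy I
  selStep : ∀ {v S} → List V₁ → Dec (v ∈ S) → Policy I
  selWalk []      S = stop
  selWalk (v ∷ L) S = move v (λ o → selStep L (v ∈? S))
  selStep {S = S} L (yes i) = select (selWalk L (S ─ i))
  selStep {S = S} L (no _)  = selWalk L S

  record Picks (R S : List V₁) : Set where
    constructor picks-in
    field
      p-uniq : Unique S
      p-size : length S ≡ k I
      p-in   : ∀ {v} → v ∈ S → v ∈ R

  open Picks

  drop-head : ∀ {v : V₁} {L S} → (∀ {x} → x ∈ S → x ∈ (v ∷ L)) → v ∉ S → ∀ {x} → x ∈ S → x ∈ L
  drop-head h v∉ i with h i
  ... | here refl = contradiction i v∉
  ... | there j   = j

  feas-walk : ∀ L κ u s → (∀ u s′ → sel s′ ≡ sel s → Feasible I (κ u) s′) → Feasible I (walk L κ u) s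
  feas-walk []      κ u s h = h u s refl
  feas-walk (v ∷ L) κ u s h with lookupRev I (rev s) v
  ... | just o  = feas-walk L κ (set u v o) (st v (rev s) (sel s)) h
  ... | nothing = λ o → feas-walk L κ (set u v o) (st v ((v , o) ∷ rev s) (sel s)) h

  feas-select : ∀ t s {o} → lookupRev I (rev s) (pos s) ≡ just o → pos s ∉ sel s →
    Feasible I t (st (pos s) (rev s) (pos s ∷ sel s)) → Feasible I (select t) s
  feas-select t s h p∉ fe with lookupRev I (rev s) (pos s)
  feas-select t s refl p∉ fe | just o = p∉ , fe

  feas-selWalk : ∀ L S s → Unique S → (∀ {v} → v ∈ S → v ∈ L) → (∀ {v} → v ∈ S → v ∉ sel s) →
    length (sel s) ℕ.+ length S ≡ k I → Feasible I (selWalk L S) s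
  feas-selStep : ∀ {v} L S (dec : Dec (v ∈ S)) s → pos s ≡ v → ∀ {o} → lookupRev I (rev s) v ≡ just o →
    Unique S → (∀ {x} → x ∈ S → x ∈ (v ∷ L)) → (∀ {x} → x ∈ S → x ∉ sel s) →
    length (sel s) ℕ.+ length S ≡ k I → Feasible I (selStep L dec) s
  feas-selWalk [] []      s un sub dis e = trans (sym (ℕP.+-identityʳ (length (sel s)))) e
  feas-selWalk [] (x ∷ S) s un sub dis e = contradiction (sub (here refl)) (λ ())
  feas-selWalk (v ∷ L) S s un sub dis e with lookupRev I (rev s) v in q
  ... | just o  = feas-selStep L S (v ∈? S) (st v (rev s) (sel s)) refl q un sub dis e
  ... | nothing = λ o → feas-selStep L S (v ∈? S) (st v ((v , o) ∷ rev s) (sel s)) refl (lookup-here (rev s) v o) un sub dis e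
  feas-selStep {v} L S (yes i) s refl q un sub dis e = feas-select (selWalk L (S ─ i)) s q (dis i)
    (feas-selWalk L (S ─ i) (st (pos s) (rev s) (pos s ∷ sel s)) (Unique-─ i un)
      (drop-head (λ j → sub (∈-─⁻ i j)) (∉-─ i un))
      (λ { j (here refl) → ∉-─ i un j ; j (there l) → dis (∈-─⁻ i j) l })
      (trans (sym (ℕP.+-suc (length (sel s)) (length (S ─ i)))) (trans (cong (length (sel s) ℕ.+_) (sym (length-─ i))) e)))
  feas-selStep {v} L S (no v∉) s refl q un sub dis e = feas-selWalk L S s un (drop-head sub v∉) dis e

  follows-walk : ∀ L κ u L′ → (∀ u → FollowsOrder I L′ (κ u)) → FollowsOrder I (L ++ L′) (walk L κ u)
  follows-walk []      κ u L′ h = h u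
  follows-walk (v ∷ L) κ u L′ h = refl , λ o → follows-walk L κ (set u v o) L′ h

  follows-selWalk : ∀ L S L′ → FollowsOrder I (L ++ L′) (selWalk L S)
  follows-selStep : ∀ {v} L S (dec : Dec (v ∈ S)) L′ → FollowsOrder I (L ++ L′) (selStep L dec)
  follows-selWalk []      S L′ = tt
  follows-selWalk (v ∷ L) S L′ = refl , λ o → follows-selStep L S (v ∈? S) L′
  follows-selStep L S (yes i) L′ = follows-selWalk L (S ─ i) L′
  follows-selStep L S (no _)  L′ = follows-selWalk L S L′

  learn : W → List V₁ → W → W
  learn u []      M = u
  learn u (v ∷ L) M = learn (set u v (get M v)) L M

  learn-keep : ∀ u L M {v} → get u v ≡ get M v → get (learn u L M) v ≡ get M v
  learn-keep u []      M h = h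
  learn-keep u (x ∷ L) M {v} h = learn-keep (set u x (get M x)) L M (go (v FP.≟ x))
    where
    go : Dec (v ≡ x) → get (set u x (get M x)) v ≡ get M v
    go (yes refl) = get-set u x (get M x)
    go (no v≢x)   = trans (get-set-≢ u (get M x) v≢x) h

  learn-∈ : ∀ u L M {v} → v ∈ L → get (learn u L M) v ≡ get M v
  learn-∈ u (x ∷ L) M (here refl) = learn-keep (set u x (get M x)) L M (get-set u x (get M x))
  learn-∈ u (x ∷ L) M (there i)   = learn-∈ (set u x (get M x)) L M i

  run-walk : ∀ L κ u M x → runcost (walk L κ u) M x ≡ walkLen x L + runcost (κ (learn u L M)) M (lastPos x L)
  run-walk []      κ u M x = sym (QP.+-identityˡ (runcost (κ u) M x))
  run-walk (v ∷ L) κ u M x = trans (cong (d I x v +_) (run-walk L κ (set u v (get M v)) M v))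
    (sym (QP.+-assoc (d I x v) (walkLen v L) (runcost (κ (learn u (v ∷ L) M)) M (lastPos v L))))

  run-selWalk : ∀ L S M x → Unique S → (∀ {v} → v ∈ S → v ∈ L) →
    runcost (selWalk L S) M x ≡ walkLen x L + d I (lastPos x L) (root I) + sumL S (vl M)
  run-selStep : ∀ {v} L S (dec : Dec (v ∈ S)) M → Unique S → (∀ {x} → x ∈ S → x ∈ (v ∷ L)) →
    runcost (selStep L dec) M v ≡ walkLen v L + d I (lastPos v L) (root I) + sumL S (vl M)
  run-selWalk [] []      M x un sub = sym (trans (QP.+-identityʳ (0ℚ + d I x (root I))) (QP.+-identityˡ (d I x (root I))))
  run-selWalk [] (v ∷ S) M x un sub = contradiction (sub (here refl)) (λ ())
  run-selWalk (v ∷ L) S M x un sub = trans (cong (d I x v +_) (run-selStep L S (v ∈? S) M un sub))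
    (eq (d I x v) (walkLen v L) (d I (lastPos v L) (root I)) (sumL S (vl M)))
    where
    eq : ∀ a b c d → a + (b + c + d) ≡ a + b + c + d
    eq = solve-∀ ℚring
  run-selStep {v} L S (yes i) M un sub = trans
    (cong (vl M v +_) (run-selWalk L (S ─ i) M v (Unique-─ i un) (drop-head (λ j → sub (∈-─⁻ i j)) (∉-─ i un))))
    (trans (eq (vl M v) (walkLen v L + d I (lastPos v L) (root I)) (sumL (S ─ i) (vl M)))
      (cong (walkLen v L + d I (lastPos v L) (root I) +_) (sym (sumL-─ i (vl M)))))
    where
    eq : ∀ a b c → a + (b + c) ≡ b + (a + c)
    eq = solve-∀ ℚring
  run-selStep {v} L S (no v∉) M un sub = run-selWalk L S M v un (drop-head sub v∉)

  Agree : List V₁ → W → W → Set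
  Agree R u M = ∀ {v} → v ∈ R → get u v ≡ get M v

  -- A phase walks the closed walk R twice: first to reveal costs, then to pick up the set chosen by
  -- `decide` (or, if there is none, to stay in line with the fixed order).
  record Phase : Set where
    field
      R       : List V₁
      loop    : lastPos (root I) R ≡ root I
      decide  : W → Maybe (List V₁)
      valid   : ∀ u {S} → decide u ≡ just S → Picks R S
      budget  : ℚ
      fail    : W → ℚ
      fail-nn : ∀ M → 0ℚ ≤ fail M
      on-just : ∀ u M {S} → Agree R u M → decide u ≡ just S → sumL S (vl M) ≤ budget
      on-fail : ∀ u M → Agree R u M → decide u ≡ nothing → 1ℚ ≤ fail M
      budget-nn : 0ℚ ≤ budget

  -- A last resort that always succeeds. It makes the policy finite and feasible in every world.
  record Final : Set where
    field
      R      : List V₁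
      loop   : lastPos (root I) R ≡ root I
      decide : W → List V₁
      valid  : ∀ u → Picks R (decide u)
      spend  : W → ℚ
      on-all : ∀ u M → Agree R u M → sumL (decide u) (vl M) ≤ spend M
      spend-nn : ∀ M → 0ℚ ≤ spend M

  pol    : List Phase → Final → W → Policy I
  branch : Phase → List Phase → Final → Maybe (List V₁) → W → Policy I
  pol []        F u = walk (Final.R F) (λ u → selWalk (Final.R F) (Final.decide F u)) u
  pol (ph ∷ ps) F u = walk (Phase.R ph) (λ u → branch ph ps F (Phase.decide ph u) u) u
  branch ph ps F (just S) u = selWalk (Phase.R ph) S
  branch ph ps F nothing  u = walk (Phase.R ph) (pol ps F) u

  order : List Phase → Final → List V₁
  order []        F = Final.R F ++ (Final.R F ++ [])
  order (ph ∷ ps) F = Phase.R ph ++ (Phase.R ph ++ order ps F)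

  pol-follows : ∀ ps F u → FollowsOrder I (order ps F) (pol ps F u)
  pol-follows []        F u = follows-walk (Final.R F) _ u _ (λ u → follows-selWalk (Final.R F) (Final.decide F u) [])
  pol-follows (ph ∷ ps) F u = follows-walk (Phase.R ph) _ u _ (λ u → branch-follows (Phase.decide ph u) u)
    where
    branch-follows : ∀ r u → FollowsOrder I (Phase.R ph ++ order ps F) (branch ph ps F r u)
    -- The policy stops after this round, so only a prefix of the fixed order is walked.
    branch-follows (just S) u = follows-selWalk (Phase.R ph) S (order ps F)
    branch-follows nothing  u = follows-walk (Phase.R ph) (pol ps F) u (order ps F) (pol-follows ps F)

  feas-picks : ∀ {R S} s → sel s ≡ [] → Picks R S → Feasible I (selWalk R S) s
  feas-picks {R} {S} s e pk = feas-selWalk R S s (p-uniq pk) (p-in pk)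
    (λ {v} _ → subst (v ∉_) (sym e) (λ ())) (trans (cong (λ l → length l ℕ.+ length S) e) (p-size pk))

  pol-feasible : ∀ ps F u s → sel s ≡ [] → Feasible I (pol ps F u) s
  pol-feasible []        F u s e = feas-walk (Final.R F) _ u s (λ u s′ e′ → feas-picks s′ (trans e′ e) (Final.valid F u))
  pol-feasible (ph ∷ ps) F u s e = feas-walk (Phase.R ph) _ u s
    (λ u s′ e′ → branch-feasible u s′ (trans e′ e) (Phase.decide ph u) refl)
    where
    branch-feasible : ∀ u s′ → sel s′ ≡ [] → ∀ r → Phase.decide ph u ≡ r → Feasible I (branch ph ps F r u) s′
    branch-feasible u s′ e (just S) q = feas-picks s′ e (Phase.valid ph u q)
    branch-feasible u s′ e nothing  q = feas-walk (Phase.R ph) (pol ps F) u s′ (λ u s″ e′ → pol-feasible ps F u s″ (trans e′ e))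

  twice : List V₁ → ℚ
  twice R = walkLen (root I) R + walkLen (root I) R

  -- A pathwise cost bound: the walks and the budget of a phase are always charged, all later phases
  -- only through `fail`.
  G : List Phase → Final → W → ℚ
  G []        F M = twice (Final.R F) + Final.spend F M
  G (ph ∷ ps) F M = twice (Phase.R ph) + Phase.budget ph + Phase.fail ph M * G ps F M

  twice-nn : ∀ R → 0ℚ ≤ twice R
  twice-nn R = +-nn (walkLen-nn (root I) R) (walkLen-nn (root I) R)

  G-nn : ∀ ps F M → 0ℚ ≤ G ps F M
  G-nn []        F M = +-nn (twice-nn (Final.R F)) (Final.spend-nn F M)
  G-nn (ph ∷ ps) F M = +-nn (+-nn (twice-nn (Phase.R ph)) (Phase.budget-nn ph)) (*-nn (Phase.fail-nn ph M) (G-nn ps F M))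

  select-bound : ∀ {R S} M b → lastPos (root I) R ≡ root I → Picks R S → sumL S (vl M) ≤ b →
    walkLen (root I) R + runcost (selWalk R S) M (root I) ≤ twice R + b
  select-bound {R} {S} M b lp pk h = QP.≤-trans (QP.≤-reflexive (trans
      (cong (ℓ +_) (trans (run-selWalk R S M (root I) (p-uniq pk) (p-in pk))
        (cong (λ z → ℓ + z + sumL S (vl M)) (trans (cong (λ x → d I x (root I)) lp) (d-refl (root I))))))
      (eq ℓ (sumL S (vl M)))))
    (QP.+-monoʳ-≤ (ℓ + ℓ) h)
    where
    ℓ = walkLen (root I) R
    eq : ∀ l s → l + (l + 0ℚ + s) ≡ l + l + s
    eq = solve-∀ ℚring

  pol-cost : ∀ ps F u M → runcost (pol ps F u) M (root I) ≤ G ps F M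
  pol-cost [] F u M = QP.≤-trans
    (QP.≤-reflexive (trans (run-walk R κ u M (root I))
      (cong (λ x → walkLen (root I) R + runcost (κ (learn u R M)) M x) (Final.loop F))))
    (select-bound M (Final.spend F M) (Final.loop F) (Final.valid F (learn u R M)) (Final.on-all F (learn u R M) M (learn-∈ u R M)))
    where
    R = Final.R F
    κ : W → Policy I
    κ u = selWalk R (Final.decide F u)
  pol-cost (ph ∷ ps) F u M = QP.≤-trans
    (QP.≤-reflexive (trans (run-walk R κ u M (root I))
      (cong (λ x → walkLen (root I) R + runcost (κ (learn u R M)) M x) (Phase.loop ph))))
    (go (Phase.decide ph (learn u R M)) refl)
    where
    R = Phase.R ph
    u′ = learn u R M
    κ : W → Policy I
    κ u = branch ph ps F (Phase.decide ph u) u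
    go : ∀ r → Phase.decide ph u′ ≡ r → walkLen (root I) R + runcost (branch ph ps F r u′) M (root I) ≤ G (ph ∷ ps) F M
    go (just S) q = QP.≤-trans
      (select-bound M (Phase.budget ph) (Phase.loop ph) (Phase.valid ph u′ q) (Phase.on-just ph u′ M (learn-∈ u R M) q))
      (≤-by (Phase.fail ph M * G ps F M) (*-nn (Phase.fail-nn ph M) (G-nn ps F M)) refl)
    go nothing q = QP.≤-trans (QP.≤-reflexive (trans (cong (ℓ +_) (trans (run-walk R (pol ps F) u′ M (root I))
          (cong (λ x → ℓ + runcost (pol ps F (learn u′ R M)) M x) (Phase.loop ph))))
        (sym (QP.+-assoc ℓ ℓ rest))))
      (QP.+-mono-≤ (≤-by {ℓ + ℓ} {ℓ + ℓ + Phase.budget ph} (Phase.budget ph) (Phase.budget-nn ph) refl)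
        (QP.≤-trans (pol-cost ps F (learn u′ R M) M) (QP.≤-trans (QP.≤-reflexive (sym (QP.*-identityˡ (G ps F M))))
          (*-monoʳ (G-nn ps F M) (Phase.on-fail ph u′ M (learn-∈ u R M) q)))))
      where
      ℓ = walkLen (root I) R
      rest = runcost (pol ps F (learn u′ R M)) M (root I)

  pol-expected : ∀ ps F → cost I (pol ps F w₀) (start I) ≤ E (prob I) (G ps F)
  pol-expected ps F = QP.≤-trans (QP.≤-reflexive (cost≡E (pol ps F w₀) (start I) (pol-feasible ps F w₀ (start I) refl)))
    (E-mono P (λ w → pol-cost ps F w₀ w))

-- α₀ β = 47/48, so the failure probabilities decay faster than the budgets grow.
β 92ℚ 94ℚ 46ℚ 47ℚ : ℚ
β   = ⁺ 47 / 46
92ℚ = ⁺ 92 / 1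
94ℚ = ⁺ 94 / 1
46ℚ = ⁺ 46 / 1
47ℚ = ⁺ 47 / 1

-- Geometrically growing budgets.

inv-anti : ∀ {B B′} → 0ℚ < B → B ≤ B′ → inv B′ ≤ inv B
inv-anti {B} {B′} 0<B h = QP.≤-trans
  (QP.≤-reflexive (trans (sym (QP.*-identityʳ u′)) (trans (cong (u′ *_) (sym (*-inv 0<B))) (eq u′ B u))))
  (QP.≤-trans (*-monoʳ u-nn (*-monoʳ u′-nn h)) (QP.≤-reflexive (trans (cong (_* u) (*-inv 0<B′)) (QP.*-identityˡ u))))
  where
  u = inv B
  u′ = inv B′
  0<B′ : 0ℚ < B′
  0<B′ = QP.<-≤-trans 0<B h
  u-nn : 0ℚ ≤ u
  u-nn = QP.<⇒≤ (inv-pos 0<B)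
  u′-nn : 0ℚ ≤ u′
  u′-nn = QP.<⇒≤ (inv-pos 0<B′)
  eq : ∀ u′ B u → u′ * (B * u) ≡ B * u′ * u
  eq = solve-∀ ℚring

leq-anti : ∀ {x x′ z} → x′ ≤ x → 𝟙 (leq x z) ≤ 𝟙 (leq x′ z)
leq-anti {x} {x′} {z} h with ≤⊎> x z | ≤⊎> x′ z
... | inj₁ _ | inj₁ _ = QP.≤-refl
... | inj₁ l | inj₂ r = contradiction (QP.≤-trans h l) (<⇒¬≤ r)
... | inj₂ _ | inj₁ _ = lit≤ {0ℚ} {1ℚ}
... | inj₂ _ | inj₂ _ = QP.≤-refl

Ok-cheaper : ∀ {n} {m : Fin n → ℕ} k (c c′ : (v : Fin n) → Fin (m v) → ℚ) c-nn c′-nn → (∀ v o → c′ v o ≤ c v o) →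
  ∀ {V w} → Levels.Ok {m = m} k c c-nn V w → Levels.Ok {m = m} k c′ c′-nn V w
Ok-cheaper {n} {m} k c c′ c-nn c′-nn h {V} {w} ok l = QP.≤-trans (ok l)
  (QP.+-monoˡ-≤ (Levels.sl {m = m} k c c-nn (F.toℕ l)) (sumL-mono (allFin n) (λ {v} _ → *-monoˡ (𝟙-nn (V v)) (lv-anti′ (F.toℕ l) v (get w v)))))
  where
  lv-anti′ : ∀ l v o → Levels.lv {m = m} k c c-nn l v o ≤ Levels.lv {m = m} k c′ c′-nn l v o
  lv-anti′ zero    v o = leq-anti (h v o)
  lv-anti′ (suc j) v o = posPart-lub (posPart-nn (1ℚ - pow 2ℚ j * c′ v o))
    (QP.≤-trans (≤-by (pow 2ℚ j * (c v o - c′ v o)) (*-nn (pow-nn j (lit≤ {0ℚ} {2ℚ})) (slack (h v o))) (eq (pow 2ℚ j) (c v o) (c′ v o)))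
      (≤posPart (1ℚ - pow 2ℚ j * c′ v o)))
    where
    eq : ∀ t x x′ → 1ℚ - t * x′ ≡ 1ℚ - t * x + t * (x - x′)
    eq = solve-∀ ℚring

-- The sum of those budgets that the optimum exceeds. Its mean collects the error terms `q` of all
-- phases, weighted by their budgets.
overrun : ℕ → ℚ → ℚ → ℚ
overrun zero    B τ = 0ℚ
overrun (suc r) B τ = B * 𝟙 (not (leq τ B)) + overrun r (β * B) τ

B≤βB : ∀ {B} → 0ℚ ≤ B → B ≤ β * B
B≤βB {B} 0≤B = ≤-by ((⁺ 1 / 46) * B) (*-nn (lit≤ {0ℚ} {⁺ 1 / 46}) 0≤B) (eq B)
  where
  eq : ∀ B → β * B ≡ B + (⁺ 1 / 46) * B
  eq = solve-∀ ℚring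

overrun-0 : ∀ r {B τ} → 0ℚ ≤ B → τ ≤ B → overrun r B τ ≤ 0ℚ
overrun-0 zero    0≤B h = QP.≤-refl
overrun-0 (suc r) {B} {τ} 0≤B h with ≤⊎> τ B
... | inj₁ _ = QP.≤-trans (QP.+-mono-≤ (QP.≤-reflexive (QP.*-zeroʳ B)) (overrun-0 r (QP.≤-trans 0≤B (B≤βB 0≤B)) (QP.≤-trans h (B≤βB 0≤B)))) QP.≤-refl
... | inj₂ l = contradiction h (<⇒¬≤ l)

-- A geometric sum of ratio `β` with terms below `τ` is at most `τ / (1 - 1/β) = 47 τ`. The term
-- `- 46 B` lets the induction close, because `46 β = 47`.
overrun-> : ∀ r {B τ} → 0ℚ ≤ B → B < τ → overrun r B τ ≤ 47ℚ * τ - 46ℚ * B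
overrun-> zero {B} {τ} 0≤B h = ≤-by (46ℚ * (τ - B) + τ) (+-nn (*-nn (lit≤ {0ℚ} {46ℚ}) (slack (QP.<⇒≤ h))) (QP.≤-trans 0≤B (QP.<⇒≤ h))) (eq τ B)
  where
  eq : ∀ τ B → 47ℚ * τ - 46ℚ * B ≡ 0ℚ + (46ℚ * (τ - B) + τ)
  eq = solve-∀ ℚring
overrun-> (suc r) {B} {τ} 0≤B h with ≤⊎> τ B
... | inj₁ l = contradiction l (<⇒¬≤ h)
... | inj₂ _ = go (≤⊎> τ (β * B))
  where
  0≤βB : 0ℚ ≤ β * B
  0≤βB = QP.≤-trans 0≤B (B≤βB 0≤B)
  go : τ ≤ β * B ⊎ β * B < τ → B * 1ℚ + overrun r (β * B) τ ≤ 47ℚ * τ - 46ℚ * B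
  go (inj₁ l) = QP.≤-trans (QP.+-monoʳ-≤ (B * 1ℚ) (overrun-0 r 0≤βB l))
    (≤-by (47ℚ * (τ - B)) (*-nn (lit≤ {0ℚ} {47ℚ}) (slack (QP.<⇒≤ h))) (eq τ B))
    where
    eq : ∀ τ B → 47ℚ * τ - 46ℚ * B ≡ B * 1ℚ + 0ℚ + 47ℚ * (τ - B)
    eq = solve-∀ ℚring
  go (inj₂ l) = QP.≤-trans (QP.+-monoʳ-≤ (B * 1ℚ) (overrun-> r 0≤βB l)) (QP.≤-reflexive (eq τ B))
    where
    eq : ∀ τ B → B * 1ℚ + (47ℚ * τ - 46ℚ * (β * B)) ≡ 47ℚ * τ - 46ℚ * B
    eq = solve-∀ ℚring

overrun-≤ : ∀ r {B τ} → 0ℚ ≤ B → 0ℚ ≤ τ → overrun r B τ ≤ 47ℚ * τ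
overrun-≤ r {B} {τ} 0≤B 0≤τ with ≤⊎> τ B
... | inj₁ l = QP.≤-trans (overrun-0 r 0≤B l) (*-nn (lit≤ {0ℚ} {47ℚ}) 0≤τ)
... | inj₂ l = QP.≤-trans (overrun-> r 0≤B l) (≤-by (46ℚ * B) (*-nn (lit≤ {0ℚ} {46ℚ}) 0≤B) (eq (47ℚ * τ) (46ℚ * B)))
  where
  eq : ∀ x z → x ≡ x - z + z
  eq = solve-∀ ℚring

bernoulli : ∀ r → 1ℚ + (⁺ 1 / 46) * ℕ→ℚ r ≤ pow β r
bernoulli zero    = lit≤ {1ℚ + (⁺ 1 / 46) * 0ℚ} {1ℚ}
bernoulli (suc r) = QP.≤-trans (≤-by ((⁺ 1 / 46) * ((⁺ 1 / 46) * ℕ→ℚ r)) (*-nn (lit≤ {0ℚ} {⁺ 1 / 46}) (*-nn (lit≤ {0ℚ} {⁺ 1 / 46}) (ℕ→ℚ-nn r)))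
    (trans (eq (ℕ→ℚ r)) (cong (λ z → 1ℚ + (⁺ 1 / 46) * z + (⁺ 1 / 46) * ((⁺ 1 / 46) * ℕ→ℚ r)) (sym (ℕ→ℚ-suc r)))))
  (*-monoˡ (lit≤ {0ℚ} {β}) (bernoulli r))
  where
  eq : ∀ x → β * (1ℚ + (⁺ 1 / 46) * x) ≡ 1ℚ + (⁺ 1 / 46) * (1ℚ + x) + (⁺ 1 / 46) * ((⁺ 1 / 46) * x)
  eq = solve-∀ ℚring

archimedes : ∀ x → ∃ λ N → x ≤ ℕ→ℚ N
archimedes x@(Q.mkℚ (⁺ a) e _) = a , QP.toℚᵘ-cancel-≤ (QᵘP.≤-respʳ-≃ (QᵘP.≃-sym (QP.toℚᵘ-fromℚᵘ (Qᵘ.mkℚᵘ (⁺ a) 0)))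
  (Qᵘ.*≤* (subst₂ ℤ._≤_ (ℤP.pos-* a 1) (ℤP.pos-* a (suc e))
    (ℤ.+≤+ (ℕP.*-monoʳ-≤ a (ℕ.s≤s ℕ.z≤n))))))
archimedes x@(Q.mkℚ (ℤ.-[1+_] a) e _) = 0 , Q.*≤* ℤ.-≤+

-- Supplies the number of phases after which the budget has outgrown the length of the last resort.
growth : ∀ x {y} → 0ℚ < y → ∃ λ r → x ≤ pow β r * y
growth x {y} 0<y = N , QP.≤-trans (QP.≤-reflexive (trans (sym (QP.*-identityʳ x)) (trans (cong (x *_) (sym (*-inv 0<y))) (eq x y (inv y)))))
  (*-monoʳ (QP.<⇒≤ 0<y) (QP.≤-trans (≤-by {x * inv y} {1ℚ + x * inv y} 1ℚ (lit≤ {0ℚ} {1ℚ}) (QP.+-comm 1ℚ (x * inv y)))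
    (QP.≤-trans (QP.+-monoʳ-≤ 1ℚ small) (bernoulli N))))
  where
  big = archimedes (46ℚ * (x * inv y))
  N = proj₁ big
  small : x * inv y ≤ (⁺ 1 / 46) * ℕ→ℚ N
  small = QP.≤-trans (QP.≤-reflexive (eq′ (x * inv y))) (*-monoˡ (lit≤ {0ℚ} {⁺ 1 / 46}) (proj₂ big))
    where
    eq′ : ∀ z → z ≡ (⁺ 1 / 46) * (46ℚ * z)
    eq′ = solve-∀ ℚring
  eq : ∀ x y u → x * (y * u) ≡ x * u * y
  eq = solve-∀ ℚring

term≤sumFin : ∀ l {f : Fin l → ℚ} → (∀ i → 0ℚ ≤ f i) → ∀ i → f i ≤ sumFin l f
term≤sumFin (suc l) {f} h zero = ≤-by (sumFin l (f ∘ suc))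
  (subst (_≤ sumFin l (f ∘ suc)) (sumFin-0 l) (sumFin-mono l (h ∘ suc))) refl
term≤sumFin (suc l) {f} h (suc i) = QP.≤-trans (term≤sumFin l (h ∘ suc) i)
  (≤-by (f zero) (h zero) (QP.+-comm (f zero) (sumFin l (f ∘ suc))))

-- Every world has positive probability, so a nonnegative cost of mean zero vanishes in every world.
E-atom : ∀ {n m} {p : Weights n m} → IsProb p → (∀ v o → 0ℚ < p v o) → ∀ w →
  ∃ λ ε → 0ℚ < ε × (∀ f → (∀ w → 0ℚ ≤ f w) → ε * f w ≤ E p f)
E-atom {zero}  P pos [] = 1ℚ , QP.positive⁻¹ 1ℚ , λ f h → QP.≤-reflexive (QP.*-identityˡ (f []))
E-atom {suc n} {m} {p} P pos (o ∷ w) with E-atom (tailP P) (λ v → pos (suc v)) w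
... | ε , 0<ε , h = p zero o * ε , *-pos (pos zero o) 0<ε , λ f f-nn → QP.≤-trans
    (QP.≤-trans (QP.≤-reflexive (QP.*-assoc (p zero o) ε (f (o ∷ w)))) (*-monoˡ (p-nn P zero o) (h (λ w → f (o ∷ w)) (λ w → f-nn (o ∷ w)))))
    (term≤sumFin (m zero) {λ o → p zero o * E (λ v → p (suc v)) (λ w → f (o ∷ w))}
      (λ o → *-nn (p-nn P zero o) (E-nn (tailP P) (λ w → f-nn (o ∷ w)))) o)

-- Assembling the phases and bounding the expected cost.

module Approximation (I : Instance) (VI : ValidInstance I) where

  open ValidInstance VI
  open Canonical I VI
  open Policies I VI

  τ : W → ℚ
  τ = total T* (root I)

  vl-nn : ∀ w v → 0ℚ ≤ vl w v
  vl-nn w v = val-nonneg v (get w v)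

  tour≤τ : ∀ w → tour (root I) (path T* w) ≤ τ w
  tour≤τ w = ≤-by (sumL (chosen T* w) (vl w)) (sumL-nn (chosen T* w) (vl-nn w)) refl

  chosen≤τ : ∀ w → sumL (chosen T* w) (vl w) ≤ τ w
  chosen≤τ w = ≤-by (tour (root I) (path T* w)) (tour-nn (root I) (path T* w))
    (QP.+-comm (tour (root I) (path T* w)) (sumL (chosen T* w) (vl w)))

  τ-nn : ∀ w → 0ℚ ≤ τ w
  τ-nn w = +-nn (tour-nn (root I) (path T* w)) (sumL-nn (chosen T* w) (vl-nn w))

  qB : ℚ → ℚ
  qB B = E (prob I) (λ w → 𝟙 (not (leq (τ w) B)))

  module AtBudget (B : ℚ) (0<B : 0ℚ < B) where

    c : (v : Fin (n I)) → Fin (m I v) → ℚ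
    c v o = val I v o * inv B

    c-nn : ∀ v o → 0ℚ ≤ c v o
    c-nn v o = *-nn (val-nonneg v o) (QP.<⇒≤ (inv-pos 0<B))

    module Lv = Levels {m = m I} (k I) c c-nn

    good : W → Bool
    good w = leq (τ w) B

    good-sum : ∀ w → good w ≡ true → sumL (chosen T* w) (λ v → c v (get w v)) ≤ 1ℚ
    good-sum w g = QP.≤-trans (QP.≤-reflexive (trans (sumL-cong (chosen T* w) (λ {v} _ → QP.*-comm (vl w v) (inv B)))
        (trans (sumL-* (chosen T* w) (inv B) (vl w)) (QP.*-comm (inv B) (sumL (chosen T* w) (vl w))))))
      (QP.≤-trans (*-monoʳ (QP.<⇒≤ (inv-pos 0<B)) (QP.≤-trans (chosen≤τ w) (leq-true g))) (QP.≤-reflexive (*-inv 0<B)))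

    module St (V : Fin (n I) → Bool) = Step P c c-nn V T* good good-sum

    tour-good : ∀ V w → tour (root I) (St.P′ V w) ≤ B
    tour-good V w = go (good w) refl
      where
      go : ∀ g → good w ≡ g → tour (root I) (if g then path T* w else []) ≤ B
      go true  e = QP.≤-trans (tour≤τ w) (leq-true e)
      go false e = QP.≤-trans (QP.≤-reflexive (d-refl (root I))) (QP.<⇒≤ 0<B)

    budget-B : ℚ
    budget-B = B * (2ℚ * C₀)

    module Decide (V : Fin (n I) → Bool) where

      from : ∀ u → Dec (Lv.Ok V u) → Maybe (List (Fin (n I)))
      from u (yes ok) = just (sel-list (Greedy.found (k I) c c-nn V u ok))
      from u (no _)   = nothing

      from-sel : ∀ u dec {S} → from u dec ≡ just S →
        Unique S × length S ≡ k I × (∀ {v} → v ∈ S → V v ≡ true) × sumL S (λ v → c v (get u v)) ≤ 2ℚ * C₀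
      from-sel u (yes ok) refl = sel-unique s , sel-length s , sel-in s , sel-cost s
        where s = Greedy.found (k I) c c-nn V u ok

      from-nothing : ∀ u dec → from u dec ≡ nothing → ¬ Lv.Ok V u
      from-nothing u (no ¬ok) _ = ¬ok

    mkPhase : (V : Fin (n I) → Bool) (R : List (Fin (n I))) → (∀ v → V v ≡ true → v ∈ R) →
      lastPos (root I) R ≡ root I → Phase
    mkPhase V R V⊆R lp = record
      { R = R ; loop = lp
      ; decide = λ u → from u (Lv.ok? V u)
      ; valid = λ u e → let s = from-sel u (Lv.ok? V u) e in picks-in (proj₁ s) (proj₁ (proj₂ s)) (λ {v} i → V⊆R v (proj₁ (proj₂ (proj₂ s)) i))
      ; budget = budget-B
      ; fail = Lv.fl V
      ; fail-nn = Lv.fl-nn V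
      ; on-just = λ u M agree e → let s = from-sel u (Lv.ok? V u) e in spend u M agree (proj₁ (proj₂ (proj₂ s))) (proj₂ (proj₂ (proj₂ s)))
      ; on-fail = λ u M agree e → QP.≤-reflexive (sym (trans (sym (Lv.fl-cong {V} {u} {M} (λ v Vv → agree (V⊆R v Vv)))) (Lv.fl-¬ok (from-nothing u (Lv.ok? V u) e))))
      ; budget-nn = *-nn (QP.<⇒≤ 0<B) (lit≤ {0ℚ} {2ℚ * C₀})
      }
      where
      open Decide V
      spend : ∀ u M {S} → Agree R u M → (∀ {v} → v ∈ S → V v ≡ true) → sumL S (λ v → c v (get u v)) ≤ 2ℚ * C₀ → sumL S (vl M) ≤ budget-B
      spend u M {S} agree in-V h = QP.≤-trans (QP.≤-reflexive (trans (sumL-cong S (λ {v} i → trans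
          (cong (val I v) (sym (agree (V⊆R v (in-V i))))) (scale (vl u v)))) (sumL-* S B (λ v → c v (get u v)))))
        (*-monoˡ (QP.<⇒≤ 0<B) h)
        where
        eq : ∀ x B u → x * (B * u) ≡ B * (x * u)
        eq = solve-∀ ℚring
        scale : ∀ x → x ≡ B * (x * inv B)
        scale x = trans (sym (QP.*-identityʳ x)) (trans (cong (x *_) (sym (*-inv 0<B))) (eq x B (inv B)))

  0<βB : ∀ {B} → 0ℚ < B → 0ℚ < β * B
  0<βB h = *-pos (QP.positive⁻¹ β) h

  -- A larger budget scales all costs down, and cheaper costs pass the test more easily.
  fl-budget : ∀ {B} (0<B : 0ℚ < B) V w → AtBudget.Lv.fl (β * B) (0<βB 0<B) V w ≤ AtBudget.Lv.fl B 0<B V w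
  fl-budget {B} 0<B V w = go (L₁.ok? V w)
    where
    module L₁ = AtBudget.Lv B 0<B
    module L₂ = AtBudget.Lv (β * B) (0<βB 0<B)
    go : Dec (L₁.Ok V w) → L₂.fl V w ≤ L₁.fl V w
    go (yes ok) = QP.≤-trans (QP.≤-reflexive (L₂.fl-ok (Ok-cheaper (k I) (AtBudget.c B 0<B) (AtBudget.c (β * B) (0<βB 0<B))
      (AtBudget.c-nn B 0<B) (AtBudget.c-nn (β * B) (0<βB 0<B))
      (λ v o → *-monoˡ (val-nonneg v o) (inv-anti 0<B (B≤βB (QP.<⇒≤ 0<B)))) {V} {w} ok))) (L₁.fl-nn V w)
    go (no ¬ok) = QP.≤-trans (L₂.fl≤1 V w) (QP.≤-reflexive (sym (L₁.fl-¬ok ¬ok)))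

  record Visited (B : ℚ) : Set where
    field
      V    : Fin (n I) → Bool
      R    : List (Fin (n I))
      V⊆R  : ∀ v → V v ≡ true → v ∈ R
      loop : lastPos (root I) R ≡ root I
      -- Two good paths add `2 B`, and `94 B = 92 β B`: the bound reproduces itself at the next
      -- budget.
      len  : walkLen (root I) R ≤ 92ℚ * B

  module Extend (B : ℚ) (0<B : 0ℚ < B) (vs : Visited B) where

    open Visited vs
    open AtBudget B 0<B

    new = St.step-lemma V
    b = proj₁ new
    e = proj₁ (proj₂ new)

    V₂ : Fin (n I) → Bool
    V₂ = St.V′ V b e

    Pb Pe R₂ : List (Fin (n I))
    Pb = St.P′ V b
    Pe = St.P′ V e
    R₂ = closed Pb ++ (closed Pe ++ R)

    V₂⊆R₂ : ∀ v → V₂ v ≡ true → v ∈ R₂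
    V₂⊆R₂ v h = go (V v) (mem Pb v) refl refl h
      where
      go : ∀ x y → V v ≡ x → mem Pb v ≡ y → x ∨ (y ∨ mem Pe v) ≡ true → v ∈ R₂
      go true  _     p q h = MP.∈-++⁺ʳ (closed Pb) (MP.∈-++⁺ʳ (closed Pe) (V⊆R v p))
      go false true  p q h = MP.∈-++⁺ˡ (MP.∈-++⁺ˡ (mem⇒∈ Pb q))
      go false false p q h = MP.∈-++⁺ʳ (closed Pb) (MP.∈-++⁺ˡ (MP.∈-++⁺ˡ (mem⇒∈ Pe h)))

    loop₂ : lastPos (root I) R₂ ≡ root I
    loop₂ = trans (lastPos-closed (root I) Pb (closed Pe ++ R)) (trans (lastPos-closed (root I) Pe R) loop)

    len₂ : walkLen (root I) R₂ ≤ 94ℚ * B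
    len₂ = QP.≤-trans (QP.≤-reflexive (trans (walkLen-closed (root I) Pb (closed Pe ++ R))
        (cong (tour (root I) Pb +_) (walkLen-closed (root I) Pe R))))
      (QP.≤-trans (QP.+-mono-≤ (tour-good V b) (QP.+-mono-≤ (tour-good V e) len)) (QP.≤-reflexive (eq B)))
      where
      eq : ∀ B → B + (B + 92ℚ * B) ≡ 94ℚ * B
      eq = solve-∀ ℚring

    visited₂ : Visited (β * B)
    visited₂ = record { V = V₂ ; R = R₂ ; V⊆R = V₂⊆R₂ ; loop = loop₂
      ; len = QP.≤-trans len₂ (QP.≤-reflexive (eq B)) }
      where
      eq : ∀ B → 94ℚ * B ≡ 92ℚ * (β * B)
      eq = solve-∀ ℚring

    phase : Phase
    phase = mkPhase V₂ R₂ V₂⊆R₂ loop₂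

  build : ℕ → (B : ℚ) → 0ℚ < B → Visited B → List Phase
  build zero    B 0<B vs = []
  build (suc r) B 0<B vs = Extend.phase B 0<B vs ∷ build r (β * B) (0<βB 0<B) (Extend.visited₂ B 0<B vs)

  allWalks : List W → List (Fin (n I))
  allWalks []       = []
  allWalks (w ∷ ws) = closed (path T* w) ++ allWalks ws

  ∈-allWalks : ∀ {w ws v} → w ∈ ws → v ∈ path T* w → v ∈ allWalks ws
  ∈-allWalks (here refl) i = MP.∈-++⁺ˡ (MP.∈-++⁺ˡ i)
  ∈-allWalks {ws = w ∷ ws} (there j) i = MP.∈-++⁺ʳ (closed (path T* w)) (∈-allWalks j i)

  allWalks-loop : ∀ ws → lastPos (root I) (allWalks ws) ≡ root I
  allWalks-loop []       = refl
  allWalks-loop (w ∷ ws) = trans (lastPos-closed (root I) (path T* w) (allWalks ws)) (allWalks-loop ws)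

  allWalks-0 : (∀ w → tour (root I) (path T* w) ≤ 0ℚ) → ∀ ws → walkLen (root I) (allWalks ws) ≤ 0ℚ
  allWalks-0 h []       = QP.≤-refl
  allWalks-0 h (w ∷ ws) = QP.≤-trans (QP.≤-reflexive (walkLen-closed (root I) (path T* w) (allWalks ws)))
    (QP.+-mono-≤ (h w) (allWalks-0 h ws))

  chosen-agree : ∀ {us} (T : Tr us) u M → (∀ {v} → v ∈ path T M → get u v ≡ get M v) → chosen T u ≡ chosen T M
  chosen-agree (fin l)             u M h = refl
  chosen-agree (visit {v = v} i f) u M h = trans (cong (λ o → chosen (f o) u) (h (here refl)))
    (chosen-agree (f (get M v)) u M (h ∘ there))

  R* : List (Fin (n I))
  R* = allWalks (allWorlds (n I) (m I))

  path⊆R* : ∀ w {v} → v ∈ path T* w → v ∈ R*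
  path⊆R* w = ∈-allWalks (∈-allWorlds w)

  -- `R*` runs through every path of `T*`, so one round reveals all that `T*` would see and the next
  -- can pick all that `T*` would choose.
  final : Final
  final = record
    { R = R* ; loop = allWalks-loop (allWorlds (n I) (m I))
    ; decide = chosen T*
    ; valid = λ u → picks-in (chosen-unique T* u) (chosen-length T* u) (λ {v} i → path⊆R* u (chosen⊆path T* u i (MP.∈-allFin v)))
    -- The picks are those of `T*` in the actual world, so on average they cost at most `A*`.
    ; spend = τ
    ; on-all = λ u M agree → QP.≤-trans (QP.≤-reflexive (cong (λ S → sumL S (vl M)) (chosen-agree T* u M (λ i → agree (path⊆R* M i))))) (chosen≤τ M)
    ; spend-nn = τ-nn
    }

  Eχτ : ∀ (χ : W → ℚ) → (∀ w → χ w ≤ 1ℚ) → E (prob I) (λ w → χ w * τ w) ≤ A*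
  Eχτ χ χ≤1 = E-mono P (λ w → QP.≤-trans (*-monoʳ (τ-nn w) (χ≤1 w)) (QP.≤-reflexive (QP.*-identityˡ (τ w))))

  E-const* : ∀ (χ : W → ℚ) z → E (prob I) (λ w → χ w * z) ≡ z * E (prob I) χ
  E-const* χ z = trans (E-cong (prob I) (λ w → QP.*-comm (χ w) z)) (E-* (prob I) z χ)

  Over : ℕ → ℚ → ℚ
  Over r B = E (prob I) (λ w → overrun r B (τ w))

  Over-suc : ∀ r B → Over (suc r) B ≡ B * qB B + Over r (β * B)
  Over-suc r B = trans (E-+ (prob I) (λ w → B * 𝟙 (not (leq (τ w) B))) (λ w → overrun r (β * B) (τ w)))
    (cong (_+ Over r (β * B)) (E-* (prob I) B (λ w → 𝟙 (not (leq (τ w) B)))))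

  -- A phase costs at most 1058 B = (2 · 94 + 2 C₀) B; further 50784 = 1058 / (1 - α₀ β) and 51888 = 50784 β.
  expected : ∀ r B 0<B vs (χ : W → ℚ) → (∀ w → 0ℚ ≤ χ w) → (∀ w → χ w ≤ 1ℚ) →
    (∀ w → AtBudget.Lv.fl B 0<B (Visited.V vs) w ≤ χ w) → twice R* ≤ (⁺ 50784 / 1) * (pow β r * B) →
    E (prob I) (λ w → χ w * G (build r B 0<B vs) final w) ≤ (⁺ 50784 / 1) * B * E (prob I) χ + (⁺ 51888 / 1) * Over r B + A*
  expected zero B 0<B vs χ χ-nn χ≤1 fl≤χ long = QP.≤-trans
    (QP.≤-reflexive (trans (E-cong (prob I) (λ w → QP.*-distribˡ-+ (χ w) (twice R*) (τ w))) (trans (E-+ (prob I) (λ w → χ w * twice R*) (λ w → χ w * τ w))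
      (cong (_+ E (prob I) (λ w → χ w * τ w)) (E-const* χ (twice R*))))))
    (QP.+-mono-≤ (QP.≤-trans (*-monoʳ (E-nn P χ-nn) (QP.≤-trans long (QP.≤-reflexive (cong ((⁺ 50784 / 1) *_) (QP.*-identityˡ B)))))
      (QP.≤-reflexive (sym (trans (cong (λ z → (⁺ 50784 / 1) * B * E (prob I) χ + (⁺ 51888 / 1) * z) (E-const P 0ℚ)) (eq ((⁺ 50784 / 1) * B * E (prob I) χ))))))
      (Eχτ χ χ≤1))
    where
    eq : ∀ z → z + (⁺ 51888 / 1) * 0ℚ ≡ z
    eq = solve-∀ ℚring
  expected (suc r) B 0<B vs χ χ-nn χ≤1 fl≤χ long = QP.≤-trans (QP.≤-reflexive split) (QP.≤-trans
    (QP.+-mono-≤ (*-monoʳ Eχ-nn fixed) (E-mono P drop-χ))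
    (QP.≤-trans (QP.+-monoʳ-≤ ((⁺ 1058 / 1) * B * Eχ) (QP.≤-trans ih (QP.+-monoˡ-≤ A* (QP.+-monoˡ-≤ ((⁺ 51888 / 1) * Over r (β * B))
      (*-monoˡ (*-nn (lit≤ {0ℚ} {(⁺ 50784 / 1)}) (QP.<⇒≤ (0<βB 0<B))) Efail)))))
      (QP.≤-reflexive (trans (eq B Eχ (qB B) (Over r (β * B)) A*) (cong (λ z → (⁺ 50784 / 1) * B * Eχ + (⁺ 51888 / 1) * z + A*) (sym (Over-suc r B)))))))
    where
    open AtBudget B 0<B
    open Extend B 0<B vs
    Eχ = E (prob I) χ
    Eχ-nn : 0ℚ ≤ Eχ
    Eχ-nn = E-nn P χ-nn
    fail : W → ℚ
    fail = Lv.fl V₂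
    K₀ = twice R₂ + budget-B
    g : W → ℚ
    g = G (build r (β * B) (0<βB 0<B) visited₂) final
    split : E (prob I) (λ w → χ w * (K₀ + fail w * g w)) ≡ K₀ * Eχ + E (prob I) (λ w → χ w * (fail w * g w))
    split = trans (E-cong (prob I) (λ w → QP.*-distribˡ-+ (χ w) K₀ (fail w * g w))) (trans (E-+ (prob I) (λ w → χ w * K₀) (λ w → χ w * (fail w * g w)))
      (cong (_+ E (prob I) (λ w → χ w * (fail w * g w))) (E-const* χ K₀)))
    fixed : K₀ ≤ (⁺ 1058 / 1) * B
    fixed = QP.≤-trans (QP.+-monoˡ-≤ budget-B (QP.+-mono-≤ len₂ len₂)) (QP.≤-reflexive (eq₀ B))
      where
      eq₀ : ∀ B → (⁺ 94 / 1) * B + (⁺ 94 / 1) * B + B * ((⁺ 2 / 1) * (⁺ 435 / 1)) ≡ (⁺ 1058 / 1) * B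
      eq₀ = solve-∀ ℚring
    -- The failure of the earlier phase is forgotten: `fail` alone serves as `χ` in the next phase,
    -- and the earlier failure enters only through `Efail`.
    drop-χ : ∀ w → χ w * (fail w * g w) ≤ fail w * g w
    drop-χ w = QP.≤-trans (*-monoʳ (*-nn (Lv.fl-nn V₂ w) (G-nn (build r (β * B) (0<βB 0<B) visited₂) final w)) (χ≤1 w))
      (QP.≤-reflexive (QP.*-identityˡ (fail w * g w)))
    Efail : E (prob I) fail ≤ α₀ * Eχ + qB B
    Efail = QP.≤-trans (proj₂ (proj₂ new)) (QP.+-monoˡ-≤ (qB B) (*-monoˡ (lit≤ {0ℚ} {α₀}) (E-mono P fl≤χ)))
    long′ : twice R* ≤ (⁺ 50784 / 1) * (pow β r * (β * B))
    long′ = QP.≤-trans long (QP.≤-reflexive (cong ((⁺ 50784 / 1) *_) (eq₁ (pow β r) B)))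
      where
      eq₁ : ∀ x B → β * x * B ≡ x * (β * B)
      eq₁ = solve-∀ ℚring
    ih : E (prob I) (λ w → fail w * g w) ≤ (⁺ 50784 / 1) * (β * B) * E (prob I) fail + (⁺ 51888 / 1) * Over r (β * B) + A*
    ih = expected r (β * B) (0<βB 0<B) visited₂ fail (Lv.fl-nn V₂) (Lv.fl≤1 V₂) (fl-budget 0<B V₂) long′
    eq : ∀ B x q o a → (⁺ 1058 / 1) * B * x + ((⁺ 50784 / 1) * ((⁺ 47 / 46) * B) * ((⁺ 23 / 24) * x + q) + (⁺ 51888 / 1) * o + a) ≡ (⁺ 50784 / 1) * B * x + (⁺ 51888 / 1) * (B * q + o) + a
    eq = solve-∀ ℚring

  A*-nn : 0ℚ ≤ A*
  A*-nn = E-nn P τ-nn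

  approx : ∃ λ ps → cost I (pol ps final w₀) (start I) ≤ (⁺ 2489521 / 1) * A*
  approx = go (≤⊎> A* 0ℚ)
    where
    go : A* ≤ 0ℚ ⊎ 0ℚ < A* → ∃ λ ps → cost I (pol ps final w₀) (start I) ≤ (⁺ 2489521 / 1) * A*
    -- Budgets proportional to `A* = 0` never grow. But then every path of `T*` is a closed tour of
    -- length zero, and the last resort alone costs `A*`.
    go (inj₁ A≤0) = [] , QP.≤-trans (pol-expected [] final) (QP.≤-trans
        (E-mono P (λ w → QP.+-mono-≤ (QP.+-mono-≤ R*-0 R*-0) (QP.≤-refl {τ w})))
        (QP.≤-trans (QP.≤-reflexive (E-cong (prob I) (λ w → QP.+-identityˡ (τ w)))) (≤-by ((⁺ 2489520 / 1) * A*) (*-nn (lit≤ {0ℚ} {⁺ 2489520 / 1}) A*-nn) (eq A*))))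
      where
      eq : ∀ x → (⁺ 2489521 / 1) * x ≡ x + (⁺ 2489520 / 1) * x
      eq = solve-∀ ℚring
      τ≤0 : ∀ w → τ w ≤ 0ℚ
      τ≤0 w with E-atom P prob-pos w
      ... | ε , 0<ε , h = *-cancelˡ 0<ε (QP.≤-trans (h τ τ-nn) (QP.≤-trans A≤0 (QP.≤-reflexive (sym (QP.*-zeroʳ ε)))))
      R*-0 : walkLen (root I) R* ≤ 0ℚ
      R*-0 = allWalks-0 (λ w → QP.≤-trans (tour≤τ w) (τ≤0 w)) (allWorlds (n I) (m I))
    go (inj₂ 0<A) = ps , QP.≤-trans (pol-expected ps final) (QP.≤-trans
        (QP.≤-reflexive (E-cong (prob I) (λ w → sym (QP.*-identityˡ (G ps final w)))))
        (QP.≤-trans (expected r A* 0<A vs (λ _ → 1ℚ) (λ _ → lit≤ {0ℚ} {1ℚ}) (λ _ → QP.≤-refl) (λ w → AtBudget.Lv.fl≤1 A* 0<A (λ _ → false) w) long)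
          (QP.≤-trans (QP.+-monoˡ-≤ A* (QP.+-mono-≤ (QP.≤-reflexive (cong ((⁺ 50784 / 1) * A* *_) (E-const P 1ℚ)))
            (*-monoˡ (lit≤ {0ℚ} {(⁺ 51888 / 1)}) (QP.≤-trans (E-mono P (λ w → overrun-≤ r (QP.<⇒≤ 0<A) (τ-nn w))) (QP.≤-reflexive (E-* (prob I) 47ℚ τ))))))
            (QP.≤-reflexive (eq A*)))))
      where
      far = growth (twice R*) (*-pos (QP.positive⁻¹ (⁺ 50784 / 1)) 0<A)
      r = proj₁ far
      vs : Visited A*
      vs = record { V = λ _ → false ; R = [] ; V⊆R = λ _ () ; loop = refl ; len = *-nn (lit≤ {0ℚ} {92ℚ}) A*-nn }
      ps = build r A* 0<A vs
      long : twice R* ≤ (⁺ 50784 / 1) * (pow β r * A*)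
      long = QP.≤-trans (proj₂ far) (QP.≤-reflexive (swap* (pow β r) (⁺ 50784 / 1) A*))
        where
        swap* : ∀ x k a → x * (k * a) ≡ k * (x * a)
        swap* = solve-∀ ℚring
      -- The three summands are the first phase with failure probability bounded by 1, the overruns
      -- with mean at most `47 A*`, and the picks of the last resort.
      eq : ∀ a → (⁺ 50784 / 1) * a * 1ℚ + (⁺ 51888 / 1) * ((⁺ 47 / 1) * a) + a ≡ (⁺ 2489521 / 1) * a
      eq = solve-∀ ℚring

theorem1p2 : Σ ℕ (λ c → (I : Instance) → ValidInstance I →
    Σ (Policy I) (λ t → NonAdaptive I t × Feasible I t (start I) ×
    ((t' : Policy I) → Feasible I t' (start I) →
    cost I t (start I) ≤ ℕ→ℚ c * cost I t' (start I))))
theorem1p2 = 2489521 , λ I VI →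
  let open Canonical I VI
      open Policies I VI
      open Approximation I VI
      ps = proj₁ approx
  in pol ps final w₀ , (order ps final , pol-follows ps final w₀) , pol-feasible ps final w₀ (start I) refl ,
     λ t′ fe → QP.≤-trans (proj₂ approx) (*-monoˡ (lit≤ {0ℚ} {ℕ→ℚ 2489521}) (A*≤ t′ fe))
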